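{- Let $\mathcal{K}\subseteq\mathbb{Z}^+$ be a finite set and let $h(u)=\sum_{r\in\mathcal{K}\cup\{0\}} c_r u^r\in\mathbb{F}_q[t][u]$ be a polynomial supported on $\mathcal{K}$ (so $c_r\neq 0$ for all $r\in\mathcal{K}$). Suppose $c_k\neq 0$ for some $k\in\mathcal{K}^*$. Suppose further that for every $g\in\mathbb{F}_q[t]\setminus\{0\}$ there exists $m_g\in\mathbb{G}_{\deg g}$ such that $h(m_g)\equiv 0 \pmod g$. Then there exist $\theta=\theta(\mathcal{K},q,\deg h)>0$ and $N_0=N_0(\mathcal{K},q,h,\theta)\in\mathbb{Z}^+$ such that for every integer $N>N_0$ and every $\beta\in\mathbb{K}_\infty$, $$\min_{x\in\mathbb{G}_N}\operatorname{ord}\{\beta h(x)\}\leq -\theta N.$$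
   Context: $\mathbb{F}_q$ is the finite field with $q$ elements, $p$ its characteristic. $\mathbb{K}=\mathbb{F}_q(t)$ and $\mathbb{K}_\infty=\mathbb{F}_q((1/t))$ is the field of formal Laurent series $\alpha=\sum_{i=-\infty}^n a_it^i$ ($a_i\in\mathbb{F}_q$). For $\alpha\neq0$ with leading coefficient $a_n\neq 0$, $\operatorname{ord}\alpha=n$; $\operatorname{ord}0=-\infty$ (for a polynomial, $\operatorname{ord}=\deg$, with $\deg 0=-\infty$). The fractional part is $\{\alpha\}=\sum_{i\le -1}a_it^i$. For $N\in\mathbb{Z}^+$ (or $N\ge 0$), $\mathbb{G}_N$ is the set of polynomials in $\mathbb{F}_q[t]$ of degree less than $N$ (including $0$). For $j,r\in\mathbb{Z}^+$ write $j\preceq_p r$ if $p\nmid\binom{r}{j}$. For $\mathcal{K}\subseteq\mathbb{Z}^+$, the shadow is $\mathcal{S}(\mathcal{K})=\{j\in\mathbb{Z}^+: j\preceq_p r\text{ for some } r\in\mathcal{K}\}$, and $\mathcal{K}^*=\{k\in\mathcal{K}: p\nmid k\text{ and } p^vk\notin\mathcal{S}(\mathcal{K})\text{ for every } v\in\mathbb{Z}^+\}$. A polynomial $f(u)\in\mathbb{K}_\infty[u]$ is supported on $\mathcal{K}$ if $f(u)=\sum_{r\in\mathcal{K}\cup\{0\}}\alpha_ru^r$ with $\alpha_r\neq 0$ for every $r\in\mathcal{K}$. -}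

module Defs where

open import Level using (0ℓ)
open import Data.Nat as ℕ using (ℕ; zero; suc; _^_)
open import Data.Nat.Divisibility using (_∣_)
open import Data.Nat.Combinatorics using (_C_)
open import Data.Integer as ℤ using (ℤ)
open import Data.Fin using (Fin)
open import Data.List using (List; []; _∷_; map; foldr)
open import Data.List.Membership.Propositional using (_∈_)
open import Data.Product using (Σ; ∃; _×_; _,_)
open import Relation.Nullary using (¬_)
open import Relation.Binary.PropositionalEquality using (_≡_; _≢_)
open import Algebra.Core using (Op₁; Op₂)
open import Algebra.Structures using (IsCommutativeRing)
open import Function.Bundles using (_↔_)

record FiniteField : Set₁ where
  field
    Carrier : Set
    _+_ _*_ : Op₂ Carrier
    -_ : Op₁ Carrier
    0# 1# : Carrier
    isCommutativeRing : IsCommutativeRing _≡_ _+_ _*_ -_ 0# 1#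
    0≢1 : 0# ≢ 1#
    inverse : ∀ x → x ≢ 0# → ∃ λ y → x * y ≡ 1#
    size : ℕ
    enumeration : Carrier ↔ Fin size

_⪯[_]_ : ℕ → ℕ → ℕ → Set
j ⪯[ p ] r = ¬ (p ∣ (r C j))

InShadow : ℕ → List ℕ → ℕ → Set
InShadow p 𝒦 j = (1 ℕ.≤ j) × ∃ λ r → (r ∈ 𝒦) × (j ⪯[ p ] r)

InKStar : ℕ → List ℕ → ℕ → Set
InKStar p 𝒦 k = (k ∈ 𝒦) × ¬ (p ∣ k)
  × (∀ v → 1 ℕ.≤ v → ¬ InShadow p 𝒦 (p ^ v ℕ.* k))

module _ (F : FiniteField) where
  open FiniteField F

  fromℕ : ℕ → Carrier
  fromℕ zero = 0#
  fromℕ (suc n) = 1# + fromℕ n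

  -- p is the characteristic (for prime p)
  HasCharacteristic : ℕ → Set
  HasCharacteristic p = fromℕ p ≡ 0#

  -- polynomials in F[t]: little-endian coefficient lists (trailing zeros allowed)
  Poly : Set
  Poly = List Carrier

  coeff : Poly → ℕ → Carrier
  coeff [] _ = 0#
  coeff (a ∷ f) zero = a
  coeff (a ∷ f) (suc i) = coeff f i

  _⊕_ : Poly → Poly → Poly
  [] ⊕ g = g
  (a ∷ f) ⊕ [] = a ∷ f
  (a ∷ f) ⊕ (b ∷ g) = (a + b) ∷ (f ⊕ g)

  _⊗_ : Poly → Poly → Poly
  [] ⊗ g = []
  (a ∷ f) ⊗ g = map (a *_) g ⊕ (0# ∷ (f ⊗ g))

  one : Poly
  one = 1# ∷ []

  _⊗^_ : Poly → ℕ → Poly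
  x ⊗^ zero = one
  x ⊗^ suc n = x ⊗ (x ⊗^ n)

  NonZeroPoly : Poly → Set
  NonZeroPoly f = ∃ λ i → coeff f i ≢ 0#

  HasDegree : Poly → ℕ → Set
  HasDegree f d = (coeff f d ≢ 0#) × (∀ i → d ℕ.< i → coeff f i ≡ 0#)

  InG : ℕ → Poly → Set
  InG N f = ∀ i → N ℕ.≤ i → coeff f i ≡ 0#

  PolyDivides : Poly → Poly → Set
  PolyDivides g f = ∃ λ a → ∀ i → coeff (a ⊗ g) i ≡ coeff f i

  -- h(x) = c 0 + Σ_{r ∈ 𝒦} c r · x^r, for 𝒦 a duplicate-free list
  evalH : List ℕ → (ℕ → Poly) → Poly → Poly
  evalH 𝒦 c x = foldr (λ r acc → (c r ⊗ (x ⊗^ r)) ⊕ acc) (c 0) 𝒦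

  -- elements of 𝕂_∞ = F((1/t)): coefficients a_i (i ∈ ℤ), zero above some bound
  record Laurent : Set where
    field
      lc : ℤ → Carrier
      top : ℤ
      bounded : ∀ i → top ℤ.< i → lc i ≡ 0#

  -- coefficient of t^i in β · f  (β ∈ 𝕂_∞, f ∈ F[t]);  f = c + t f'
  mulCoeff : (ℤ → Carrier) → Poly → ℤ → Carrier
  mulCoeff β [] i = 0#
  mulCoeff β (c ∷ f) i = (c * β i) + mulCoeff β f (i ℤ.- ℤ.+ 1)

  -- ord {β f} ≤ -(a/b)·N :  all coefficients at t^{-i} with 1 ≤ i and i < (a/b)N vanish
  FracOrdLe : Laurent → Poly → ℕ → ℕ → ℕ → Set
  FracOrdLe β f a b N =
    ∀ i → 1 ℕ.≤ i → b ℕ.* i ℕ.< a ℕ.* N → mulCoeff (Laurent.lc β) f (ℤ.- ℤ.+ i) ≡ 0#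

{-# OPTIONS --safe #-}

-- Only the linear functional f ↦ (coefficient of t⁻¹ in βf) on F[t] matters; M is a small multiple
-- of N throughout.  If some g ≠ 0 of degree O(M) makes it vanish on all gf with f of much larger
-- degree, then x = m_g works, because g divides h(m_g).  Otherwise one finds x for which the first M
-- fractional digits of β c_k x^k are those of - β c_0 and those of β c_r x^r are zero for r ≠ k.
--
-- Systems of conditions on the digits of β u x^j are solved by induction on the largest exponent s.
-- Put x = x₀ + v y.  A Chevalley–Warning argument provides v ≠ 0 of degree O(M) such that all terms
-- of top degree in v vanish.  The mixed terms are conditions on x₀ with exponents below s: they are
-- made zero, except that the digits of β u v^(s-1) x₀ are prescribed in such a way that the choice
-- of y then corrects the conditions of exponent s.  In the end only linear conditions are left, and
-- these are independent because the v's are chosen with rapidly increasing t-adic valuations.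
--
-- An exponent divisible by p is reduced by taking p-th roots, which replaces a functional μ by
-- f ↦ μ(f^p)^(1/p) and leads to the functionals Λ d (t^e β).  Those may be related to each other, so
-- one passes to a subfamily without relations of small degree that spans all of them up to a common
-- factor Q; this Q is absorbed by making v divisible by it.  As k ∈ K*, the condition on x^k is not
-- the p-th root of any other one, so that its target can be prescribed freely.
module Submission where

open import Defs
open import Level using (0ℓ)
open import Data.Nat as ℕ using (ℕ; zero; suc; _+_; _*_; _∸_; _^_; _≤_; _<_; z≤n; s≤s; _<?_; _!)
import Data.Nat.Properties as ℕₚ
open import Data.Nat.Properties using (≤-trans; ≤-reflexive; m≤n+m; m≤m+n; *-monoˡ-≤; <⇒≤; *-distribʳ-+; +-monoˡ-≤; +-monoʳ-≤; <⇒≱; *-monoʳ-≤; ≮⇒≥; <-≤-trans; m∸n≤m; n<1+n)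
open import Data.Nat.Primality using (Prime; euclidsLemma; prime⇒nonZero; prime⇒nonTrivial; prime⇒irreducible)
open import Data.Nat.Coprimality using (Coprime; coprime-Bézout)
open import Data.Nat.GCD using (module Bézout)
open import Data.Nat.Divisibility using (_∣_; _∣?_; divides; ∣⇒≤; m∣m*n)
open import Data.Nat.Combinatorics using (_C_; nCn≡1; nC1≡n; nCk≡nC[n∸k]; nCk≡n!/k![n-k]!; k![n∸k]!∣n!)
open import Data.Nat.DivMod using (_%_; _/_; m/n*n≡m; m<n⇒m%n≡m; [m+kn]%n≡m%n; m≡m%n+[m/n]*n; m%n<n; m/n≤m; m/n*n≤m; m*n/n≡m; /-monoˡ-≤)
open import Data.Nat.Induction using (<-rec)
open import Data.Integer as ℤ using (ℤ)
open import Data.Fin as Fin using (Fin; zero; suc; toℕ)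
import Data.Fin.Properties as Finₚ
open import Data.Fin.Properties using (toℕ<n; toℕ-fromℕ<; remQuot-combine)
open import Data.Bool using (Bool; true; false)
open import Data.Vec as Vec using (Vec; []; _∷_; lookup; replicate)
open import Data.Unit using (⊤; tt)
import Data.Vec.Properties as Vecₚ
import Data.Bool.Properties as Boolₚ
import Data.Nat.ListAction as ListAction
open import Data.List as List using (List; []; _∷_; map; foldr)
open import Data.List.Membership.Propositional using (_∈_)
open import Data.List.Membership.Propositional.Properties using (∈-map⁺)
open import Data.List.Relation.Unary.Any using (here; there)
open import Data.List.Relation.Unary.All as All using (All)
open import Data.List.Relation.Unary.AllPairs using (_∷_)
open import Data.List.Relation.Unary.Unique.Propositional using (Unique)
open import Data.Product using (∃; _×_; _,_; proj₁; proj₂)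
open import Data.Sum using (_⊎_; inj₁; inj₂)
open import Data.Empty using (⊥-elim)
open import Relation.Nullary using (¬_; Dec; yes; no; contradiction)
open import Relation.Nullary.Decidable using (via-injection; _×-dec_; ¬?; decidable-stable)
open import Relation.Binary.PropositionalEquality
  using (_≡_; _≢_; refl; sym; trans; cong; cong₂; subst; subst₂; module ≡-Reasoning)
import Relation.Binary.Reasoning.Setoid as SetoidReasoning
open import Relation.Binary.Bundles using (Setoid)
open import Function using (_∘_)
open import Function.Bundles using (Inverse)
open import Function.Properties.Inverse using (↔⇒↣)
open import Algebra.Bundles using (CommutativeRing)
import Algebra.Properties.CommutativeSemiring.Binomial as Binomial
import Algebra.Properties.Semiring.Sum as Sum
import Algebra.Properties.Semiring.Exp as Exp
import Algebra.Properties.Semiring.Mult as Mult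
import Algebra.Properties.CommutativeSemiring.Exp as CommutativeSemiringExp
import Algebra.Properties.Ring as RingProperties
import Algebra.Solver.Ring.NaturalCoefficients.Default as SemiringSolver

-- The correction y depends on the error that x₀ leaves at exponent s, yet the digits through which
-- y acts must be prescribed before x₀ is known. This is why `powerSurjectivity` produces
-- functionals γ that work for all targets at once: the γ themselves are imposed on x₀, and y is
-- chosen afterwards. The prescription is consistent because the place reserved for it, one factor
-- x₀ beside v^(s-1), is met by no other mixed term, with or without root extraction. Each v is a
-- p^L-th power, where p^L is above every exponent of h; so if the exponent of x₀ in a mixed term is
-- divisible by p, the roots to be taken are built from the same polynomials. How regular the family
-- must be depends on the size of Q, while every elimination of a relation enlarges Q; hence the
-- ranges are computed by recursion on the length of the family. All sizes are multiples of M whose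
-- factors depend only on 𝒦 and the field, so θ is chosen before the coefficients of h, which enter
-- the bounds only through the requirement that M exceed their lengths.

prime∤! : ∀ {p} → Prime p → ∀ k → k < p → ¬ (p ∣ k !)
prime∤! pr zero    _   p∣1 = <⇒≱ (ℕ.nonTrivial⇒n>1 _ {{prime⇒nonTrivial pr}}) (∣⇒≤ p∣1)
prime∤! pr (suc k) k<p p∣k! with euclidsLemma (suc k) (k !) pr p∣k!
... | inj₁ p∣k = <⇒≱ k<p (∣⇒≤ p∣k)
... | inj₂ p∣! = prime∤! pr k (ℕₚ.<-trans (n<1+n k) k<p) p∣!

prime∣C : ∀ {p} → Prime p → ∀ k → 0 < k → k < p → p ∣ (p C k)
prime∣C {zero} pr k _ ()
prime∣C {p@(suc p′)} pr k 0<k k<p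
  with euclidsLemma (p C k) (k ! * (p ∸ k) !) pr (subst (p ∣_) (sym C*!≡!) (m∣m*n (p′ !)))
  where
  instance _ = k ℕₚ.!* (p ∸ k) !≢0
  C*!≡! : (p C k) * (k ! * (p ∸ k) !) ≡ p !
  C*!≡! = trans (cong (_* (k ! * (p ∸ k) !)) (nCk≡n!/k![n-k]! (<⇒≤ k<p)))
                (m/n*n≡m (k![n∸k]!∣n! (<⇒≤ k<p)))
... | inj₁ p∣C = p∣C
... | inj₂ p∣!! with euclidsLemma (k !) ((p ∸ k) !) pr p∣!!
...   | inj₁ p∣k! = ⊥-elim (prime∤! pr k k<p p∣k!)
...   | inj₂ p∣! = ⊥-elim (prime∤! pr (p ∸ k) (ℕₚ.∸-monoʳ-< 0<k (<⇒≤ k<p)) p∣!)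

nC0≡1 : ∀ n → n C 0 ≡ 1
nC0≡1 n = trans (nCk≡nC[n∸k] {0} {n} z≤n) (nCn≡1 n)

module RingIdentities {c ℓ} (R : CommutativeRing c ℓ) where
  open CommutativeRing R using (_≈_; commutativeSemiring) renaming (_+_ to _⊹_; _*_ to _⊛_; refl to ≈-refl)
  open SemiringSolver commutativeSemiring using (solve; _:=_; _:+_; _:*_)

  +-interchange : ∀ a b c d → (a ⊹ b) ⊹ (c ⊹ d) ≈ (a ⊹ c) ⊹ (b ⊹ d)
  +-interchange = solve 4 (λ a b c d → (a :+ b) :+ (c :+ d) := (a :+ c) :+ (b :+ d)) ≈-refl

  *-leftSwap : ∀ a b c → a ⊛ (b ⊛ c) ≈ b ⊛ (a ⊛ c)
  *-leftSwap = solve 3 (λ a b c → a :* (b :* c) := b :* (a :* c)) ≈-refl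

module SumOverProduct {c ℓ} (R : CommutativeRing c ℓ) where
  open CommutativeRing R using (Carrier; _≈_; setoid; semiring; +-congˡ; +-assoc; +-identityˡ)
    renaming (_+_ to _+ʳ_; sym to ≈-sym; trans to ≈-trans; refl to ≈-refl)
  open Sum semiring using (sum)

  sum-++ : ∀ a {b} (f : Fin (a + b) → Carrier) → sum f ≈ sum (λ i → f (i Fin.↑ˡ b)) +ʳ sum (λ j → f (a Fin.↑ʳ j))
  sum-++ zero    f = ≈-sym (+-identityˡ _)
  sum-++ (suc a) f = ≈-trans (+-congˡ (sum-++ a (f ∘ suc))) (≈-sym (+-assoc _ _ _))

  sum-combine : ∀ m {k} (f : Fin (m * k) → Carrier) → sum f ≈ sum (λ i → sum (λ j → f (Fin.combine {m} {k} i j)))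
  sum-combine zero    f = ≈-refl
  sum-combine (suc m) {k} f = ≈-trans (sum-++ k f) (+-congˡ (sum-combine m (λ j → f (k Fin.↑ʳ j))))

-- Additivity of p-th powers in characteristic p

module Frobenius {c ℓ} (R : CommutativeRing c ℓ) {p : ℕ} (pr : Prime p) where
  open CommutativeRing R hiding (zero) renaming (_+_ to _+ʳ_; _*_ to _*ʳ_; refl to ≈-refl; sym to ≈-sym; trans to ≈-trans)
  open Exp semiring using () renaming (_^_ to _^ʳ_; ^-congˡ to ^ʳ-congˡ; ^-assocʳ to ^ʳ-assocʳ)
  open Mult semiring using () renaming (_×_ to _×ʳ_; ×-assocˡ to ×ʳ-assocˡ; ×-assoc-* to ×ʳ-assoc-*; ×-congʳ to ×ʳ-congʳ; ×-homo-1 to ×ʳ-homo-1)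
  open Sum semiring using (sum; sum-init-last; sum-cong-≋; sum-replicate-zero)
  open Binomial commutativeSemiring using (binomialTerm; theorem)
  open SetoidReasoning setoid

  module _ (char : p ×ʳ 1# ≈ 0#) where

    ∣⇒×≈0 : ∀ {n} → p ∣ n → ∀ x → n ×ʳ x ≈ 0#
    ∣⇒×≈0 (divides q refl) x = begin
      (q * p) ×ʳ x ≈⟨ ×ʳ-assocˡ x q p ⟨
      q ×ʳ (p ×ʳ x) ≈⟨ ×ʳ-congʳ q p×x≈0 ⟩
      q ×ʳ 0# ≈⟨ lemma q ⟩
      0# ∎
      where
      p×x≈0 : p ×ʳ x ≈ 0#
      p×x≈0 = begin
        p ×ʳ x ≈⟨ ×ʳ-congʳ p (*-identityˡ x) ⟨
        p ×ʳ (1# *ʳ x) ≈⟨ ×ʳ-assoc-* p 1# x ⟨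
        (p ×ʳ 1#) *ʳ x ≈⟨ *-congʳ char ⟩
        0# *ʳ x ≈⟨ zeroˡ x ⟩
        0# ∎
      lemma : ∀ q → q ×ʳ 0# ≈ 0#
      lemma zero    = ≈-refl
      lemma (suc q) = ≈-trans (+-identityˡ _) (lemma q)

    ^p-distrib-+ : ∀ x y → (x +ʳ y) ^ʳ p ≈ x ^ʳ p +ʳ y ^ʳ p
    ^p-distrib-+ x y = subst (λ k → (x +ʳ y) ^ʳ k ≈ x ^ʳ k +ʳ y ^ʳ k) (sym eq) (begin
      (x +ʳ y) ^ʳ suc n ≈⟨ theorem (suc n) x y ⟩
      t zero +ʳ sum (t ∘ suc) ≈⟨ +-congˡ (sum-init-last (t ∘ suc)) ⟩
      t zero +ʳ (sum (t ∘ suc ∘ Fin.inject₁) +ʳ t (suc (Fin.fromℕ n)))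
        ≈⟨ +-cong first (+-cong (≈-trans (sum-cong-≋ middle) (sum-replicate-zero n)) last′) ⟩
      y ^ʳ suc n +ʳ (0# +ʳ x ^ʳ suc n) ≈⟨ +-congˡ (+-identityˡ _) ⟩
      y ^ʳ suc n +ʳ x ^ʳ suc n ≈⟨ +-comm _ _ ⟩
      x ^ʳ suc n +ʳ y ^ʳ suc n ∎)
      where
      instance _ = prime⇒nonZero pr
      n = ℕ.pred p
      eq : p ≡ suc n
      eq = sym (ℕₚ.suc-pred p)
      t = binomialTerm x y (suc n)
      first : t zero ≈ y ^ʳ suc n
      first = ≈-trans (×ʳ-homo-1 _) (*-identityˡ _)
      middle : ∀ i → t (suc (Fin.inject₁ i)) ≈ 0#
      middle i = ∣⇒×≈0 (subst (_∣ (suc n C suc (toℕ (Fin.inject₁ i)))) (sym eq)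
        (prime∣C (subst Prime eq pr) _ (s≤s z≤n) (s≤s (subst (_< n) (sym (Finₚ.toℕ-inject₁ i)) (toℕ<n i))))) _
      last′ : t (suc (Fin.fromℕ n)) ≈ x ^ʳ suc n
      last′ rewrite Finₚ.toℕ-fromℕ n | nCn≡1 (suc n) | ℕₚ.n∸n≡0 n =
        ≈-trans (×ʳ-homo-1 _) (*-identityʳ _)

    ^p^-distrib-+ : ∀ n x y → (x +ʳ y) ^ʳ (p ^ n) ≈ x ^ʳ (p ^ n) +ʳ y ^ʳ (p ^ n)
    ^p^-distrib-+ zero    x y = ≈-trans (*-identityʳ _) (≈-sym (+-cong (*-identityʳ _) (*-identityʳ _)))
    ^p^-distrib-+ (suc n) x y = begin
      (x +ʳ y) ^ʳ (p * p ^ n) ≈⟨ ^ʳ-assocʳ (x +ʳ y) p (p ^ n) ⟨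
      ((x +ʳ y) ^ʳ p) ^ʳ (p ^ n) ≈⟨ ^ʳ-congˡ (p ^ n) (^p-distrib-+ x y) ⟩
      (x ^ʳ p +ʳ y ^ʳ p) ^ʳ (p ^ n) ≈⟨ ^p^-distrib-+ n (x ^ʳ p) (y ^ʳ p) ⟩
      (x ^ʳ p) ^ʳ (p ^ n) +ʳ (y ^ʳ p) ^ʳ (p ^ n) ≈⟨ +-cong (^ʳ-assocʳ x p (p ^ n)) (^ʳ-assocʳ y p (p ^ n)) ⟩
      x ^ʳ (p * p ^ n) +ʳ y ^ʳ (p * p ^ n) ∎

-- A missed value y could be adjoined to the image, giving an injection of n + 1 elements into n.
-- This is the source of p-th roots in the finite field.
injective⇒surjective : ∀ {n} (f : Fin n → Fin n) → (∀ {i j} → f i ≡ f j → i ≡ j) → ∀ y → ∃ λ x → f x ≡ y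
injective⇒surjective {n} f inj y with Finₚ.any? (λ x → f x Finₚ.≟ y)
... | yes p = p
... | no ¬p = contradiction (Finₚ.injective⇒≤ g-injective) (<⇒≱ (n<1+n n))
  where
  g : Fin (suc n) → Fin n
  g zero    = y
  g (suc i) = f i
  g-injective : ∀ {i j} → g i ≡ g j → i ≡ j
  g-injective {zero}  {zero}  _  = refl
  g-injective {zero}  {suc j} eq = contradiction (j , sym eq) ¬p
  g-injective {suc i} {zero}  eq = contradiction (i , eq) ¬p
  g-injective {suc i} {suc j} eq = cong suc (inj eq)

-- Arithmetic of the finite field and its p-power roots

module Field (F : FiniteField) where
  open FiniteField F public
    using (size; enumeration; 0≢1; inverse; isCommutativeRing)
    renaming (Carrier to 𝔽; _+_ to infixl 6 _∔_; _*_ to infixl 7 _·_; -_ to neg; 0# to 0f; 1# to 1f)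

  fieldRing : CommutativeRing 0ℓ 0ℓ
  fieldRing = record { isCommutativeRing = isCommutativeRing }

  open CommutativeRing fieldRing public
    using ()
    renaming (+-identityˡ to ∔-identityˡ; +-identityʳ to ∔-identityʳ; zeroˡ to ·-zeroˡ; zeroʳ to ·-zeroʳ
             ; *-identityˡ to ·-identityˡ; *-identityʳ to ·-identityʳ; +-comm to ∔-comm; *-comm to ·-comm
             ; +-assoc to ∔-assoc; *-assoc to ·-assoc; distribˡ to ·-distribˡ; distribʳ to ·-distribʳ
             ; -‿inverseˡ to neg-inverseˡ; -‿inverseʳ to neg-inverseʳ; semiring to fieldSemiring)
  open RingIdentities fieldRing public
    renaming (+-interchange to ∔-interchange
             ; *-leftSwap to ·-leftSwap)
  open RingProperties (CommutativeRing.ring fieldRing) public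
    using ()
    renaming (-‿distribˡ-* to neg-distribˡ-·; -‿distribʳ-* to neg-distribʳ-·; -‿+-comm to neg-∔-comm
             ; -0#≈0# to neg-0; -‿involutive to neg-involutive)
  open Exp fieldSemiring public using ()
    renaming (_^_ to infixr 8 _^f_; ^-assocʳ to ^f-assocʳ)
  open CommutativeSemiringExp (CommutativeRing.commutativeSemiring fieldRing) public using ()
    renaming (^-distrib-* to ^f-distrib-·)
  open Sum fieldSemiring public
    using () renaming (sum to sumf; sum-cong-≗ to sumf-cong; sum-replicate-zero to sumf-replicate-zero
                      ; ∑-distrib-+ to sumf-distrib-∔; *-distribˡ-sum to ·-distribˡ-sumf
                      ; *-distribʳ-sum to ·-distribʳ-sumf; sum-remove to sumf-remove)
  open Mult fieldSemiring public using () renaming (_×_ to _×f_; ×-assocˡ to ×f-assocˡ)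

  _≟f_ : (x y : 𝔽) → Dec (x ≡ y)
  _≟f_ = via-injection (↔⇒↣ enumeration) Finₚ._≟_

  inv : ∀ x → x ≢ 0f → 𝔽
  inv x x≢0 = proj₁ (inverse x x≢0)

  inv-inverseʳ : ∀ x x≢0 → x · inv x x≢0 ≡ 1f
  inv-inverseʳ x x≢0 = proj₂ (inverse x x≢0)

  inv-inverseˡ : ∀ x x≢0 → inv x x≢0 · x ≡ 1f
  inv-inverseˡ x x≢0 = trans (·-comm _ _) (inv-inverseʳ x x≢0)

  noZeroDivisors : ∀ {x y} → x ≢ 0f → x · y ≡ 0f → y ≡ 0f
  noZeroDivisors {x} {y} x≢0 xy≡0 = begin
    y ≡⟨ ·-identityˡ y ⟨
    1f · y ≡⟨ cong (_· y) (inv-inverseˡ x x≢0) ⟨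
    inv x x≢0 · x · y ≡⟨ ·-assoc _ x y ⟩
    inv x x≢0 · (x · y) ≡⟨ cong (inv x x≢0 ·_) xy≡0 ⟩
    inv x x≢0 · 0f ≡⟨ ·-zeroʳ _ ⟩
    0f ∎
    where open ≡-Reasoning

  ·-≢0 : ∀ {x y} → x ≢ 0f → y ≢ 0f → x · y ≢ 0f
  ·-≢0 x≢0 y≢0 xy≡0 = y≢0 (noZeroDivisors x≢0 xy≡0)

  ∔-cancelʳ-0 : ∀ {x y} → x ∔ y ≡ y → x ≡ 0f
  ∔-cancelʳ-0 {x} {y} eq = begin
    x ≡⟨ ∔-identityʳ x ⟨
    x ∔ 0f ≡⟨ cong (x ∔_) (neg-inverseʳ y) ⟨
    x ∔ (y ∔ neg y) ≡⟨ ∔-assoc x y (neg y) ⟨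
    x ∔ y ∔ neg y ≡⟨ cong (_∔ neg y) eq ⟩
    y ∔ neg y ≡⟨ neg-inverseʳ y ⟩
    0f ∎
    where open ≡-Reasoning

  ∔-cancelʳ : ∀ {x y z} → x ∔ z ≡ y ∔ z → x ≡ y
  ∔-cancelʳ {x} {y} {z} = RingProperties.+-cancelʳ (CommutativeRing.ring fieldRing) z x y

  x∔negy≡0⇒x≡y : ∀ {x y} → x ∔ neg y ≡ 0f → x ≡ y
  x∔negy≡0⇒x≡y {x} {y} eq = begin
    x ≡⟨ ∔-identityʳ x ⟨
    x ∔ 0f ≡⟨ cong (x ∔_) (neg-inverseˡ y) ⟨
    x ∔ (neg y ∔ y) ≡⟨ ∔-assoc x (neg y) y ⟨
    x ∔ neg y ∔ y ≡⟨ cong (_∔ y) eq ⟩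
    0f ∔ y ≡⟨ ∔-identityˡ y ⟩
    y ∎
    where open ≡-Reasoning

  neg-cancel : ∀ x y → x ∔ neg y ∔ y ≡ x
  neg-cancel x y = trans (∔-assoc x (neg y) y) (trans (cong (x ∔_) (neg-inverseˡ y)) (∔-identityʳ x))

  ^f-≡0 : ∀ n {x} → x ^f n ≡ 0f → x ≡ 0f
  ^f-≡0 zero    1≡0 = contradiction (sym 1≡0) 0≢1
  ^f-≡0 (suc n) {x} xⁿ≡0 with x ≟f 0f
  ... | yes x≡0 = x≡0
  ... | no  x≢0 = ^f-≡0 n (noZeroDivisors x≢0 xⁿ≡0)

  0^f : ∀ n → 0 < n → 0f ^f n ≡ 0f
  0^f (suc n) _ = ·-zeroˡ _

  endo-surjective : (f : 𝔽 → 𝔽) → (∀ {x y} → f x ≡ f y → x ≡ y) → ∀ y → ∃ λ x → f x ≡ y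
  endo-surjective f inj y = from (proj₁ pre) , trans (sym (from-to (f (from (proj₁ pre))))) (trans (cong from (proj₂ pre)) (from-to y))
    where
    open Inverse enumeration using (to; from; strictlyInverseˡ; strictlyInverseʳ)
    from-to = strictlyInverseʳ
    pre : ∃ λ i → to (f (from i)) ≡ to y
    pre = injective⇒surjective (to ∘ f ∘ from)
            (λ {i} {j} eq → trans (sym (strictlyInverseˡ i)) (trans (cong to (inj (trans (sym (from-to _)) (trans (cong from eq) (from-to _))))) (strictlyInverseˡ j)))
            (to y)

  module Characteristic {p : ℕ} (pr : Prime p) (charp : HasCharacteristic F p) where
    open Frobenius fieldRing pr

    char× : p ×f 1f ≡ 0f
    char× = trans (×≡fromℕ p) charp
      where
      ×≡fromℕ : ∀ n → n ×f 1f ≡ fromℕ F n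
      ×≡fromℕ zero    = refl
      ×≡fromℕ (suc n) = cong (1f ∔_) (×≡fromℕ n)

    ^p^-distrib-∔ : ∀ n x y → (x ∔ y) ^f (p ^ n) ≡ x ^f (p ^ n) ∔ y ^f (p ^ n)
    ^p^-distrib-∔ = ^p^-distrib-+ char×

    -- The power map is additive, so injectivity reduces to the absence of nilpotent elements; on a
    -- finite set the map is then also onto, which provides `root`.
    ^p^-injective : ∀ n {x y} → x ^f (p ^ n) ≡ y ^f (p ^ n) → x ≡ y
    ^p^-injective n {x} {y} eq = x∔negy≡0⇒x≡y (^f-≡0 (p ^ n) (∔-cancelʳ-0 (begin
      (x ∔ neg y) ^f q ∔ y ^f q ≡⟨ ^p^-distrib-∔ n (x ∔ neg y) y ⟨
      (x ∔ neg y ∔ y) ^f q ≡⟨ cong (_^f q) (neg-cancel x y) ⟩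
      x ^f q ≡⟨ eq ⟩
      y ^f q ∎)))
      where
      open ≡-Reasoning
      q = p ^ n

    opaque
      root : ℕ → 𝔽 → 𝔽
      root n a = proj₁ (endo-surjective (_^f (p ^ n)) (^p^-injective n) a)

      root-^ : ∀ n a → root n a ^f (p ^ n) ≡ a
      root-^ n a = proj₂ (endo-surjective (_^f (p ^ n)) (^p^-injective n) a)

    0<p^ : ∀ n → 0 < p ^ n
    0<p^ n = ℕₚ.m^n>0 p {{prime⇒nonZero pr}} n

    root-∔ : ∀ n a b → root n (a ∔ b) ≡ root n a ∔ root n b
    root-∔ n a b = ^p^-injective n (trans (root-^ n (a ∔ b))
      (sym (trans (^p^-distrib-∔ n _ _) (cong₂ _∔_ (root-^ n a) (root-^ n b)))))

    -- Taking roots turns a p^n-semilinear map into a linear one; this makes `Λ` linear over the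
    -- field.
    root-· : ∀ n a b → root n (a ^f (p ^ n) · b) ≡ a · root n b
    root-· n a b = ^p^-injective n (trans (root-^ n _)
      (sym (trans (^f-distrib-· a _ (p ^ n)) (cong (a ^f (p ^ n) ·_) (root-^ n b)))))

    multiple-×≡0 : ∀ m {n} → n ×f 1f ≡ 0f → (m * n) ×f 1f ≡ 0f
    multiple-×≡0 m {n} n≡0 = begin
      (m * n) ×f 1f ≡⟨ ×f-assocˡ 1f m n ⟨
      m ×f (n ×f 1f) ≡⟨ cong (m ×f_) n≡0 ⟩
      m ×f 0f ≡⟨ ×f-zero m ⟩
      0f ∎
      where
      open ≡-Reasoning
      ×f-zero : ∀ m → m ×f 0f ≡ 0f
      ×f-zero zero    = refl
      ×f-zero (suc m) = trans (∔-identityˡ _) (×f-zero m)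

    -- By Bézout, 1 is an integral combination of p and n, and both would vanish in the field.
    p∤⇒×≢0 : ∀ n → ¬ (p ∣ n) → n ×f 1f ≢ 0f
    p∤⇒×≢0 n p∤n n≡0 with coprime-Bézout coprime
      where
      coprime : Coprime p n
      coprime (d∣p , d∣n) with prime⇒irreducible pr d∣p
      ... | inj₁ d≡1 = d≡1
      ... | inj₂ refl = contradiction d∣n p∤n
    ... | Bézout.+- x y eq = 0≢1 (begin
      0f ≡⟨ multiple-×≡0 x char× ⟨
      (x * p) ×f 1f ≡⟨ cong (_×f 1f) eq ⟨
      1f ∔ (y * n) ×f 1f ≡⟨ cong (1f ∔_) (multiple-×≡0 y n≡0) ⟩
      1f ∔ 0f ≡⟨ ∔-identityʳ 1f ⟩
      1f ∎)
      where open ≡-Reasoning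
    ... | Bézout.-+ x y eq = 0≢1 (begin
      0f ≡⟨ multiple-×≡0 y n≡0 ⟨
      (y * n) ×f 1f ≡⟨ cong (_×f 1f) eq ⟨
      1f ∔ (x * p) ×f 1f ≡⟨ cong (1f ∔_) (multiple-×≡0 x char×) ⟩
      1f ∔ 0f ≡⟨ ∔-identityʳ 1f ⟩
      1f ∎)
      where open ≡-Reasoning

-- The polynomial ring over the field

module Polynomials (F : FiniteField) where
  open Field F public

  Pol : Set
  Pol = Poly F

  coef : Pol → ℕ → 𝔽
  coef = coeff F

  infixl 6 _⊞_
  infixl 7 _⊠_
  infix 4 _≈_

  scale : 𝔽 → Pol → Pol
  scale a = map (a ·_)

  -- a record rather than a function type, so that f and g can be inferred from an equation
  record _≈_ (f g : Pol) : Set where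
    constructor mk≈
    field at : ∀ i → coef f i ≡ coef g i
  open _≈_ public

  ≈-refl : ∀ {f} → f ≈ f
  ≈-refl = mk≈ λ i → refl

  ≈-sym : ∀ {f g} → f ≈ g → g ≈ f
  ≈-sym e = mk≈ λ i → sym (at e i)

  ≈-trans : ∀ {f g h} → f ≈ g → g ≈ h → f ≈ h
  ≈-trans d e = mk≈ λ i → trans (at d i) (at e i)

  polySetoid : Setoid 0ℓ 0ℓ
  polySetoid = record
    { Carrier = Pol ; _≈_ = _≈_
    ; isEquivalence = record { refl = ≈-refl ; sym = ≈-sym ; trans = ≈-trans } }

  module ≈-Reasoning = SetoidReasoning polySetoid

  constant : 𝔽 → Pol
  constant a = a ∷ []

  opaque
    _⊞_ _⊠_ : Pol → Pol → Pol
    _⊞_ = _⊕_ F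
    _⊠_ = _⊗_ F

    coef-⊞ : ∀ f g i → coef (f ⊞ g) i ≡ coef f i ∔ coef g i
    coef-⊞ []      g       i       = sym (∔-identityˡ _)
    coef-⊞ (a ∷ f) []      i       = sym (∔-identityʳ _)
    coef-⊞ (a ∷ f) (b ∷ g) zero    = refl
    coef-⊞ (a ∷ f) (b ∷ g) (suc i) = coef-⊞ f g i

    coef-scale : ∀ a f i → coef (scale a f) i ≡ a · coef f i
    coef-scale a []      i       = sym (·-zeroʳ a)
    coef-scale a (b ∷ f) zero    = refl
    coef-scale a (b ∷ f) (suc i) = coef-scale a f i

    coef-neg : ∀ f i → coef (map neg f) i ≡ neg (coef f i)
    coef-neg []      i       = sym neg-0
    coef-neg (b ∷ f) zero    = refl
    coef-neg (b ∷ f) (suc i) = coef-neg f i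

    ⊞-cong : ∀ {f f′ g g′} → f ≈ f′ → g ≈ g′ → f ⊞ g ≈ f′ ⊞ g′
    ⊞-cong {f} {f′} {g} {g′} d e = mk≈ λ i →
      trans (coef-⊞ f g i) (trans (cong₂ _∔_ (at d i) (at e i)) (sym (coef-⊞ f′ g′ i)))

    ⊞-assoc : ∀ f g h → (f ⊞ g) ⊞ h ≈ f ⊞ (g ⊞ h)
    ⊞-assoc f g h = mk≈ λ i → begin
      coef ((f ⊞ g) ⊞ h) i ≡⟨ coef-⊞ (f ⊞ g) h i ⟩
      coef (f ⊞ g) i ∔ coef h i ≡⟨ cong (_∔ coef h i) (coef-⊞ f g i) ⟩
      coef f i ∔ coef g i ∔ coef h i ≡⟨ ∔-assoc _ _ _ ⟩
      coef f i ∔ (coef g i ∔ coef h i) ≡⟨ cong (coef f i ∔_) (coef-⊞ g h i) ⟨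
      coef f i ∔ coef (g ⊞ h) i ≡⟨ coef-⊞ f (g ⊞ h) i ⟨
      coef (f ⊞ (g ⊞ h)) i ∎
      where open ≡-Reasoning

    ⊞-comm : ∀ f g → f ⊞ g ≈ g ⊞ f
    ⊞-comm f g = mk≈ λ i → trans (coef-⊞ f g i) (trans (∔-comm _ _) (sym (coef-⊞ g f i)))

    ⊞-identityˡ : ∀ f → [] ⊞ f ≈ f
    ⊞-identityˡ f = ≈-refl

    ⊞-identityʳ : ∀ f → f ⊞ [] ≈ f
    ⊞-identityʳ f = ⊞-comm f []

    neg-cong : ∀ {f g} → f ≈ g → map neg f ≈ map neg g
    neg-cong {f} {g} e = mk≈ λ i → trans (coef-neg f i) (trans (cong neg (at e i)) (sym (coef-neg g i)))

    ⊞-inverseʳ : ∀ f → f ⊞ map neg f ≈ []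
    ⊞-inverseʳ f = mk≈ λ i → trans (coef-⊞ f (map neg f) i) (trans (cong (coef f i ∔_) (coef-neg f i)) (neg-inverseʳ _))

    ∷-cong : ∀ {a b f g} → a ≡ b → f ≈ g → a ∷ f ≈ b ∷ g
    ∷-cong refl e = mk≈ λ { zero → refl ; (suc i) → at e i }

    0∷[]≈[] : 0f ∷ [] ≈ []
    0∷[]≈[] = mk≈ λ { zero → refl ; (suc i) → refl }

    scale-cong : ∀ a {f g} → f ≈ g → scale a f ≈ scale a g
    scale-cong a {f} {g} e = mk≈ λ i → trans (coef-scale a f i) (trans (cong (a ·_) (at e i)) (sym (coef-scale a g i)))

    scale-⊞ : ∀ a f g → scale a (f ⊞ g) ≈ scale a f ⊞ scale a g
    scale-⊞ a f g = mk≈ λ i → begin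
      coef (scale a (f ⊞ g)) i ≡⟨ coef-scale a (f ⊞ g) i ⟩
      a · coef (f ⊞ g) i ≡⟨ cong (a ·_) (coef-⊞ f g i) ⟩
      a · (coef f i ∔ coef g i) ≡⟨ ·-distribˡ a _ _ ⟩
      a · coef f i ∔ a · coef g i ≡⟨ cong₂ _∔_ (coef-scale a f i) (coef-scale a g i) ⟨
      coef (scale a f) i ∔ coef (scale a g) i ≡⟨ coef-⊞ (scale a f) (scale a g) i ⟨
      coef (scale a f ⊞ scale a g) i ∎
      where open ≡-Reasoning

    scale-· : ∀ a b f → scale (a · b) f ≈ scale a (scale b f)
    scale-· a b f = mk≈ λ i → trans (coef-scale (a · b) f i) (trans (·-assoc a b _)
      (sym (trans (coef-scale a (scale b f) i) (cong (a ·_) (coef-scale b f i)))))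

    scale-1 : ∀ f → scale 1f f ≈ f
    scale-1 f = mk≈ λ i → trans (coef-scale 1f f i) (·-identityˡ _)

    scale-0 : ∀ f → scale 0f f ≈ []
    scale-0 f = mk≈ λ i → trans (coef-scale 0f f i) (·-zeroˡ _)

    ⊞-interchange : ∀ a b c d → (a ⊞ b) ⊞ (c ⊞ d) ≈ (a ⊞ c) ⊞ (b ⊞ d)
    ⊞-interchange a b c d = mk≈ λ i → trans (four a b c d i) (trans (∔-interchange _ _ _ _) (sym (four a c b d i)))
      where
      four : ∀ a b c d i → coef ((a ⊞ b) ⊞ (c ⊞ d)) i ≡ (coef a i ∔ coef b i) ∔ (coef c i ∔ coef d i)
      four a b c d i = trans (coef-⊞ (a ⊞ b) (c ⊞ d) i) (cong₂ _∔_ (coef-⊞ a b i) (coef-⊞ c d i))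

    ⊠-zeroʳ : ∀ f → f ⊠ [] ≈ []
    ⊠-zeroʳ []      = ≈-refl
    ⊠-zeroʳ (a ∷ f) = ≈-trans (∷-cong refl (⊠-zeroʳ f)) 0∷[]≈[]

    ⊠-congˡ : ∀ f {g h} → g ≈ h → f ⊠ g ≈ f ⊠ h
    ⊠-congˡ []      e = ≈-refl
    ⊠-congˡ (a ∷ f) e = ⊞-cong (scale-cong a e) (∷-cong refl (⊠-congˡ f e))

    ⊠-distribˡ : ∀ f g h → f ⊠ (g ⊞ h) ≈ f ⊠ g ⊞ f ⊠ h
    ⊠-distribˡ []      g h = ≈-refl
    ⊠-distribˡ (a ∷ f) g h = begin
      scale a (g ⊞ h) ⊞ (0f ∷ f ⊠ (g ⊞ h))
        ≈⟨ ⊞-cong (scale-⊞ a g h) (∷-cong (sym (∔-identityˡ 0f)) (⊠-distribˡ f g h)) ⟩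
      (scale a g ⊞ scale a h) ⊞ ((0f ∷ f ⊠ g) ⊞ (0f ∷ f ⊠ h))
        ≈⟨ ⊞-interchange (scale a g) (scale a h) _ _ ⟩
      (scale a g ⊞ (0f ∷ f ⊠ g)) ⊞ (scale a h ⊞ (0f ∷ f ⊠ h)) ∎
      where open ≈-Reasoning

    ⊠-scaleʳ : ∀ f a g → f ⊠ scale a g ≈ scale a (f ⊠ g)
    ⊠-scaleʳ []      a g = ≈-refl
    ⊠-scaleʳ (b ∷ f) a g = begin
      scale b (scale a g) ⊞ (0f ∷ f ⊠ scale a g)
        ≈⟨ ⊞-cong (≈-trans (≈-sym (scale-· b a g)) (≈-trans (mk≈ λ i → cong (λ c → coef (scale c g) i) (·-comm b a)) (scale-· a b g)))
                  (∷-cong (sym (·-zeroʳ a)) (⊠-scaleʳ f a g)) ⟩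
      scale a (scale b g) ⊞ scale a (0f ∷ f ⊠ g)
        ≈⟨ scale-⊞ a (scale b g) _ ⟨
      scale a (scale b g ⊞ (0f ∷ f ⊠ g)) ∎
      where open ≈-Reasoning

    ⊠-shiftʳ : ∀ f g → f ⊠ (0f ∷ g) ≈ 0f ∷ f ⊠ g
    ⊠-shiftʳ []      g = ≈-sym 0∷[]≈[]
    ⊠-shiftʳ (a ∷ f) g = begin
      scale a (0f ∷ g) ⊞ (0f ∷ f ⊠ (0f ∷ g))
        ≈⟨ ⊞-cong {scale a (0f ∷ g)} (∷-cong (·-zeroʳ a) ≈-refl) (∷-cong refl (⊠-shiftʳ f g)) ⟩
      (0f ∔ 0f) ∷ (scale a g ⊞ (0f ∷ f ⊠ g))
        ≈⟨ ∷-cong (∔-identityˡ 0f) ≈-refl ⟩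
      0f ∷ (scale a g ⊞ (0f ∷ f ⊠ g)) ∎
      where open ≈-Reasoning

    ∷-split : ∀ a f → a ∷ f ≈ (a ∷ []) ⊞ (0f ∷ f)
    ∷-split a f = ∷-cong (sym (∔-identityʳ a)) ≈-refl

    constant-⊠ : ∀ a f → constant a ⊠ f ≈ scale a f
    constant-⊠ a f = ≈-trans (⊞-cong {scale a f} ≈-refl 0∷[]≈[]) (⊞-identityʳ _)

    ⊠-constant : ∀ f a → f ⊠ constant a ≈ scale a f
    ⊠-constant []      a = ≈-refl
    ⊠-constant (b ∷ f) a = ∷-cong (trans (∔-identityʳ _) (·-comm b a)) (⊠-constant f a)

    ⊠-comm : ∀ f g → f ⊠ g ≈ g ⊠ f
    ⊠-comm []      g = ≈-sym (⊠-zeroʳ g)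
    ⊠-comm (a ∷ f) g = begin
      scale a g ⊞ (0f ∷ f ⊠ g) ≈⟨ ⊞-cong (≈-sym (⊠-constant g a)) (≈-trans (∷-cong refl (⊠-comm f g)) (≈-sym (⊠-shiftʳ g f))) ⟩
      g ⊠ constant a ⊞ g ⊠ (0f ∷ f) ≈⟨ ⊠-distribˡ g (constant a) (0f ∷ f) ⟨
      g ⊠ (constant a ⊞ (0f ∷ f)) ≈⟨ ⊠-congˡ g (∷-split a f) ⟨
      g ⊠ (a ∷ f) ∎
      where open ≈-Reasoning

    ⊠-cong : ∀ {f f′ g g′} → f ≈ f′ → g ≈ g′ → f ⊠ g ≈ f′ ⊠ g′
    ⊠-cong {f} {f′} {g} {g′} d e = begin
      f ⊠ g ≈⟨ ⊠-congˡ f e ⟩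
      f ⊠ g′ ≈⟨ ⊠-comm f g′ ⟩
      g′ ⊠ f ≈⟨ ⊠-congˡ g′ d ⟩
      g′ ⊠ f′ ≈⟨ ⊠-comm g′ f′ ⟩
      f′ ⊠ g′ ∎
      where open ≈-Reasoning

    ⊠-distribʳ : ∀ f g h → (g ⊞ h) ⊠ f ≈ g ⊠ f ⊞ h ⊠ f
    ⊠-distribʳ f g h = ≈-trans (⊠-comm (g ⊞ h) f) (≈-trans (⊠-distribˡ f g h) (⊞-cong (⊠-comm f g) (⊠-comm f h)))

    ⊠-scaleˡ : ∀ a f g → scale a f ⊠ g ≈ scale a (f ⊠ g)
    ⊠-scaleˡ a f g = ≈-trans (⊠-comm (scale a f) g) (≈-trans (⊠-scaleʳ g a f) (scale-cong a (⊠-comm g f)))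

    ⊠-shiftˡ : ∀ f g → (0f ∷ f) ⊠ g ≈ 0f ∷ f ⊠ g
    ⊠-shiftˡ f g = ⊞-cong (scale-0 g) ≈-refl

    ⊠-assoc : ∀ f g h → (f ⊠ g) ⊠ h ≈ f ⊠ (g ⊠ h)
    ⊠-assoc []      g h = ≈-refl
    ⊠-assoc (a ∷ f) g h = begin
      (scale a g ⊞ (0f ∷ f ⊠ g)) ⊠ h ≈⟨ ⊠-distribʳ h (scale a g) _ ⟩
      scale a g ⊠ h ⊞ (0f ∷ f ⊠ g) ⊠ h ≈⟨ ⊞-cong (⊠-scaleˡ a g h) (⊠-shiftˡ (f ⊠ g) h) ⟩
      scale a (g ⊠ h) ⊞ (0f ∷ (f ⊠ g) ⊠ h) ≈⟨ ⊞-cong {scale a (g ⊠ h)} ≈-refl (∷-cong refl (⊠-assoc f g h)) ⟩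
      scale a (g ⊠ h) ⊞ (0f ∷ f ⊠ (g ⊠ h)) ∎
      where open ≈-Reasoning

  1p : Pol
  1p = one F

  ⊠-identityˡ : ∀ f → 1p ⊠ f ≈ f
  ⊠-identityˡ f = ≈-trans (constant-⊠ 1f f) (scale-1 f)

  polyRing : CommutativeRing 0ℓ 0ℓ
  polyRing = record
    { Carrier = Pol ; _≈_ = _≈_ ; _+_ = _⊞_ ; _*_ = _⊠_ ; -_ = map neg ; 0# = [] ; 1# = 1p
    ; isCommutativeRing = record
      { isRing = record
        { +-isAbelianGroup = record
          { isGroup = record
            { isMonoid = record
              { isSemigroup = record
                { isMagma = record
                  { isEquivalence = record { refl = ≈-refl ; sym = ≈-sym ; trans = ≈-trans }
                  ; ∙-cong = ⊞-cong }
                ; assoc = ⊞-assoc }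
              ; identity = ⊞-identityˡ , ⊞-identityʳ }
            ; inverse = (λ f → ≈-trans (⊞-comm (map neg f) f) (⊞-inverseʳ f)) , ⊞-inverseʳ
            ; ⁻¹-cong = λ {f} {g} e → mk≈ λ i → trans (coef-neg f i) (trans (cong neg (at e i)) (sym (coef-neg g i))) }
          ; comm = ⊞-comm }
        ; *-cong = ⊠-cong
        ; *-assoc = ⊠-assoc
        ; *-identity = ⊠-identityˡ , (λ f → ≈-trans (⊠-comm f 1p) (⊠-identityˡ f))
        ; distrib = ⊠-distribˡ , ⊠-distribʳ }
      ; *-comm = ⊠-comm } }

  open CommutativeRing polyRing public
    using ()
    renaming (semiring to polySemiring; *-identityʳ to ⊠-identityʳ; zeroˡ to ⊠-zeroˡ)
  open RingIdentities polyRing public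
    using ()
    renaming (*-leftSwap to ⊠-leftSwap)
  open Exp polySemiring public using ()
    renaming (_^_ to infixr 8 _^p_; ^-congˡ to ^p-cong; ^-congʳ to ^p-congʳ; ^-assocʳ to ^p-assocʳ)
  open CommutativeSemiringExp (CommutativeRing.commutativeSemiring polyRing) public using ()
    renaming (^-distrib-* to ^p-distrib-⊠)
  open Sum polySemiring public
    using () renaming (sum to sump; sum-cong-≋ to sump-cong
                      ; ∑-comm to sump-comm; *-distribˡ-sum to ⊠-distribˡ-sump
                      ; *-distribʳ-sum to ⊠-distribʳ-sump)
  open Mult polySemiring public using () renaming (_×_ to _×p_; ×-assoc-* to ×p-assoc-⊠; ×-congʳ to ×p-congʳ; ×-comm-* to ×p-comm-⊠)

-- Degrees, leading coefficients and powers of t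

module Degrees (F : FiniteField) where
  open Polynomials F public

  infix 4 _∈G_

  record _∈G_ (f : Pol) (n : ℕ) : Set where
    constructor mkG
    field vanish : ∀ i → n ≤ i → coef f i ≡ 0f
  open _∈G_ public

  G-≤ : ∀ {f m n} → m ≤ n → f ∈G m → f ∈G n
  G-≤ m≤n e = mkG λ i n≤i → vanish e i (≤-trans m≤n n≤i)

  G-≈ : ∀ {f g n} → f ≈ g → f ∈G n → g ∈G n
  G-≈ d e = mkG λ i n≤i → trans (sym (at d i)) (vanish e i n≤i)

  G-[] : ∀ {n} → [] ∈G n
  G-[] = mkG λ i _ → refl

  G0⇒≈[] : ∀ {f} → f ∈G 0 → f ≈ []
  G0⇒≈[] e = mk≈ λ i → vanish e i z≤n

  G-⊞ : ∀ {f g n} → f ∈G n → g ∈G n → f ⊞ g ∈G n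
  G-⊞ {f} {g} d e = mkG λ i n≤i → trans (coef-⊞ f g i) (trans (cong₂ _∔_ (vanish d i n≤i) (vanish e i n≤i)) (∔-identityˡ 0f))

  G-scale : ∀ {a f n} → f ∈G n → scale a f ∈G n
  G-scale {a} {f} e = mkG λ i n≤i → trans (coef-scale a f i) (trans (cong (a ·_) (vanish e i n≤i)) (·-zeroʳ a))

  G-neg : ∀ {f n} → f ∈G n → map neg f ∈G n
  G-neg {f} e = mkG λ i n≤i → trans (coef-neg f i) (trans (cong neg (vanish e i n≤i)) neg-0)

  G-∷ : ∀ {a f n} → f ∈G n → a ∷ f ∈G suc n
  G-∷ e = mkG λ { zero () ; (suc i) (s≤s n≤i) → vanish e i n≤i }

  G-tail : ∀ {a f n} → a ∷ f ∈G suc n → f ∈G n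
  G-tail e = mkG λ i n≤i → vanish e (suc i) (s≤s n≤i)

  G-1p : 1p ∈G 1
  G-1p = G-∷ G-[]

  opaque
    unfolding _⊞_

    G-⊠ : ∀ {f g m n} → f ∈G m → g ∈G n → f ⊠ g ∈G (m + n)
    G-⊠ {f} {g} {zero} d e = G-≈ (≈-sym (⊠-cong (G0⇒≈[] d) (≈-refl {g}))) G-[]
    G-⊠ {[]}    {g} {suc m} d e = G-[]
    G-⊠ {a ∷ f} {g} {suc m} {n} d e = G-⊞ (G-≤ (m≤n+m n (suc m)) (G-scale e)) (G-∷ (G-⊠ (G-tail d) e))

  G-^p : ∀ {f m} j → f ∈G m → f ^p j ∈G (j * m + 1)
  G-^p zero    d = G-1p
  G-^p {f} {m} (suc j) d = G-≤ (≤-reflexive (sym (ℕₚ.+-assoc m (j * m) 1))) (G-⊠ d (G-^p j d))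

  G-sump : ∀ {k n} (f : Fin k → Pol) → (∀ i → f i ∈G n) → sump f ∈G n
  G-sump {zero}  f d = G-[]
  G-sump {suc k} f d = G-⊞ (d zero) (G-sump (f ∘ suc) (d ∘ suc))

  opaque
    unfolding _⊞_

    coef-⊠-top : ∀ {f g d e} → f ∈G suc d → g ∈G suc e → coef (f ⊠ g) (d + e) ≡ coef f d · coef g e
    coef-⊠-top {[]}    {g} {d} {e} _ _ = sym (·-zeroˡ _)
    coef-⊠-top {a ∷ f} {g} {zero} {e} df dg = begin
      coef (scale a g ⊞ (0f ∷ f ⊠ g)) e ≡⟨ coef-⊞ (scale a g) _ e ⟩
      coef (scale a g) e ∔ coef (0f ∷ f ⊠ g) e ≡⟨ cong₂ _∔_ (coef-scale a g e) (at tail≈[] e) ⟩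
      a · coef g e ∔ 0f ≡⟨ ∔-identityʳ _ ⟩
      a · coef g e ∎
      where
      open ≡-Reasoning
      tail≈[] : 0f ∷ f ⊠ g ≈ []
      tail≈[] = ≈-trans (∷-cong refl (⊠-cong (G0⇒≈[] (G-tail df)) (≈-refl {g}))) 0∷[]≈[]
    coef-⊠-top {a ∷ f} {g} {suc d} {e} df dg = begin
      coef (scale a g ⊞ (0f ∷ f ⊠ g)) (suc d + e) ≡⟨ coef-⊞ (scale a g) _ (suc d + e) ⟩
      coef (scale a g) (suc d + e) ∔ coef (f ⊠ g) (d + e)
        ≡⟨ cong₂ _∔_ (vanish (G-scale {a} dg) (suc d + e) (s≤s (m≤n+m e d))) (coef-⊠-top {f} (G-tail df) dg) ⟩
      0f ∔ coef f d · coef g e ≡⟨ ∔-identityˡ _ ⟩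
      coef f d · coef g e ∎
      where open ≡-Reasoning

  record Degree (f : Pol) : Set where
    constructor mkDegree
    field
      deg   : ℕ
      lead  : coef f deg ≢ 0f
      bound : f ∈G suc deg

  degree? : ∀ f → f ≈ [] ⊎ Degree f
  degree? [] = inj₁ ≈-refl
  degree? (a ∷ f) with degree? f
  ... | inj₂ (mkDegree d l b) = inj₂ (mkDegree (suc d) l (G-∷ b))
  ... | inj₁ f≈[] with a ≟f 0f
  ...   | yes refl = inj₁ (≈-trans (∷-cong refl f≈[]) 0∷[]≈[])
  ...   | no a≢0 = inj₂ (mkDegree 0 a≢0 (G-∷ (G-≈ (≈-sym f≈[]) G-[])))

  _≉0 : Pol → Set
  f ≉0 = ¬ (f ≈ [])

  degree : ∀ {f} → f ≉0 → Degree f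
  degree {f} f≉0 with degree? f
  ... | inj₁ f≈[] = contradiction f≈[] f≉0
  ... | inj₂ d = d

  lead⇒≉0 : ∀ {f} i → coef f i ≢ 0f → f ≉0
  lead⇒≉0 i c e = c (at e i)

  ⊠-≉0 : ∀ {f g} → f ≉0 → g ≉0 → (f ⊠ g) ≉0
  ⊠-≉0 {f} {g} f≉0 g≉0 = lead⇒≉0 _ λ eq → ·-≢0 (lead df) (lead dg) (trans (sym (coef-⊠-top (bound df) (bound dg))) eq)
    where
    open Degree
    df = degree f≉0
    dg = degree g≉0

  1p≉0 : 1p ≉0
  1p≉0 e = 0≢1 (sym (at e 0))

  ^p-≉0 : ∀ {f} n → f ≉0 → (f ^p n) ≉0
  ^p-≉0 zero    f≉0 = 1p≉0
  ^p-≉0 (suc n) f≉0 = ⊠-≉0 f≉0 (^p-≉0 n f≉0)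

  ⊠-cancelˡ : ∀ {f g} → f ≉0 → f ⊠ g ≈ [] → g ≈ []
  ⊠-cancelˡ {f} {g} f≉0 e with degree? g
  ... | inj₁ g≈[] = g≈[]
  ... | inj₂ (mkDegree d l b) = contradiction e (⊠-≉0 f≉0 (lead⇒≉0 d l))

  G-⊠⁻¹ : ∀ {f g n} → g ≉0 → f ⊠ g ∈G n → f ∈G n
  G-⊠⁻¹ {f} {g} {n} g≉0 e with degree? f
  ... | inj₁ f≈[] = G-≈ (≈-sym f≈[]) G-[]
  ... | inj₂ (mkDegree d l b) = G-≤ (≮⇒≥ λ n<1+d → ·-≢0 l (Degree.lead dg)
          (trans (sym (coef-⊠-top b (Degree.bound dg))) (vanish e _ (≤-trans (ℕₚ.≤-pred n<1+d) (m≤m+n d _))))) b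
    where dg = degree g≉0

  tpow : ℕ → Pol
  tpow zero    = 1p
  tpow (suc k) = 0f ∷ tpow k

  G-tpow : ∀ k → tpow k ∈G suc k
  G-tpow zero    = G-1p
  G-tpow (suc k) = G-∷ (G-tpow k)

  coef-tpow : ∀ k → coef (tpow k) k ≡ 1f
  coef-tpow zero    = refl
  coef-tpow (suc k) = coef-tpow k

  coef-tpow-≢ : ∀ k i → i ≢ k → coef (tpow k) i ≡ 0f
  coef-tpow-≢ zero    zero    i≢k = contradiction refl i≢k
  coef-tpow-≢ zero    (suc i) i≢k = refl
  coef-tpow-≢ (suc k) zero    i≢k = refl
  coef-tpow-≢ (suc k) (suc i) i≢k = coef-tpow-≢ k i (i≢k ∘ cong suc)

  tpow≉0 : ∀ k → tpow k ≉0
  tpow≉0 k = lead⇒≉0 k λ eq → 0≢1 (trans (sym eq) (coef-tpow k))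

  coef-tpow-⊠ : ∀ k f i → i < k → coef (tpow k ⊠ f) i ≡ 0f
  coef-tpow-⊠ (suc k) f zero    _ = at (⊠-shiftˡ (tpow k) f) 0
  coef-tpow-⊠ (suc k) f (suc i) (s≤s i<k) = trans (at (⊠-shiftˡ (tpow k) f) (suc i)) (coef-tpow-⊠ k f i i<k)

  tpow-+ : ∀ j k → tpow (j + k) ≈ tpow j ⊠ tpow k
  tpow-+ zero    k = ≈-sym (⊠-identityˡ _)
  tpow-+ (suc j) k = ≈-trans (∷-cong refl (tpow-+ j k)) (≈-sym (⊠-shiftˡ (tpow j) (tpow k)))

  tpow-^p : ∀ k n → tpow k ^p n ≈ tpow (n * k)
  tpow-^p k zero    = ≈-refl
  tpow-^p k (suc n) = ≈-trans (⊠-cong ≈-refl (tpow-^p k n)) (≈-sym (tpow-+ k (n * k)))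

  polyOf : ∀ {n} → (Fin n → 𝔽) → Pol
  polyOf {zero}  x = []
  polyOf {suc n} x = x zero ∷ polyOf (x ∘ suc)

  G-polyOf : ∀ {n} (x : Fin n → 𝔽) → polyOf x ∈G n
  G-polyOf {zero}  x = G-[]
  G-polyOf {suc n} x = G-∷ (G-polyOf (x ∘ suc))

  coef-polyOf : ∀ {n} (x : Fin n → 𝔽) k → coef (polyOf x) (toℕ k) ≡ x k
  coef-polyOf x zero    = refl
  coef-polyOf x (suc k) = coef-polyOf (x ∘ suc) k

-- Linear functionals on polynomials

module Functionals (F : FiniteField) where
  open Degrees F public

  record Lin : Set where
    field
      ⟦_⟧    : Pol → 𝔽
      resp   : ∀ {f g} → f ≈ g → ⟦_⟧ f ≡ ⟦_⟧ g
      lin-⊞  : ∀ f g → ⟦_⟧ (f ⊞ g) ≡ ⟦_⟧ f ∔ ⟦_⟧ g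
      lin-scale : ∀ a f → ⟦_⟧ (scale a f) ≡ a · ⟦_⟧ f
  open Lin public

  lin-[] : ∀ μ → ⟦ μ ⟧ [] ≡ 0f
  lin-[] μ = trans (lin-scale μ 0f []) (·-zeroˡ _)

  lin-≈[] : ∀ μ {f} → f ≈ [] → ⟦ μ ⟧ f ≡ 0f
  lin-≈[] μ e = trans (resp μ e) (lin-[] μ)

  lin-sum : ∀ μ {n} (f : Fin n → Pol) → ⟦ μ ⟧ (sump f) ≡ sumf (λ i → ⟦ μ ⟧ (f i))
  lin-sum μ {zero}  f = lin-[] μ
  lin-sum μ {suc n} f = trans (lin-⊞ μ (f zero) _) (cong (⟦ μ ⟧ (f zero) ∔_) (lin-sum μ (f ∘ suc)))

  lin-×p : ∀ μ n f → ⟦ μ ⟧ (n ×p f) ≡ n ×f 1f · ⟦ μ ⟧ f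
  lin-×p μ zero    f = trans (lin-[] μ) (sym (·-zeroˡ _))
  lin-×p μ (suc n) f = trans (lin-⊞ μ f (n ×p f)) (sym (trans (·-distribʳ _ 1f (n ×f 1f)) (cong₂ _∔_ (·-identityˡ _) (sym (lin-×p μ n f)))))

  infixr 7 _▷_
  _▷_ : Pol → Lin → Lin
  a ▷ μ = record
    { ⟦_⟧ = λ f → ⟦ μ ⟧ (a ⊠ f)
    ; resp = λ e → resp μ (⊠-congˡ a e)
    ; lin-⊞ = λ f g → trans (resp μ (⊠-distribˡ a f g)) (lin-⊞ μ _ _)
    ; lin-scale = λ c f → trans (resp μ (⊠-scaleʳ a c f)) (lin-scale μ c _) }

  zeroLin : Lin
  zeroLin = record
    { ⟦_⟧ = λ _ → 0f ; resp = λ _ → refl ; lin-⊞ = λ _ _ → sym (∔-identityˡ 0f)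
    ; lin-scale = λ a _ → sym (·-zeroʳ a) }

  addLin : Lin → Lin → Lin
  addLin μ ν = record
    { ⟦_⟧ = λ f → ⟦ μ ⟧ f ∔ ⟦ ν ⟧ f
    ; resp = λ e → cong₂ _∔_ (resp μ e) (resp ν e)
    ; lin-⊞ = λ f g → trans (cong₂ _∔_ (lin-⊞ μ f g) (lin-⊞ ν f g)) (∔-interchange _ _ _ _)
    ; lin-scale = λ a f → trans (cong₂ _∔_ (lin-scale μ a f) (lin-scale ν a f)) (sym (·-distribˡ a _ _)) }

  scaleLin : 𝔽 → Lin → Lin
  scaleLin c μ = record
    { ⟦_⟧ = λ f → c · ⟦ μ ⟧ f
    ; resp = λ e → cong (c ·_) (resp μ e)
    ; lin-⊞ = λ f g → trans (cong (c ·_) (lin-⊞ μ f g)) (·-distribˡ c _ _)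
    ; lin-scale = λ a f → trans (cong (c ·_) (lin-scale μ a f)) (·-leftSwap c a _) }

  coefLin : ℕ → Lin
  coefLin k = record
    { ⟦_⟧ = λ f → coef f k ; resp = λ e → at e k ; lin-⊞ = λ f g → coef-⊞ f g k
    ; lin-scale = λ a f → coef-scale a f k }

  -- Induction on n: the constant coefficient is split off, and the factor t of the rest is moved
  -- into the functionals.
  lin-ext : ∀ {n} μ ν → (∀ k → k < n → ⟦ μ ⟧ (tpow k) ≡ ⟦ ν ⟧ (tpow k)) → ∀ {f} → f ∈G n → ⟦ μ ⟧ f ≡ ⟦ ν ⟧ f
  lin-ext μ ν eq {[]} _ = trans (lin-[] μ) (sym (lin-[] ν))
  lin-ext {zero} μ ν eq {a ∷ f} d = trans (lin-≈[] μ (G0⇒≈[] d)) (sym (lin-≈[] ν (G0⇒≈[] d)))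
  lin-ext {suc n} μ ν eq {a ∷ f} d = trans (split μ) (trans (cong₂ _∔_ (cong (a ·_) (eq 0 (s≤s z≤n)))
      (trans (resp μ (≈-sym (t⊠ f))) (trans ih (resp ν (t⊠ f))))) (sym (split ν)))
    where
    t = 0f ∷ 1p
    t⊠ : ∀ f → t ⊠ f ≈ 0f ∷ f
    t⊠ f = ≈-trans (⊠-shiftˡ 1p f) (∷-cong refl (⊠-identityˡ f))
    split : ∀ μ → ⟦ μ ⟧ (a ∷ f) ≡ a · ⟦ μ ⟧ 1p ∔ ⟦ μ ⟧ (0f ∷ f)
    split μ = trans (resp μ (∷-split a f)) (trans (lin-⊞ μ (a ∷ []) (0f ∷ f))
      (cong (_∔ ⟦ μ ⟧ (0f ∷ f)) (trans (resp μ (∷-cong (sym (·-identityʳ a)) ≈-refl)) (lin-scale μ a 1p))))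
    ih : ⟦ t ▷ μ ⟧ f ≡ ⟦ t ▷ ν ⟧ f
    ih = lin-ext (t ▷ μ) (t ▷ ν) (λ k k<n → trans (resp μ (t⊠ (tpow k))) (trans (eq (suc k) (s≤s k<n)) (resp ν (≈-sym (t⊠ (tpow k)))))) (G-tail d)

  lin-zero : ∀ {n} μ → (∀ k → k < n → ⟦ μ ⟧ (tpow k) ≡ 0f) → ∀ {f} → f ∈G n → ⟦ μ ⟧ f ≡ 0f
  lin-zero μ = lin-ext μ zeroLin

  opaque
    unfolding _⊞_

    lin-polyOf : ∀ μ {n} (x : Fin n → 𝔽) f → ⟦ μ ⟧ (polyOf x ⊠ f) ≡ sumf (λ k → x k · ⟦ μ ⟧ (tpow (toℕ k) ⊠ f))
    lin-polyOf μ {zero}  x f = lin-[] μ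
    lin-polyOf μ {suc n} x f = begin
      ⟦ μ ⟧ (scale (x zero) f ⊞ (0f ∷ polyOf (x ∘ suc) ⊠ f))
        ≡⟨ lin-⊞ μ _ _ ⟩
      ⟦ μ ⟧ (scale (x zero) f) ∔ ⟦ μ ⟧ (0f ∷ polyOf (x ∘ suc) ⊠ f)
        ≡⟨ cong₂ _∔_ (trans (lin-scale μ (x zero) f) (cong (x zero ·_) (resp μ (≈-sym (⊠-identityˡ f)))))
                     (resp μ (≈-sym (⊠-shiftʳ (polyOf (x ∘ suc)) f))) ⟩
      x zero · ⟦ μ ⟧ (1p ⊠ f) ∔ ⟦ μ ⟧ (polyOf (x ∘ suc) ⊠ (0f ∷ f))
        ≡⟨ cong (x zero · ⟦ μ ⟧ (1p ⊠ f) ∔_) (trans (lin-polyOf μ (x ∘ suc) (0f ∷ f))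
             (sumf-cong λ k → cong (x (suc k) ·_) (resp μ (≈-trans (⊠-shiftʳ (tpow (toℕ k)) f) (≈-sym (⊠-shiftˡ (tpow (toℕ k)) f)))))) ⟩
      x zero · ⟦ μ ⟧ (1p ⊠ f) ∔ sumf (λ k → x (suc k) · ⟦ μ ⟧ (tpow (toℕ (suc k)) ⊠ f)) ∎
      where open ≡-Reasoning

  Relation : ∀ {m} → (Fin m → Lin) → ℕ → Set
  Relation {m} φ n = ∃ λ (c : Fin m → 𝔽) → (∃ λ i → c i ≢ 0f) × (∀ {f} → f ∈G n → sumf (λ i → c i · ⟦ φ i ⟧ f) ≡ 0f)

  Onto : ∀ {m} → (Fin m → Lin) → ℕ → Set
  Onto {m} φ n = (τ : Fin m → 𝔽) → ∃ λ f → f ∈G n × (∀ i → ⟦ φ i ⟧ f ≡ τ i)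

  zeroOrPivot : ∀ μ n → (∀ {f} → f ∈G n → ⟦ μ ⟧ f ≡ 0f) ⊎ ∃ λ f → f ∈G n × ⟦ μ ⟧ f ≢ 0f
  zeroOrPivot μ n with Finₚ.all? (λ (k : Fin n) → ⟦ μ ⟧ (tpow (toℕ k)) ≟f 0f)
  ... | yes all0 = inj₁ (lin-zero μ λ k k<n → subst (λ j → ⟦ μ ⟧ (tpow j) ≡ 0f) (toℕ-fromℕ< k<n) (all0 (Fin.fromℕ< k<n)))
  ... | no ¬all0 with Finₚ.¬∀⟶∃¬ n _ (λ k → ⟦ μ ⟧ (tpow (toℕ k)) ≟f 0f) ¬all0
  ...   | k , ≢0 = inj₂ (tpow (toℕ k) , G-≤ (toℕ<n k) (G-tpow (toℕ k)) , ≢0)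

  -- Gaussian elimination
  opaque
    relationOrOnto : ∀ {m} (φ : Fin m → Lin) n → Relation φ n ⊎ Onto φ n
    relationOrOnto {zero}  φ n = inj₂ λ τ → [] , G-[] , λ ()
    relationOrOnto {suc m} φ n with zeroOrPivot (φ zero) n
    ... | inj₁ φ₀≡0 = inj₁ (c , (zero , λ eq → 0≢1 (sym eq)) , λ {f} d →
            trans (cong₂ _∔_ (trans (·-identityˡ _) (φ₀≡0 d))
                             (trans (sumf-cong {m} (λ i → ·-zeroˡ (⟦ φ (suc i) ⟧ f))) (sumf-replicate-zero m))) (∔-identityˡ 0f))
      where
      c : Fin (suc m) → 𝔽
      c zero    = 1f
      c (suc i) = 0f
    ... | inj₂ (f₀ , d₀ , piv) = result (relationOrOnto ψ n)
      where
      s : 𝔽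
      s = inv (⟦ φ zero ⟧ f₀) piv
      coeff₀ : Fin m → 𝔽
      coeff₀ i = neg (⟦ φ (suc i) ⟧ f₀ · s)
      -- Every `ψ i` vanishes at f₀, so a multiple of f₀ can be added to adjust the value of
      -- `φ zero` without disturbing the `ψ i`.
      ψ : Fin m → Lin
      ψ i = addLin (φ (suc i)) (scaleLin (coeff₀ i) (φ zero))
      ψ-f₀ : ∀ i → ⟦ ψ i ⟧ f₀ ≡ 0f
      ψ-f₀ i = begin
        y ∔ neg (y · s) · x ≡⟨ cong (y ∔_) (neg-distribˡ-· (y · s) x) ⟨
        y ∔ neg (y · s · x) ≡⟨ cong (λ z → y ∔ neg z) (trans (·-assoc y s x) (trans (cong (y ·_) (inv-inverseˡ x piv)) (·-identityʳ y))) ⟩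
        y ∔ neg y ≡⟨ neg-inverseʳ y ⟩
        0f ∎
        where
        open ≡-Reasoning
        x y : 𝔽
        y = ⟦ φ (suc i) ⟧ f₀
        x = ⟦ φ zero ⟧ f₀
      result : Relation ψ n ⊎ Onto ψ n → Relation φ n ⊎ Onto φ n
      result (inj₁ (c , (i , cᵢ≢0) , rel)) = inj₁ (c′ , (suc i , cᵢ≢0) , rel′)
        where
        c′ : Fin (suc m) → 𝔽
        c′ zero    = sumf (λ i → c i · coeff₀ i)
        c′ (suc i) = c i
        rel′ : ∀ {f} → f ∈G n → sumf (λ i → c′ i · ⟦ φ i ⟧ f) ≡ 0f
        rel′ {f} d = begin
          sumf (λ i → c i · coeff₀ i) · x ∔ sumf (λ i → c i · ⟦ φ (suc i) ⟧ f)
            ≡⟨ cong (_∔ sumf (λ i → c i · ⟦ φ (suc i) ⟧ f)) (·-distribʳ-sumf x (λ i → c i · coeff₀ i)) ⟩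
          sumf (λ i → c i · coeff₀ i · x) ∔ sumf (λ i → c i · ⟦ φ (suc i) ⟧ f)
            ≡⟨ ∔-comm _ _ ⟩
          sumf (λ i → c i · ⟦ φ (suc i) ⟧ f) ∔ sumf (λ i → c i · coeff₀ i · x)
            ≡⟨ sumf-distrib-∔ (λ i → c i · ⟦ φ (suc i) ⟧ f) (λ i → c i · coeff₀ i · x) ⟨
          sumf (λ i → c i · ⟦ φ (suc i) ⟧ f ∔ c i · coeff₀ i · x)
            ≡⟨ sumf-cong (λ i → trans (cong (c i · ⟦ φ (suc i) ⟧ f ∔_) (·-assoc (c i) (coeff₀ i) x)) (sym (·-distribˡ (c i) _ _))) ⟩
          sumf (λ i → c i · ⟦ ψ i ⟧ f)
            ≡⟨ rel d ⟩
          0f ∎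
          where
          open ≡-Reasoning
          x : 𝔽
          x = ⟦ φ zero ⟧ f
      result (inj₂ onto) = inj₂ λ τ →
        let f , d , eq = onto (λ i → τ (suc i) ∔ coeff₀ i · τ zero)
            r = (τ zero ∔ neg (⟦ φ zero ⟧ f)) · s
            g = f ⊞ scale r f₀
            ψg : ∀ i → ⟦ ψ i ⟧ g ≡ τ (suc i) ∔ coeff₀ i · τ zero
            ψg i = trans (lin-⊞ (ψ i) f (scale r f₀)) (trans (cong₂ _∔_ (eq i)
                     (trans (lin-scale (ψ i) r f₀) (trans (cong (r ·_) (ψ-f₀ i)) (·-zeroʳ r)))) (∔-identityʳ _))
            φ₀g : ⟦ φ zero ⟧ g ≡ τ zero
            φ₀g = trans (lin-⊞ (φ zero) f (scale r f₀)) (trans (cong (⟦ φ zero ⟧ f ∔_)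
                    (trans (lin-scale (φ zero) r f₀) (trans (·-assoc _ s _) (trans (cong ((τ zero ∔ neg (⟦ φ zero ⟧ f)) ·_) (inv-inverseˡ _ piv)) (·-identityʳ _)))))
                    (trans (∔-comm _ _) (neg-cancel (τ zero) _)))
        in g , G-⊞ d (G-scale d₀) , λ { zero → φ₀g
           ; (suc i) → ∔-cancelʳ (trans (cong (λ z → ⟦ φ (suc i) ⟧ g ∔ coeff₀ i · z) (sym φ₀g)) (ψg i)) }

-- Chevalley-Warning on the Boolean cube

module CubePolynomials (F : FiniteField) where
  open Functionals F public

  -- With variables restricted to 0 and 1, every function is represented by a unique multilinear
  -- polynomial, and degrees can be handled one variable at a time by the finite difference `Δ`.
  Cube : ℕ → Set
  Cube = Vec Bool

  origin : ∀ {n} → Cube n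
  origin = replicate _ false

  Δ : ∀ {n} → (Cube (suc n) → 𝔽) → Cube n → 𝔽
  Δ f v = f (true ∷ v) ∔ neg (f (false ∷ v))

  -- the multilinear polynomial representing f has degree less than d
  Deg : (n d : ℕ) → (Cube n → 𝔽) → Set
  Deg n       zero    f = ∀ v → f v ≡ 0f
  Deg zero    (suc d) f = ⊤
  Deg (suc n) (suc d) f = Deg n (suc d) (λ v → f (false ∷ v)) × Deg n d (Δ f)

  Deg-ext : ∀ {n} d {f g : Cube n → 𝔽} → (∀ v → f v ≡ g v) → Deg n d f → Deg n d g
  Deg-ext {n}     zero    e D = λ v → trans (sym (e v)) (D v)
  Deg-ext {zero}  (suc d) e D = tt
  Deg-ext {suc n} (suc d) e (D₀ , D₁) =
    Deg-ext (suc d) (λ v → e (false ∷ v)) D₀ ,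
    Deg-ext d (λ v → cong₂ (λ a b → a ∔ neg b) (e (true ∷ v)) (e (false ∷ v))) D₁

  Deg-0 : ∀ {n} d {f : Cube n → 𝔽} → (∀ v → f v ≡ 0f) → Deg n d f
  Deg-0 {n}     zero    e = e
  Deg-0 {zero}  (suc d) e = tt
  Deg-0 {suc n} (suc d) e = Deg-0 (suc d) (λ v → e (false ∷ v)) ,
    Deg-0 d (λ v → trans (cong₂ (λ a b → a ∔ neg b) (e (true ∷ v)) (e (false ∷ v))) (neg-inverseʳ 0f))

  Deg-suc : ∀ {n} d {f : Cube n → 𝔽} → Deg n d f → Deg n (suc d) f
  Deg-suc {n}     zero    D = Deg-0 1 D
  Deg-suc {zero}  (suc d) D = tt
  Deg-suc {suc n} (suc d) (D₀ , D₁) = Deg-suc (suc d) D₀ , Deg-suc d D₁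

  Deg-≤ : ∀ {n d e} {f : Cube n → 𝔽} → d ≤ e → Deg n d f → Deg n e f
  Deg-≤ {n} {d} {e} {f} d≤e D = subst (λ k → Deg n k f) (ℕₚ.m∸n+n≡m d≤e) (go (e ∸ d))
    where
    go : ∀ k → Deg n (k + d) f
    go zero    = D
    go (suc k) = Deg-suc (k + d) (go k)

  Deg-const : ∀ {n} d c → Deg n (suc d) (λ _ → c)
  Deg-const {zero}  d c = tt
  Deg-const {suc n} d c = Deg-const d c , Deg-0 d (λ _ → neg-inverseʳ c)

  Deg-∔ : ∀ {n} d {f g : Cube n → 𝔽} → Deg n d f → Deg n d g → Deg n d (λ v → f v ∔ g v)
  Deg-∔ {n}     zero    D E = λ v → trans (cong₂ _∔_ (D v) (E v)) (∔-identityˡ 0f)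
  Deg-∔ {zero}  (suc d) D E = tt
  Deg-∔ {suc n} (suc d) {f} {g} (D₀ , D₁) (E₀ , E₁) = Deg-∔ (suc d) D₀ E₀ ,
    Deg-ext d (λ v → trans (∔-interchange (f (true ∷ v)) _ _ _) (cong (f (true ∷ v) ∔ g (true ∷ v) ∔_) (neg-∔-comm _ _))) (Deg-∔ d D₁ E₁)

  -- The Leibniz rule for finite differences: a, b and c, d are the values of two functions at the
  -- two ends of an edge, and the product of both differences is the extra term.
  Δ-· : ∀ a b c d → ((a ∔ neg b) · d ∔ (c ∔ neg d) · b) ∔ (a ∔ neg b) · (c ∔ neg d) ≡ a · c ∔ neg (b · d)
  Δ-· a b c d = begin
    (x · d ∔ y · b) ∔ x · y ≡⟨ ∔-assoc _ _ _ ⟩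
    x · d ∔ (y · b ∔ x · y) ≡⟨ cong (x · d ∔_) (cong (y · b ∔_) (·-comm x y)) ⟩
    x · d ∔ (y · b ∔ y · x) ≡⟨ cong (x · d ∔_) (·-distribˡ y b x) ⟨
    x · d ∔ y · (b ∔ x) ≡⟨ cong (λ z → x · d ∔ y · z) (trans (∔-comm b x) (neg-cancel a b)) ⟩
    x · d ∔ y · a ≡⟨ cong₂ _∔_ (·-distribʳ d a (neg b)) (trans (·-comm y a) (·-distribˡ a c (neg d))) ⟩
    (a · d ∔ neg b · d) ∔ (a · c ∔ a · neg d)
      ≡⟨ cong₂ (λ z w → (a · d ∔ z) ∔ (a · c ∔ w)) (sym (neg-distribˡ-· b d)) (sym (neg-distribʳ-· a d)) ⟩
    (a · d ∔ neg (b · d)) ∔ (a · c ∔ neg (a · d)) ≡⟨ cong₂ _∔_ (∔-comm _ _) (∔-comm _ _) ⟩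
    (neg (b · d) ∔ a · d) ∔ (neg (a · d) ∔ a · c) ≡⟨ ∔-assoc _ _ _ ⟩
    neg (b · d) ∔ (a · d ∔ (neg (a · d) ∔ a · c)) ≡⟨ cong (neg (b · d) ∔_) (∔-assoc _ _ _) ⟨
    neg (b · d) ∔ ((a · d ∔ neg (a · d)) ∔ a · c) ≡⟨ cong (λ z → neg (b · d) ∔ (z ∔ a · c)) (neg-inverseʳ _) ⟩
    neg (b · d) ∔ (0f ∔ a · c) ≡⟨ cong (neg (b · d) ∔_) (∔-identityˡ _) ⟩
    neg (b · d) ∔ a · c ≡⟨ ∔-comm _ _ ⟩
    a · c ∔ neg (b · d) ∎
    where
    open ≡-Reasoning
    x = a ∔ neg b
    y = c ∔ neg d

  -- `Deg` bounds degrees strictly, so only one of the two bounds is shifted: degree below d times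
  -- degree at most e is below d + e.
  Deg-· : ∀ {n} d e {f g : Cube n → 𝔽} → Deg n d f → Deg n (suc e) g → Deg n (d + e) (λ v → f v · g v)
  Deg-· {n}     zero    e {g = g} D E = Deg-0 e λ v → trans (cong (_· g v) (D v)) (·-zeroˡ _)
  Deg-· {zero}  (suc d) e D E = tt
  Deg-· {suc n} (suc d) e {f} {g} (D₀ , D₁) (E₀ , E₁) = Deg-· (suc d) e D₀ E₀ ,
    Deg-ext (d + e) (λ v → Δ-· (f (true ∷ v)) (f (false ∷ v)) (g (true ∷ v)) (g (false ∷ v)))
      (Deg-∔ (d + e)
        (Deg-∔ (d + e) (Deg-· d e D₁ E₀) (subst (λ k → Deg n k (λ v → Δ g v · f (false ∷ v))) (ℕₚ.+-comm e d) (Deg-· e d E₁ D₀)))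
        (Deg-· d e D₁ (Deg-suc e E₁)))

  Deg-sumf : ∀ {n} d {m} (f : Fin m → Cube n → 𝔽) → (∀ i → Deg n d (f i)) → Deg n d (λ v → sumf (λ i → f i v))
  Deg-sumf d {zero}  f D = Deg-0 d λ _ → refl
  Deg-sumf d {suc m} f D = Deg-∔ d (D zero) (Deg-sumf d (f ∘ suc) (D ∘ suc))

  bit : Bool → 𝔽
  bit true  = 1f
  bit false = 0f

  Deg-bit : ∀ {n} (k : Fin n) → Deg n 2 (λ v → bit (lookup v k))
  Deg-bit zero    = Deg-const 1 0f , Deg-const 0 (1f ∔ neg 0f)
  Deg-bit (suc k) = Deg-bit k , Deg-0 1 (λ _ → neg-inverseʳ _)

  -- The coefficient of the product of all n variables in the multilinear polynomial of f.
  altSum : ∀ n → (Cube n → 𝔽) → 𝔽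
  altSum zero    f = f []
  altSum (suc n) f = altSum n (Δ f)

  Deg⇒altSum≡0 : ∀ n d {f : Cube n → 𝔽} → d ≤ n → Deg n d f → altSum n f ≡ 0f
  Deg⇒altSum≡0 zero    zero    _ D = D []
  Deg⇒altSum≡0 (suc n) zero    _ D = Deg⇒altSum≡0 n zero z≤n λ v →
    trans (cong₂ (λ a b → a ∔ neg b) (D (true ∷ v)) (D (false ∷ v))) (neg-inverseʳ 0f)
  Deg⇒altSum≡0 (suc n) (suc d) (s≤s d≤n) (_ , D) = Deg⇒altSum≡0 n d d≤n D

  altSum-supported : ∀ n {f : Cube n → 𝔽} → (∀ v → v ≢ origin → f v ≡ 0f) → altSum n f ≡ 0f → f origin ≡ 0f
  altSum-supported zero    supp e = e
  altSum-supported (suc n) {f} supp e = trans (sym (neg-involutive _)) (trans (cong neg neg≡0) neg-0)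
    where
    Δ≡0 : Δ f origin ≡ 0f
    Δ≡0 = altSum-supported n (λ v v≢0 → trans (cong₂ (λ a b → a ∔ neg b) (supp (true ∷ v) λ ()) (supp (false ∷ v) (v≢0 ∘ cong Vec.tail))) (neg-inverseʳ 0f)) e
    neg≡0 : neg (f origin) ≡ 0f
    neg≡0 = trans (sym (∔-identityˡ _)) (trans (cong (_∔ neg (f origin)) (sym (supp (true ∷ origin) λ ()))) Δ≡0)

  anyCube? : ∀ {n} {P : Cube n → Set} → (∀ v → Dec (P v)) → Dec (∃ P)
  anyCube? {zero}  P? with P? []
  ... | yes p = yes ([] , p)
  ... | no ¬p = no λ { ([] , p) → ¬p p }
  anyCube? {suc n} P? with anyCube? (λ v → P? (false ∷ v)) | anyCube? (λ v → P? (true ∷ v))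
  ... | yes (v , p) | _ = yes (false ∷ v , p)
  ... | no _ | yes (v , p) = yes (true ∷ v , p)
  ... | no ¬f | no ¬t = no λ { (false ∷ v , p) → ¬f (v , p) ; (true ∷ v , p) → ¬t (v , p) }

  _≟c_ : ∀ {n} (v w : Cube n) → Dec (v ≡ w)
  _≟c_ = Vecₚ.≡-dec Boolₚ._≟_

  -- A function that is nonzero at the origin only is a multiple of the product of all 1 - x_i,
  -- whose degree is n. A degree below n therefore forces another nonzero value.
  secondNonzero : ∀ {n} {f : Cube n → 𝔽} → Deg n n f → f origin ≢ 0f → ∃ λ v → v ≢ origin × f v ≢ 0f
  secondNonzero {n} {f} D f0 with anyCube? (λ v → ¬? (v ≟c origin) ×-dec ¬? (f v ≟f 0f))
  ... | yes p = p
  ... | no ¬p = contradiction (altSum-supported n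
                  (λ v v≢0 → decidable-stable (f v ≟f 0f) (λ fv≢0 → ¬p (v , v≢0 , fv≢0)))
                  (Deg⇒altSum≡0 n n ℕₚ.≤-refl D)) f0

  prodf : ∀ {n} → (Fin n → 𝔽) → 𝔽
  prodf {zero}  f = 1f
  prodf {suc n} f = f zero · prodf (f ∘ suc)

  prodf-≢0 : ∀ {n} (f : Fin n → 𝔽) → (∀ i → f i ≢ 0f) → prodf f ≢ 0f
  prodf-≢0 {zero}  f h = 0≢1 ∘ sym
  prodf-≢0 {suc n} f h = ·-≢0 (h zero) (prodf-≢0 (f ∘ suc) (h ∘ suc))

  prodf-≢0⁻¹ : ∀ {n} (f : Fin n → 𝔽) → prodf f ≢ 0f → ∀ i → f i ≢ 0f
  prodf-≢0⁻¹ f h zero    e = h (trans (cong (_· prodf (f ∘ suc)) e) (·-zeroˡ _))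
  prodf-≢0⁻¹ f h (suc i) = prodf-≢0⁻¹ (f ∘ suc) (λ e → h (trans (cong (f zero ·_) e) (·-zeroʳ _))) i

  Deg-prodf : ∀ {n} d {m} (f : Fin m → Cube n → 𝔽) → (∀ i → Deg n (suc d) (f i)) → Deg n (suc (m * d)) (λ v → prodf (λ i → f i v))
  Deg-prodf d {zero}  f D = Deg-const 0 1f
  Deg-prodf d {suc m} f D = Deg-· (suc d) (m * d) (D zero) (Deg-prodf d (f ∘ suc) (D ∘ suc))

  element : Fin size → 𝔽
  element = Inverse.from enumeration

  factor : 𝔽 → 𝔽 → 𝔽
  factor b a with b ≟f 0f
  ... | yes _ = 1f
  ... | no  _ = b ∔ neg a

  -- The product of b - a over all b ≠ 0, that is, a^(q-1) - 1 with q = `size`. The factor at b = 0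
  -- is set to 1 so that the product can be indexed by the whole field.
  indicator : 𝔽 → 𝔽
  indicator a = prodf (λ k → factor (element k) a)

  indicator-0 : indicator 0f ≢ 0f
  indicator-0 = prodf-≢0 (λ k → factor (element k) 0f) λ k → nonzero (element k)
    where
    nonzero : ∀ b → factor b 0f ≢ 0f
    nonzero b e with b ≟f 0f
    ... | yes _ = 0≢1 (sym e)
    ... | no b≢0 = b≢0 (x∔negy≡0⇒x≡y e)

  indicator-≢0 : ∀ {a} → indicator a ≢ 0f → a ≡ 0f
  indicator-≢0 {a} h = decidable-stable (a ≟f 0f) λ a≢0 →
    prodf-≢0⁻¹ (λ k → factor (element k) a) h (Inverse.to enumeration a)
      (subst (λ b → factor b a ≡ 0f) (sym (Inverse.strictlyInverseʳ enumeration a)) (vanishes a≢0))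
    where
    vanishes : a ≢ 0f → factor a a ≡ 0f
    vanishes a≢0 with a ≟f 0f
    ... | yes a≡0 = contradiction a≡0 a≢0
    ... | no  _ = neg-inverseʳ a

  Deg-neg : ∀ {n} d {f : Cube n → 𝔽} → Deg n (suc d) f → Deg n (suc d) (λ v → neg (f v))
  Deg-neg d {f} D = Deg-ext (suc d) (λ v → trans (sym (neg-distribˡ-· 1f (f v))) (cong neg (·-identityˡ (f v)))) (Deg-· 1 d (Deg-const 0 (neg 1f)) D)

  Deg-indicator : ∀ {n} d {f : Cube n → 𝔽} → Deg n (suc d) f → Deg n (suc (size * d)) (λ v → indicator (f v))
  Deg-indicator d {f} D = Deg-prodf d _ λ k → factorDeg (element k)
    where
    factorDeg : ∀ b → Deg _ (suc d) (λ v → factor b (f v))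
    factorDeg b with b ≟f 0f
    ... | yes _ = Deg-const d 1f
    ... | no  _ = Deg-∔ (suc d) (Deg-const d b) (Deg-neg d D)

  -- A property certified by a polynomial. Multiplying witnesses takes the conjunction of the
  -- properties and adds the degrees, which reduces a system of equations to a single polynomial.
  record Condition (n d : ℕ) (P : Cube n → Set) : Set where
    field
      witness  : Cube n → 𝔽
      degree≤  : Deg n (suc d) witness
      atOrigin : witness origin ≢ 0f
      sound    : ∀ v → witness v ≢ 0f → P v
  open Condition

  equation : ∀ {n d} {f : Cube n → 𝔽} → Deg n (suc d) f → f origin ≡ 0f → Condition n (size * d) (λ v → f v ≡ 0f)
  equation {n} {d} {f} D f0 = record
    { witness = λ v → indicator (f v)
    ; degree≤ = Deg-indicator d D
    ; atOrigin = subst (λ a → indicator a ≢ 0f) (sym f0) indicator-0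
    ; sound = λ v → indicator-≢0 }

  every : ∀ {n d m} {P : Fin m → Cube n → Set} → (∀ i → Condition n d (P i)) → Condition n (m * d) (λ v → ∀ i → P i v)
  every {d = d} c = record
    { witness = λ v → prodf (λ i → witness (c i) v)
    ; degree≤ = Deg-prodf d _ (λ i → degree≤ (c i))
    ; atOrigin = prodf-≢0 _ (λ i → atOrigin (c i))
    ; sound = λ v h i → sound (c i) v (prodf-≢0⁻¹ _ h i) }

  -- a form of the Chevalley–Warning theorem
  opaque
    nontrivialSolution : ∀ {n d P} → Condition n d P → d < n → ∃ λ v → v ≢ origin × P v
    nontrivialSolution c d<n with v , v≢0 , h ← secondNonzero (Deg-≤ d<n (degree≤ c)) (atOrigin c) = v , v≢0 , sound c v h

  cubePoly : ∀ {n} → Cube n → Pol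
  cubePoly v = polyOf (λ k → bit (lookup v k))

  G-cubePoly : ∀ {n} (v : Cube n) → cubePoly v ∈G n
  G-cubePoly v = G-polyOf _

  cubePoly-≉0 : ∀ {n} {v : Cube n} → v ≢ origin → cubePoly v ≉0
  cubePoly-≉0 {v = []} v≢0 = contradiction refl v≢0
  cubePoly-≉0 {v = true ∷ v} v≢0 e = 0≢1 (sym (at e 0))
  cubePoly-≉0 {v = false ∷ v} v≢0 e = cubePoly-≉0 (v≢0 ∘ cong (false ∷_)) (mk≈ λ i → at e (suc i))

  cubePoly-origin : ∀ n → cubePoly (origin {n}) ≈ []
  cubePoly-origin zero    = ≈-refl
  cubePoly-origin (suc n) = ≈-trans (∷-cong refl (cubePoly-origin n)) 0∷[]≈[]

  -- `cubePoly v` is linear in the bits of v. Peeling off one factor leaves a sum of bits times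
  -- values at the next lower power, with μ multiplied by powers of t.
  Deg-lin-^p : ∀ {n} j μ → Deg n (suc j) (λ v → ⟦ μ ⟧ (cubePoly v ^p j))
  Deg-lin-^p zero    μ = Deg-const 0 _
  Deg-lin-^p (suc j) μ = Deg-ext (2 + j) (λ v → sym (lin-polyOf μ _ (cubePoly v ^p j)))
    (Deg-sumf (2 + j) _ λ k → Deg-· 2 j (Deg-bit k) (Deg-lin-^p j (tpow (toℕ k) ▷ μ)))

opaque
  primePart : ∀ {p} → Prime p → ∀ n → 1 ≤ n → ∃ λ c → ∃ λ m → 1 ≤ m × ¬ (p ∣ m) × n ≡ m * p ^ c
  primePart {p} pr = <-rec _ go
    where
    go : ∀ n → (∀ {m} → m < n → 1 ≤ m → ∃ λ c → ∃ λ k → 1 ≤ k × ¬ (p ∣ k) × m ≡ k * p ^ c)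
       → 1 ≤ n → ∃ λ c → ∃ λ m → 1 ≤ m × ¬ (p ∣ m) × n ≡ m * p ^ c
    go n rec 1≤n with p ∣? n
    ... | no p∤n = 0 , n , 1≤n , p∤n , sym (ℕₚ.*-identityʳ n)
    ... | yes (divides zero refl) = contradiction 1≤n λ ()
    ... | yes (divides m@(suc _) refl) with rec (ℕₚ.m<m*n m p (ℕ.nonTrivial⇒n>1 p {{prime⇒nonTrivial pr}})) (s≤s z≤n)
    ...   | c , k , 1≤k , p∤k , eq = suc c , k , 1≤k , p∤k , (begin
        m * p ≡⟨ cong (_* p) eq ⟩
        k * p ^ c * p ≡⟨ ℕₚ.*-assoc k (p ^ c) p ⟩
        k * (p ^ c * p) ≡⟨ cong (k *_) (ℕₚ.*-comm (p ^ c) p) ⟩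
        k * p ^ suc c ∎)
      where open ≡-Reasoning

quotRem-unique : ∀ n {a b x y} → a < n → b < n → a + x * n ≡ b + y * n → a ≡ b × x ≡ y
quotRem-unique n@(suc _) {a} {b} {x} {y} a<n b<n eq = a≡b , ℕₚ.*-cancelʳ-≡ x y n (ℕₚ.+-cancelˡ-≡ a _ _ (trans eq (cong (_+ y * n) (sym a≡b))))
  where
  open ≡-Reasoning
  a≡b : a ≡ b
  a≡b = begin
    a ≡⟨ m<n⇒m%n≡m a<n ⟨
    a % n ≡⟨ [m+kn]%n≡m%n a x n ⟨
    (a + x * n) % n ≡⟨ cong (_% n) eq ⟩
    (b + y * n) % n ≡⟨ [m+kn]%n≡m%n b y n ⟩
    b % n ≡⟨ m<n⇒m%n≡m b<n ⟩
    b ∎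

-- Root functionals, division and gluing of functionals

module FrobeniusFunctionals (F : FiniteField) {p : ℕ} (pr : Prime p) (charp : HasCharacteristic F p) where
  open CubePolynomials F public
  open Characteristic pr charp public
  open Frobenius polyRing pr using (^p^-distrib-+)

  constant-∔ : ∀ a b → constant (a ∔ b) ≈ constant a ⊞ constant b
  constant-∔ a b = mk≈ λ { zero → sym (coef-⊞ (constant a) (constant b) 0)
                         ; (suc i) → sym (trans (coef-⊞ (constant a) (constant b) (suc i)) (∔-identityˡ 0f)) }

  ×p1p : ∀ n → n ×p 1p ≈ constant (n ×f 1f)
  ×p1p zero    = ≈-sym 0∷[]≈[]
  ×p1p (suc n) = ≈-trans (⊞-cong ≈-refl (×p1p n)) (≈-sym (constant-∔ 1f (n ×f 1f)))

  ^p^-distrib-⊞ : ∀ n f g → (f ⊞ g) ^p (p ^ n) ≈ f ^p (p ^ n) ⊞ g ^p (p ^ n)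
  ^p^-distrib-⊞ = ^p^-distrib-+ (≈-trans (×p1p p) (≈-trans (∷-cong char× ≈-refl) 0∷[]≈[]))

  constant-^p : ∀ a n → constant a ^p n ≈ constant (a ^f n)
  constant-^p a zero    = ≈-refl
  constant-^p a (suc n) = ≈-trans (⊠-congˡ (constant a) (constant-^p a n)) (constant-⊠ a (constant (a ^f n)))

  scale-^p : ∀ a f n → scale a f ^p n ≈ scale (a ^f n) (f ^p n)
  scale-^p a f n = begin
    scale a f ^p n ≈⟨ ^p-cong n (≈-sym (constant-⊠ a f)) ⟩
    (constant a ⊠ f) ^p n ≈⟨ ^p-distrib-⊠ (constant a) f n ⟩
    constant a ^p n ⊠ f ^p n ≈⟨ ⊠-cong (constant-^p a n) ≈-refl ⟩
    constant (a ^f n) ⊠ f ^p n ≈⟨ constant-⊠ (a ^f n) (f ^p n) ⟩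
    scale (a ^f n) (f ^p n) ∎
    where open ≈-Reasoning

  Λ : ℕ → Lin → Lin
  Λ d μ = record
    { ⟦_⟧ = λ f → root d (⟦ μ ⟧ (f ^p (p ^ d)))
    ; resp = λ e → cong (root d) (resp μ (^p-cong (p ^ d) e))
    ; lin-⊞ = λ f g → trans (cong (root d) (trans (resp μ (^p^-distrib-⊞ d f g)) (lin-⊞ μ _ _))) (root-∔ d _ _)
    ; lin-scale = λ a f → trans (cong (root d) (trans (resp μ (scale-^p a f (p ^ d))) (lin-scale μ _ _))) (root-· d a _) }

  Λ-^ : ∀ d μ f → ⟦ Λ d μ ⟧ f ^f (p ^ d) ≡ ⟦ μ ⟧ (f ^p (p ^ d))
  Λ-^ d μ f = root-^ d _

  -- A factor a between two root extractions passes through the inner one as a^(p^d). Repeated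
  -- extraction from multiples of μ thus never leaves the functionals `Λ d (a ▷ μ)`.
  Λ-∘ : ∀ c d a e μ f → ⟦ Λ c (a ▷ Λ d (e ▷ μ)) ⟧ f ≡ ⟦ Λ (d + c) ((e ⊠ a ^p (p ^ d)) ▷ μ) ⟧ f
  Λ-∘ c d a e μ f = ^p^-injective (d + c) (begin
    x ^f (p ^ (d + c)) ≡⟨ cong (x ^f_) p^d+c ⟩
    x ^f (p ^ c * p ^ d) ≡⟨ ^f-assocʳ x (p ^ c) (p ^ d) ⟨
    (x ^f (p ^ c)) ^f (p ^ d) ≡⟨ cong (_^f (p ^ d)) (Λ-^ c (a ▷ Λ d (e ▷ μ)) f) ⟩
    ⟦ Λ d (e ▷ μ) ⟧ (a ⊠ f ^p (p ^ c)) ^f (p ^ d) ≡⟨ Λ-^ d (e ▷ μ) (a ⊠ f ^p (p ^ c)) ⟩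
    ⟦ μ ⟧ (e ⊠ (a ⊠ f ^p (p ^ c)) ^p (p ^ d)) ≡⟨ resp μ (⊠-congˡ e (^p-distrib-⊠ a _ (p ^ d))) ⟩
    ⟦ μ ⟧ (e ⊠ (a ^p (p ^ d) ⊠ (f ^p (p ^ c)) ^p (p ^ d))) ≡⟨ resp μ (≈-sym (⊠-assoc e _ _)) ⟩
    ⟦ μ ⟧ (e ⊠ a ^p (p ^ d) ⊠ (f ^p (p ^ c)) ^p (p ^ d))
      ≡⟨ resp μ (⊠-congˡ _ (≈-trans (^p-assocʳ f (p ^ c) (p ^ d)) (^p-congʳ f (sym p^d+c)))) ⟩
    ⟦ μ ⟧ (e ⊠ a ^p (p ^ d) ⊠ f ^p (p ^ (d + c))) ≡⟨ Λ-^ (d + c) ((e ⊠ a ^p (p ^ d)) ▷ μ) f ⟨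
    ⟦ Λ (d + c) ((e ⊠ a ^p (p ^ d)) ▷ μ) ⟧ f ^f (p ^ (d + c)) ∎)
    where
    open ≡-Reasoning
    x = ⟦ Λ c (a ▷ Λ d (e ▷ μ)) ⟧ f
    p^d+c : p ^ (d + c) ≡ p ^ c * p ^ d
    p^d+c = trans (ℕₚ.^-distribˡ-+-* p d c) (ℕₚ.*-comm (p ^ d) (p ^ c))

  -- The coefficient functional at deg q + n sees q t^n but none of the q t^k with k < n. So a
  -- multiple of it repairs the value at t^n and leaves those already arranged intact.
  divide : ∀ {q} → q ≉0 → ∀ γ n → ∃ λ γ′ → ∀ {f} → f ∈G n → ⟦ γ′ ⟧ (q ⊠ f) ≡ ⟦ γ ⟧ f
  divide {q} q≉0 γ zero = zeroLin , λ d → sym (lin-≈[] γ (G0⇒≈[] d))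
  divide {q} q≉0 γ (suc n) = γ″ , λ {f} → lin-ext (q ▷ γ″) γ onPowers {f}
    where
    open Degree (degree q≉0)
    γ′ = proj₁ (divide q≉0 γ n)
    c = (⟦ γ ⟧ (tpow n) ∔ neg (⟦ γ′ ⟧ (q ⊠ tpow n))) · inv (coef q deg) lead
    γ″ = addLin γ′ (scaleLin c (coefLin (deg + n)))
    onPowers : ∀ k → k < suc n → ⟦ γ″ ⟧ (q ⊠ tpow k) ≡ ⟦ γ ⟧ (tpow k)
    onPowers k (s≤s k≤n) with k ℕₚ.≟ n
    ... | yes refl = trans (cong (⟦ γ′ ⟧ (q ⊠ tpow k) ∔_) (begin
      c · coef (q ⊠ tpow k) (deg + k) ≡⟨ cong (c ·_) (coef-⊠-top bound (G-tpow k)) ⟩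
      c · (coef q deg · coef (tpow k) k) ≡⟨ cong (λ z → c · (coef q deg · z)) (coef-tpow k) ⟩
      c · (coef q deg · 1f) ≡⟨ cong (c ·_) (·-identityʳ _) ⟩
      c · coef q deg ≡⟨ ·-assoc _ _ _ ⟩
      diff · (inv (coef q deg) lead · coef q deg) ≡⟨ cong (diff ·_) (inv-inverseˡ _ lead) ⟩
      diff · 1f ≡⟨ ·-identityʳ _ ⟩
      diff ∎)) (trans (∔-comm _ _) (neg-cancel _ _))
      where
      open ≡-Reasoning
      diff = ⟦ γ ⟧ (tpow k) ∔ neg (⟦ γ′ ⟧ (q ⊠ tpow k))
    ... | no k≢n = trans (cong₂ _∔_ (proj₂ (divide q≉0 γ n) (G-≤ (ℕₚ.≤∧≢⇒< k≤n k≢n) (G-tpow k)))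
                     (trans (cong (c ·_) (trans (coef-⊠-top bound (G-≤ (s≤s k≤n) (G-tpow k)))
                       (trans (cong (coef q deg ·_) (coef-tpow-≢ k n (k≢n ∘ sym))) (·-zeroʳ _)))) (·-zeroʳ c))) (∔-identityʳ _)

  sumLin : ∀ {m} → (Fin m → Lin) → Lin
  sumLin {zero}  φ = zeroLin
  sumLin {suc m} φ = addLin (φ zero) (sumLin (φ ∘ suc))

  ⟦sumLin⟧ : ∀ {m} (φ : Fin m → Lin) f → ⟦ sumLin φ ⟧ f ≡ sumf (λ i → ⟦ φ i ⟧ f)
  ⟦sumLin⟧ {zero}  φ f = refl
  ⟦sumLin⟧ {suc m} φ f = cong (⟦ φ zero ⟧ f ∔_) (⟦sumLin⟧ (φ ∘ suc) f)

  sumf-zero : ∀ {m} {f : Fin m → 𝔽} → (∀ i → f i ≡ 0f) → sumf f ≡ 0f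
  sumf-zero {m} e = trans (sumf-cong e) (sumf-replicate-zero m)

  sumf-single : ∀ {m} (f : Fin m → 𝔽) i → (∀ j → j ≢ i → f j ≡ 0f) → sumf f ≡ f i
  sumf-single {suc m} f i e = trans (sumf-remove {i = i} f) (trans (cong (f i ∔_) (sumf-zero λ j → e (Fin.punchIn i j) (Finₚ.punchInᵢ≢i i j))) (∔-identityʳ _))

  valueLin : (ℕ → 𝔽) → ℕ → Lin
  valueLin val zero    = zeroLin
  valueLin val (suc n) = addLin (valueLin val n) (scaleLin (val n) (coefLin n))

  valueLin-≥ : ∀ val n k → n ≤ k → ⟦ valueLin val n ⟧ (tpow k) ≡ 0f
  valueLin-≥ val zero    k _   = refl
  valueLin-≥ val (suc n) k n<k = trans (cong₂ _∔_ (valueLin-≥ val n k (<⇒≤ n<k))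
    (trans (cong (val n ·_) (coef-tpow-≢ k n (ℕₚ.<⇒≢ n<k))) (·-zeroʳ _))) (∔-identityʳ 0f)

  valueLin-< : ∀ val n k → k < n → ⟦ valueLin val n ⟧ (tpow k) ≡ val k
  valueLin-< val (suc n) k (s≤s k≤n) with k ℕₚ.≟ n
  ... | yes refl = trans (cong₂ _∔_ (valueLin-≥ val k k ℕₚ.≤-refl) (trans (cong (val k ·_) (coef-tpow k)) (·-identityʳ _))) (∔-identityˡ _)
  ... | no k≢n = trans (cong₂ _∔_ (valueLin-< val n k (ℕₚ.≤∧≢⇒< k≤n k≢n))
    (trans (cong (val n ·_) (coef-tpow-≢ k n (k≢n ∘ sym))) (·-zeroʳ _))) (∔-identityʳ _)

  -- Disjoint blocks of R coefficients carry the ℓ functionals, so that ℓ simultaneous problems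
  -- become one.
  glue : ∀ {ℓ} R (σ : Fin ℓ → Lin) → ∃ λ ς → ∀ i {a} → a ∈G R → ⟦ ς ⟧ (tpow (R * toℕ i) ⊠ a) ≡ ⟦ σ i ⟧ a
  glue {ℓ} R σ = ς , λ i {a} → lin-ext (tpow (R * toℕ i) ▷ ς) (σ i) (λ s s<R →
      trans (resp ς (≈-sym (tpow-+ (R * toℕ i) s)))
      (trans (cong (λ m → ⟦ ς ⟧ (tpow m)) (sym (index i s s<R)))
      (trans (valueLin-< val (ℓ * R) _ (toℕ<n (Fin.combine i (Fin.fromℕ< s<R))))
      (trans (val-combine i (Fin.fromℕ< s<R)) (cong (λ m → ⟦ σ i ⟧ (tpow m)) (toℕ-fromℕ< s<R)))))) {a}
    where
    entry : Fin ℓ × Fin R → 𝔽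
    entry (i , s) = ⟦ σ i ⟧ (tpow (toℕ s))
    val : ℕ → 𝔽
    val m with m <? ℓ * R
    ... | yes lt = entry (Fin.remQuot R (Fin.fromℕ< lt))
    ... | no  _  = 0f
    val-combine : ∀ i s → val (toℕ (Fin.combine i s)) ≡ entry (i , s)
    val-combine i s with toℕ (Fin.combine i s) <? ℓ * R
    ... | yes lt = cong entry (trans (cong (Fin.remQuot R) (Finₚ.fromℕ<-toℕ (Fin.combine i s) lt)) (remQuot-combine i s))
    ... | no ¬lt = contradiction (toℕ<n (Fin.combine i s)) ¬lt
    ς = valueLin val (ℓ * R)
    index : ∀ i s (s<R : s < R) → toℕ (Fin.combine i (Fin.fromℕ< s<R)) ≡ R * toℕ i + s
    index i s s<R = trans (Finₚ.toℕ-combine i (Fin.fromℕ< s<R)) (cong (R * toℕ i +_) (toℕ-fromℕ< s<R))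

-- Linearizing and solving equations for powers

module PowerEquations (F : FiniteField) {p : ℕ} (pr : Prime p) (charp : HasCharacteristic F p) where
  open FrobeniusFunctionals F pr charp public

  G-tpow-⊠ : ∀ k {f n} → f ∈G n → tpow k ⊠ f ∈G (k + n)
  G-tpow-⊠ zero    d = G-≈ (≈-sym (⊠-identityˡ _)) d
  G-tpow-⊠ (suc k) {f} d = G-≈ (≈-sym (⊠-shiftˡ (tpow k) f)) (G-∷ (G-tpow-⊠ k d))

  coef-tpow-⊠-+ : ∀ k f i → coef (tpow k ⊠ f) (k + i) ≡ coef f i
  coef-tpow-⊠-+ zero    f i = at (⊠-identityˡ f) i
  coef-tpow-⊠-+ (suc k) f i = trans (at (⊠-shiftˡ (tpow k) f) (suc k + i)) (coef-tpow-⊠-+ k f i)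

  -- Terms of order at least two in ζ lose K from the degree at least twice and gain at most H per
  -- factor ζ; since n + 2 H ≤ K, they stay below k K even after multiplication by a. In the
  -- coefficients from k K up to (k + 1) K, the power times a therefore depends linearly on ζ.
  linearPart : ∀ {K H n} → n + (H + H) ≤ K → ∀ {ζ} → ζ ∈G H → ∀ k → ∃ λ Ξ →
    (tpow K ⊞ ζ) ^p suc k ≈ (tpow (suc k * K) ⊞ (suc k ×p 1p) ⊠ (tpow (k * K) ⊠ ζ)) ⊞ Ξ
    × (∀ {a} → a ∈G n → Ξ ⊠ a ∈G (k * K))
  linearPart {K} {H} {n} _ {ζ} _ zero = [] , eq , λ {a} _ → G-≈ (≈-sym (⊠-zeroˡ a)) G-[]
    where
    open ≈-Reasoning
    eq : (tpow K ⊞ ζ) ^p 1 ≈ (tpow (1 * K) ⊞ (1 ×p 1p) ⊠ (tpow 0 ⊠ ζ)) ⊞ []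
    eq = begin
      (tpow K ⊞ ζ) ⊠ 1p ≈⟨ ⊠-identityʳ _ ⟩
      tpow K ⊞ ζ ≈⟨ ⊞-cong (mk≈ λ i → cong (λ m → coef (tpow m) i) (sym (ℕₚ.+-identityʳ K)))
                                                          (≈-sym (≈-trans (⊠-cong (⊞-identityʳ 1p) (⊠-identityˡ ζ)) (⊠-identityˡ ζ))) ⟩
      tpow (1 * K) ⊞ (1 ×p 1p) ⊠ (tpow 0 ⊠ ζ) ≈⟨ ⊞-identityʳ _ ⟨
      (tpow (1 * K) ⊞ (1 ×p 1p) ⊠ (tpow 0 ⊠ ζ)) ⊞ [] ∎
  linearPart {K} {H} {n} n+H+H≤K {ζ} dζ (suc k) with linearPart n+H+H≤K dζ k
  ... | Ξ , eq , small = Γ ⊠ (tpow (k * K) ⊠ (ζ ⊠ ζ)) ⊞ (tpow K ⊞ ζ) ⊠ Ξ , eq′ , small′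
    where
    Γ = suc k ×p 1p
    open SemiringSolver (CommutativeRing.commutativeSemiring polyRing) using (solve; _:=_; _:+_; _:*_; con)
    expand : ∀ X ζ Y Γ Ξ → (X ⊞ ζ) ⊠ ((X ⊠ Y ⊞ Γ ⊠ (Y ⊠ ζ)) ⊞ Ξ)
           ≈ (X ⊠ (X ⊠ Y) ⊞ (1p ⊞ Γ) ⊠ ((X ⊠ Y) ⊠ ζ)) ⊞ (Γ ⊠ (Y ⊠ (ζ ⊠ ζ)) ⊞ (X ⊞ ζ) ⊠ Ξ)
    expand = solve 5 (λ X ζ Y Γ Ξ → (X :+ ζ) :* ((X :* Y :+ Γ :* (Y :* ζ)) :+ Ξ)
           := (X :* (X :* Y) :+ (con 1 :+ Γ) :* ((X :* Y) :* ζ)) :+ (Γ :* (Y :* (ζ :* ζ)) :+ (X :+ ζ) :* Ξ)) ≈-refl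
    open ≈-Reasoning
    eq′ : (tpow K ⊞ ζ) ^p suc (suc k) ≈
          (tpow (suc (suc k) * K) ⊞ (suc (suc k) ×p 1p) ⊠ (tpow (suc k * K) ⊠ ζ)) ⊞ (Γ ⊠ (tpow (k * K) ⊠ (ζ ⊠ ζ)) ⊞ (tpow K ⊞ ζ) ⊠ Ξ)
    eq′ = begin
      (tpow K ⊞ ζ) ⊠ (tpow K ⊞ ζ) ^p suc k
        ≈⟨ ⊠-congˡ _ (≈-trans eq (⊞-cong (⊞-cong (tpow-+ K (k * K)) ≈-refl) ≈-refl)) ⟩
      (tpow K ⊞ ζ) ⊠ ((tpow K ⊠ tpow (k * K) ⊞ Γ ⊠ (tpow (k * K) ⊠ ζ)) ⊞ Ξ)
        ≈⟨ expand (tpow K) ζ (tpow (k * K)) Γ Ξ ⟩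
      (tpow K ⊠ (tpow K ⊠ tpow (k * K)) ⊞ (1p ⊞ Γ) ⊠ ((tpow K ⊠ tpow (k * K)) ⊠ ζ)) ⊞ (Γ ⊠ (tpow (k * K) ⊠ (ζ ⊠ ζ)) ⊞ (tpow K ⊞ ζ) ⊠ Ξ)
        ≈⟨ ⊞-cong (⊞-cong (≈-sym (≈-trans (tpow-+ K (suc k * K)) (⊠-congˡ _ (tpow-+ K (k * K)))))
                          (⊠-congˡ _ (⊠-cong (≈-sym (tpow-+ K (k * K))) ≈-refl))) ≈-refl ⟩
      (tpow (suc (suc k) * K) ⊞ (suc (suc k) ×p 1p) ⊠ (tpow (suc k * K) ⊠ ζ)) ⊞ (Γ ⊠ (tpow (k * K) ⊠ (ζ ⊠ ζ)) ⊞ (tpow K ⊞ ζ) ⊠ Ξ) ∎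
    regroup : ∀ X ζ Y Γ Ξ a → (Γ ⊠ (Y ⊠ (ζ ⊠ ζ)) ⊞ (X ⊞ ζ) ⊠ Ξ) ⊠ a ≈ Γ ⊠ (Y ⊠ (a ⊠ (ζ ⊠ ζ))) ⊞ (X ⊠ (Ξ ⊠ a) ⊞ ζ ⊠ (Ξ ⊠ a))
    regroup = solve 6 (λ X ζ Y Γ Ξ a → (Γ :* (Y :* (ζ :* ζ)) :+ (X :+ ζ) :* Ξ) :* a
                                     := Γ :* (Y :* (a :* (ζ :* ζ))) :+ (X :* (Ξ :* a) :+ ζ :* (Ξ :* a))) ≈-refl
    Γ-G : ∀ {f n} → f ∈G n → Γ ⊠ f ∈G n
    Γ-G {f} d = G-≈ (≈-sym (≈-trans (⊠-cong (×p1p (suc k)) ≈-refl) (constant-⊠ _ f))) (G-scale d)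
    H≤K : H ≤ K
    H≤K = ≤-trans (m≤m+n H H) (≤-trans (m≤n+m (H + H) n) n+H+H≤K)
    small′ : ∀ {a} → a ∈G n → (Γ ⊠ (tpow (k * K) ⊠ (ζ ⊠ ζ)) ⊞ (tpow K ⊞ ζ) ⊠ Ξ) ⊠ a ∈G (suc k * K)
    small′ {a} da = G-≈ (≈-sym (regroup (tpow K) ζ (tpow (k * K)) Γ Ξ a))
      (G-⊞ (Γ-G (G-≤ (≤-trans (+-monoʳ-≤ (k * K) n+H+H≤K) (≤-reflexive (ℕₚ.+-comm (k * K) K)))
                     (G-tpow-⊠ (k * K) (G-⊠ da (G-⊠ dζ dζ)))))
           (G-⊞ (G-tpow-⊠ K (small da)) (G-≤ (+-monoˡ-≤ (k * K) H≤K) (G-⊠ dζ (small da)))))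

  -- The positions r + (n + r n) p^b, r < p^b, are spread so that every t^s with s < n is
  -- moved by a multiple of p^b onto one of them, while all other t^s′ miss them.
  module Positions (b n : ℕ) where
    q = p ^ b

    instance
      q-nonZero : ℕ.NonZero q
      q-nonZero = ℕ.>-nonZero (0<p^ b)

    position : ℕ → ℕ
    position r = r + (n + r * n) * q

    shift : ℕ → ℕ
    shift s = (n + s % q * n) ∸ s / q

    shift-≤ : ∀ s → shift s ≤ q * n
    shift-≤ s = ≤-trans (m∸n≤m _ (s / q)) (*-monoˡ-≤ n (m%n<n s q))

    s/q≤ : ∀ {s} → s < n → s / q ≤ n + s % q * n
    s/q≤ {s} s<n = ≤-trans (m/n≤m s q) (≤-trans (<⇒≤ s<n) (m≤m+n n _))

    shift-+ : ∀ {s} → s < n → shift s * q + s / q * q ≡ (n + s % q * n) * q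
    shift-+ {s} s<n = trans (sym (*-distribʳ-+ q (shift s) (s / q))) (cong (_* q) (ℕₚ.m∸n+n≡m (s/q≤ s<n)))

    hit : ∀ {s} → s < n → s + shift s * q ≡ position (s % q)
    hit {s} s<n = begin
      s + shift s * q ≡⟨ cong (_+ shift s * q) (m≡m%n+[m/n]*n s q) ⟩
      s % q + s / q * q + shift s * q ≡⟨ ℕₚ.+-assoc (s % q) _ _ ⟩
      s % q + (s / q * q + shift s * q) ≡⟨ cong (s % q +_) (trans (ℕₚ.+-comm (s / q * q) _) (shift-+ s<n)) ⟩
      position (s % q) ∎
      where open ≡-Reasoning

    -- Modulo q the equation gives r = s′ % q. The quotients of the positions are multiples of n,
    -- whereas s / q and s′ / q are below n, so a comparison of base n digits gives the rest.
    miss : ∀ {s s′ r} → s < n → s′ < n → r < q → s′ + shift s * q ≡ position r → s′ ≡ s × r ≡ s % q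
    miss {s} {s′} {r} s<n s′<n r<q eq = s′≡s , sym (proj₂ outer)
      where
      open ≡-Reasoning
      rearranged : s′ % q + (s′ / q + (n + s % q * n)) * q ≡ r + ((n + r * n) + s / q) * q
      rearranged = begin
        s′ % q + (s′ / q + (n + s % q * n)) * q ≡⟨ cong (s′ % q +_) (*-distribʳ-+ q (s′ / q) _) ⟩
        s′ % q + (s′ / q * q + (n + s % q * n) * q) ≡⟨ ℕₚ.+-assoc (s′ % q) _ _ ⟨
        s′ % q + s′ / q * q + (n + s % q * n) * q ≡⟨ cong₂ _+_ (m≡m%n+[m/n]*n s′ q) (shift-+ s<n) ⟨
        s′ + (shift s * q + s / q * q) ≡⟨ ℕₚ.+-assoc s′ _ _ ⟨
        s′ + shift s * q + s / q * q ≡⟨ cong (_+ s / q * q) eq ⟩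
        r + (n + r * n) * q + s / q * q ≡⟨ ℕₚ.+-assoc r _ _ ⟩
        r + ((n + r * n) * q + s / q * q) ≡⟨ cong (r +_) (*-distribʳ-+ q (n + r * n) (s / q)) ⟨
        r + ((n + r * n) + s / q) * q ∎
      inner = quotRem-unique q (m%n<n s′ q) r<q rearranged
      outer : s′ / q ≡ s / q × s % q ≡ r
      outer = quotRem-unique n (ℕₚ.≤-<-trans (m/n≤m s′ q) s′<n) (ℕₚ.≤-<-trans (m/n≤m s q) s<n)
        (ℕₚ.+-cancelˡ-≡ n _ _ (begin
          n + (s′ / q + s % q * n) ≡⟨ ℕₚ.+-assoc n (s′ / q) _ ⟨
          n + s′ / q + s % q * n ≡⟨ cong (_+ s % q * n) (ℕₚ.+-comm n (s′ / q)) ⟩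
          s′ / q + n + s % q * n ≡⟨ ℕₚ.+-assoc (s′ / q) n _ ⟩
          s′ / q + (n + s % q * n) ≡⟨ proj₂ inner ⟩
          n + r * n + s / q ≡⟨ ℕₚ.+-assoc n (r * n) (s / q) ⟩
          n + (r * n + s / q) ≡⟨ cong (n +_) (ℕₚ.+-comm (r * n) (s / q)) ⟩
          n + (s / q + r * n) ∎))
      s′≡s : s′ ≡ s
      s′≡s = begin
        s′ ≡⟨ m≡m%n+[m/n]*n s′ q ⟩
        s′ % q + s′ / q * q ≡⟨ cong₂ (λ x y → x + y * q) (trans (proj₁ inner) (sym (proj₂ outer))) (proj₁ outer) ⟩
        s % q + s / q * q ≡⟨ m≡m%n+[m/n]*n s q ⟨
        s ∎

    spread : Lin
    spread = sumLin {q} λ r → coefLin (position (toℕ r))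

    row : Fin n → Lin
    row s = Λ b (tpow (toℕ s) ▷ spread)

    row-tpow : ∀ s m → ⟦ row s ⟧ (tpow m) ^f q ≡ sumf {q} (λ r → coef (tpow (toℕ s + m * q)) (position (toℕ r)))
    row-tpow s m = trans (Λ-^ b (tpow (toℕ s) ▷ spread) (tpow m)) (trans (resp spread pow) (⟦sumLin⟧ {q} _ _))
      where
      pow : tpow (toℕ s) ⊠ tpow m ^p q ≈ tpow (toℕ s + m * q)
      pow = ≈-trans (⊠-congˡ (tpow (toℕ s)) (≈-trans (tpow-^p m q) (mk≈ λ i → cong (λ k → coef (tpow k) i) (ℕₚ.*-comm q m)))) (≈-sym (tpow-+ (toℕ s) (m * q)))

    row-diagonal : ∀ s → ⟦ row s ⟧ (tpow (shift (toℕ s))) ≢ 0f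
    row-diagonal s e = 0≢1 (begin
      0f ≡⟨ 0^f q (0<p^ b) ⟨
      0f ^f q ≡⟨ cong (_^f q) e ⟨
      ⟦ row s ⟧ (tpow (shift (toℕ s))) ^f q ≡⟨ row-tpow s (shift (toℕ s)) ⟩
      sumf {q} entries ≡⟨ sumf-single entries r₀ others ⟩
      entries r₀ ≡⟨ cong (λ k → coef (tpow target) (position k)) (toℕ-fromℕ< (m%n<n (toℕ s) q)) ⟩
      coef (tpow target) (position (toℕ s % q)) ≡⟨ cong (coef (tpow target)) (hit (toℕ<n s)) ⟨
      coef (tpow target) target ≡⟨ coef-tpow target ⟩
      1f ∎)
      where
      open ≡-Reasoning
      target = toℕ s + shift (toℕ s) * q
      entries : Fin q → 𝔽
      entries r = coef (tpow target) (position (toℕ r))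
      r₀ : Fin q
      r₀ = Fin.fromℕ< (m%n<n (toℕ s) q)
      others : ∀ r → r ≢ r₀ → entries r ≡ 0f
      others r r≢r₀ = coef-tpow-≢ target (position (toℕ r)) λ eq → r≢r₀ (Finₚ.toℕ-injective
        (trans (proj₂ (miss (toℕ<n s) (toℕ<n s) (toℕ<n r) (sym eq))) (sym (toℕ-fromℕ< (m%n<n (toℕ s) q)))))

    row-offDiagonal : ∀ s s′ → s′ ≢ s → ⟦ row s′ ⟧ (tpow (shift (toℕ s))) ≡ 0f
    row-offDiagonal s s′ s′≢s = ^f-≡0 q (trans (row-tpow s′ (shift (toℕ s))) (sumf-zero λ r →
      coef-tpow-≢ _ (position (toℕ r)) λ eq → s′≢s (Finₚ.toℕ-injective (proj₁ (miss (toℕ<n s) (toℕ<n s′) (toℕ<n r) (sym eq))))))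

    -- At t^(shift s) every row except the one of s vanishes, which rules out any relation between
    -- the rows.
    row-onto : Onto row (suc (q * n))
    row-onto with relationOrOnto row (suc (q * n))
    ... | inj₂ onto = onto
    ... | inj₁ (c , (s , cₛ≢0) , rel) = contradiction
          (trans (sym (sumf-single (λ i → c i · ⟦ row i ⟧ z) s λ j j≢s → trans (cong (c j ·_) (row-offDiagonal s j j≢s)) (·-zeroʳ _))) (rel dz))
          (·-≢0 cₛ≢0 (row-diagonal s))
      where
      z = tpow (shift (toℕ s))
      dz : z ∈G suc (q * n)
      dz = G-≤ (s≤s (shift-≤ (toℕ s))) (G-tpow (shift (toℕ s)))

    -- `spread` at t^s z^q is the q-th power of `row s` at z. Replacing the targets by their roots
    -- thus turns the equations for z^q into linear ones for z.
    solvePower : ∀ σ → ∃ λ z → z ∈G suc (q * n) × (∀ {a} → a ∈G n → ⟦ spread ⟧ (a ⊠ z ^p q) ≡ ⟦ σ ⟧ a)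
    solvePower σ with row-onto (λ s → root b (⟦ σ ⟧ (tpow (toℕ s))))
    ... | z , dz , eq = z , dz , λ {a} da → trans (resp spread (⊠-comm a (z ^p q)))
          (lin-ext (z ^p q ▷ spread) σ (λ k k<n → trans (resp spread (⊠-comm (z ^p q) (tpow k))) (onPower k k<n)) da)
      where
      onPower : ∀ k → k < n → ⟦ spread ⟧ (tpow k ⊠ z ^p q) ≡ ⟦ σ ⟧ (tpow k)
      onPower k k<n = subst (λ j → ⟦ spread ⟧ (tpow j ⊠ z ^p q) ≡ ⟦ σ ⟧ (tpow j)) (toℕ-fromℕ< k<n)
        (trans (sym (Λ-^ b (tpow (toℕ s) ▷ spread) z)) (trans (cong (_^f q) (eq s)) (root-^ b _)))
        where s = Fin.fromℕ< k<n

    position-< : ∀ r → r < q → position r < q * suc (q * n)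
    position-< r r<q = <-≤-trans (ℕₚ.+-monoˡ-< ((n + r * n) * q) r<q)
      (≤-trans (+-monoʳ-≤ q (≤-trans (*-monoˡ-≤ q (*-monoˡ-≤ n r<q)) (≤-reflexive (ℕₚ.*-comm (q * n) q))))
        (≤-reflexive (sym (ℕₚ.*-suc q (q * n)))))

module Units (M : ℕ) (1≤M : 1 ≤ M) where
  infix 4 _⊑_

  -- Sizes are measured in multiples of M. That the factors are free of M is what makes θ
  -- independent of N.
  record _⊑_ (x c : ℕ) : Set where
    constructor mk⊑
    field get : x ≤ c * M
  open _⊑_ public

  ⊑-+ : ∀ {x y a b} → x ⊑ a → y ⊑ b → x + y ⊑ a + b
  ⊑-+ {a = a} {b} (mk⊑ x≤) (mk⊑ y≤) = mk⊑ (≤-trans (ℕₚ.+-mono-≤ x≤ y≤) (≤-reflexive (sym (*-distribʳ-+ M a b))))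

  ⊑-* : ∀ k {x a} → x ⊑ a → k * x ⊑ k * a
  ⊑-* k {a = a} (mk⊑ x≤) = mk⊑ (≤-trans (*-monoʳ-≤ k x≤) (≤-reflexive (sym (ℕₚ.*-assoc k a M))))

  ⊑-const : ∀ c → c ⊑ c
  ⊑-const c = mk⊑ (≤-trans (≤-reflexive (sym (ℕₚ.*-identityʳ c))) (*-monoʳ-≤ c 1≤M))

  ⊑-unit : ∀ a → a * M ⊑ a
  ⊑-unit a = mk⊑ ℕₚ.≤-refl

  ⊑-mono : ∀ {x a b} → x ⊑ a → a ≤ b → x ⊑ b
  ⊑-mono (mk⊑ x≤) a≤b = mk⊑ (≤-trans x≤ (*-monoˡ-≤ M a≤b))

module PowerSurjectivity (F : FiniteField) {p : ℕ} (pr : Prime p) (charp : HasCharacteristic F p) where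
  open PowerEquations F pr charp public

  -- The γ precede the targets σ, so they can be imposed on an x₀ from which σ is computed only
  -- later. With e = (k + 1) p^b and p not dividing k + 1, put y = t^N₀ + z: then y^e is the (k +
  -- 1)-st power of t^K + z^(p^b). The γ read a window of coefficients where it is linear in
  -- z^(p^b), and `solvePower` supplies z.
  powerSurjectivity : ∀ {e} → 1 ≤ e → ∀ ℓ κ → ∃ λ λₑ → ∀ M → 1 ≤ M → ∀ {Q} → Q ≉0 →
    ∃ λ (γ : Fin ℓ → Lin) → ∀ (σ : Fin ℓ → Lin) →
    ∃ λ y → y ∈G (λₑ * M) × (∀ i {a} → a ∈G (κ * M) → ⟦ γ i ⟧ (Q ⊠ (a ⊠ y ^p e)) ≡ ⟦ σ i ⟧ a)
  powerSurjectivity {e} 1≤e ℓ κ with primePart pr e 1≤e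
  ... | b , suc k , _ , p∤e′ , e≡ = λₑ , main
    where
    q₀ = p ^ b
    h = q₀ * (1 + q₀ * (ℓ * κ)) + 1
    λₑ = 1 + ((ℓ * κ) + (h + h))
    main : ∀ M → 1 ≤ M → ∀ {Q} → Q ≉0 → ∃ λ (γ : Fin ℓ → Lin) → ∀ (σ : Fin ℓ → Lin) →
      ∃ λ y → y ∈G (λₑ * M) × (∀ i {a} → a ∈G (κ * M) → ⟦ γ i ⟧ (Q ⊠ (a ⊠ y ^p e)) ≡ ⟦ σ i ⟧ a)
    main M 1≤M {Q} Q≉0 = γ , solve′
      where
      open Units M 1≤M
      R = κ * M
      n = ℓ * R
      open Positions b n
      H = q * suc (q * n) + 1
      N₀ = n + (H + H)
      K = q * N₀
      N₀≤K : N₀ ≤ K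
      N₀≤K = ℕₚ.m≤n*m N₀ q
      H≤N₀ : H ≤ N₀
      H≤N₀ = ≤-trans (m≤m+n H H) (m≤n+m (H + H) n)
      size-y : suc N₀ ≤ λₑ * M
      size-y = get (⊑-+ (⊑-const 1) (⊑-+ n⊑ (⊑-+ H⊑ H⊑)))
        where
        n⊑ : n ⊑ ℓ * κ
        n⊑ = ⊑-* ℓ (⊑-unit κ)
        H⊑ : H ⊑ h
        H⊑ = ⊑-+ (⊑-* q (⊑-+ (⊑-const 1) (⊑-* q n⊑))) (⊑-const 1)
      -- These positions lie between k K and (k + 1) K: multiples of the leading power t^((k + 1) K)
      -- begin above them, and the terms of higher order in ζ end below them.
      γ₀ = sumLin {q} λ r → coefLin (k * K + position (toℕ r))
      γ′ = proj₁ (divide Q≉0 γ₀ (n + (e * (λₑ * M) + 1)))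
      γ′-eq = proj₂ (divide Q≉0 γ₀ (n + (e * (λₑ * M) + 1)))
      γ : Fin ℓ → Lin
      γ i = tpow (R * toℕ i) ▷ γ′
      solve′ : ∀ (σ : Fin ℓ → Lin) → ∃ λ y → y ∈G (λₑ * M) × (∀ i {a} → a ∈G R → ⟦ γ i ⟧ (Q ⊠ (a ⊠ y ^p e)) ≡ ⟦ σ i ⟧ a)
      solve′ σ = y , dy , λ i {a} da → begin
        ⟦ γ′ ⟧ (tpow (R * toℕ i) ⊠ (Q ⊠ (a ⊠ y ^p e)))
          ≡⟨ resp γ′ (≈-trans (⊠-leftSwap (tpow (R * toℕ i)) Q _) (⊠-congˡ Q (≈-sym (⊠-assoc (tpow (R * toℕ i)) a _)))) ⟩
        ⟦ γ′ ⟧ (Q ⊠ ((tpow (R * toℕ i) ⊠ a) ⊠ y ^p e)) ≡⟨ γ′-eq (G-⊠ (shifted i da) (G-^p e dy)) ⟩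
        ⟦ γ₀ ⟧ ((tpow (R * toℕ i) ⊠ a) ⊠ y ^p e) ≡⟨ evaluate (shifted i da) ⟩
        ⟦ ς ⟧ (tpow (R * toℕ i) ⊠ a) ≡⟨ proj₂ (glue R σ) i da ⟩
        ⟦ σ i ⟧ a ∎
        where
        open ≡-Reasoning
        ς = proj₁ (glue R σ)
        e′≢0 = p∤⇒×≢0 (suc k) p∤e′
        -- The linear term of y^e carries the factor k + 1, which is compensated here.
        solution = solvePower (scaleLin (inv _ e′≢0) ς)
        z = proj₁ solution
        dz = proj₁ (proj₂ solution)
        y = tpow N₀ ⊞ z
        dy : y ∈G (λₑ * M)
        dy = G-≤ size-y (G-⊞ (G-tpow N₀) (G-≤ (≤-trans (≤-trans (ℕₚ.m≤n*m _ q) (m≤m+n _ 1)) (≤-trans H≤N₀ (ℕₚ.n≤1+n N₀))) dz))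
        ζ = z ^p q
        shifted : ∀ i {a} → a ∈G R → tpow (R * toℕ i) ⊠ a ∈G n
        shifted i da = G-≤ (≤-trans (≤-reflexive (trans (ℕₚ.+-comm (R * toℕ i) R) (cong (R +_) (ℕₚ.*-comm R (toℕ i)))))
          (*-monoˡ-≤ R (toℕ<n i))) (G-tpow-⊠ (R * toℕ i) da)
        expansion = linearPart {K} {H} {n} N₀≤K {ζ} (G-^p q dz) k
        Ξ = proj₁ expansion
        y^e : y ^p e ≈ (tpow (suc k * K) ⊞ (suc k ×p 1p) ⊠ (tpow (k * K) ⊠ ζ)) ⊞ Ξ
        y^e = ≈-trans (^p-congʳ y (trans e≡ (ℕₚ.*-comm (suc k) q)))
          (≈-trans (≈-sym (^p-assocʳ y q (suc k)))
          (≈-trans (^p-cong (suc k) (≈-trans (^p^-distrib-⊞ b (tpow N₀) z) (⊞-cong (tpow-^p N₀ q) ≈-refl)))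
                   (proj₁ (proj₂ expansion))))
        evaluate : ∀ {A} → A ∈G n → ⟦ γ₀ ⟧ (A ⊠ y ^p e) ≡ ⟦ ς ⟧ A
        evaluate {A} dA = begin
          ⟦ γ₀ ⟧ (A ⊠ y ^p e) ≡⟨ resp γ₀ A⊠y^e ⟩
          ⟦ γ₀ ⟧ ((tpow (suc k * K) ⊠ A ⊞ suc k ×p (tpow (k * K) ⊠ (A ⊠ ζ))) ⊞ Ξ ⊠ A) ≡⟨ ⟦sumLin⟧ {q} _ _ ⟩
          sumf {q} (λ r → coef ((tpow (suc k * K) ⊠ A ⊞ suc k ×p (tpow (k * K) ⊠ (A ⊠ ζ))) ⊞ Ξ ⊠ A) (k * K + position (toℕ r)))
                                                                               ≡⟨ sumf-cong {q} term ⟩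
          sumf {q} (λ r → suc k ×f 1f · coef (A ⊠ ζ) (position (toℕ r))) ≡⟨ ·-distribˡ-sumf {q} _ (λ r → coef (A ⊠ ζ) (position (toℕ r))) ⟨
          suc k ×f 1f · sumf {q} (λ r → coef (A ⊠ ζ) (position (toℕ r))) ≡⟨ cong (suc k ×f 1f ·_) (⟦sumLin⟧ {q} _ (A ⊠ ζ)) ⟨
          suc k ×f 1f · ⟦ spread ⟧ (A ⊠ ζ) ≡⟨ cong (suc k ×f 1f ·_) (proj₂ (proj₂ solution) dA) ⟩
          suc k ×f 1f · (inv _ e′≢0 · ⟦ ς ⟧ A) ≡⟨ ·-assoc _ _ _ ⟨
          suc k ×f 1f · inv _ e′≢0 · ⟦ ς ⟧ A ≡⟨ cong (_· ⟦ ς ⟧ A) (inv-inverseʳ _ e′≢0) ⟩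
          1f · ⟦ ς ⟧ A ≡⟨ ·-identityˡ _ ⟩
          ⟦ ς ⟧ A ∎
          where
          open SemiringSolver (CommutativeRing.commutativeSemiring polyRing) using (solve; _:=_; _:+_; _:*_)
          regroup : ∀ A X D Y ζ Ξ → A ⊠ ((X ⊞ D ⊠ (Y ⊠ ζ)) ⊞ Ξ) ≈ (X ⊠ A ⊞ D ⊠ (Y ⊠ (A ⊠ ζ))) ⊞ Ξ ⊠ A
          regroup = solve 6 (λ A X D Y ζ Ξ → A :* ((X :+ D :* (Y :* ζ)) :+ Ξ) := (X :* A :+ D :* (Y :* (A :* ζ))) :+ Ξ :* A) ≈-refl
          A⊠y^e : A ⊠ y ^p e ≈ (tpow (suc k * K) ⊠ A ⊞ suc k ×p (tpow (k * K) ⊠ (A ⊠ ζ))) ⊞ Ξ ⊠ A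
          A⊠y^e = ≈-trans (⊠-congˡ A y^e) (≈-trans (regroup A (tpow (suc k * K)) (suc k ×p 1p) (tpow (k * K)) ζ Ξ)
            (⊞-cong (⊞-cong ≈-refl (≈-trans (×p-assoc-⊠ (suc k) 1p _) (×p-congʳ (suc k) (⊠-identityˡ _)))) ≈-refl))
          term : ∀ r → coef ((tpow (suc k * K) ⊠ A ⊞ suc k ×p (tpow (k * K) ⊠ (A ⊠ ζ))) ⊞ Ξ ⊠ A) (k * K + position (toℕ r))
                     ≡ suc k ×f 1f · coef (A ⊠ ζ) (position (toℕ r))
          term r = begin
            coef ((T₁ ⊞ T₂) ⊞ Ξ ⊠ A) m ≡⟨ coef-⊞ (T₁ ⊞ T₂) (Ξ ⊠ A) m ⟩
            coef (T₁ ⊞ T₂) m ∔ coef (Ξ ⊠ A) m ≡⟨ cong₂ _∔_ (coef-⊞ T₁ T₂ m) (vanish (proj₂ (proj₂ expansion) dA) m (m≤m+n (k * K) S)) ⟩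
            coef T₁ m ∔ coef T₂ m ∔ 0f ≡⟨ ∔-identityʳ _ ⟩
            coef T₁ m ∔ coef T₂ m ≡⟨ cong (_∔ coef T₂ m) (coef-tpow-⊠ (suc k * K) A m m<) ⟩
            0f ∔ coef T₂ m ≡⟨ ∔-identityˡ _ ⟩
            coef T₂ m ≡⟨ lin-×p (coefLin m) (suc k) _ ⟩
            suc k ×f 1f · coef (tpow (k * K) ⊠ (A ⊠ ζ)) m ≡⟨ cong (suc k ×f 1f ·_) (coef-tpow-⊠-+ (k * K) (A ⊠ ζ) S) ⟩
            suc k ×f 1f · coef (A ⊠ ζ) S ∎
            where
            S = position (toℕ r)
            m = k * K + S
            T₁ = tpow (suc k * K) ⊠ A
            T₂ = suc k ×p (tpow (k * K) ⊠ (A ⊠ ζ))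
            m< : m < suc k * K
            m< = <-≤-trans (ℕₚ.+-monoʳ-< (k * K) (<-≤-trans (position-< (toℕ r) (toℕ<n r))
                   (≤-trans (m≤m+n _ 1) (≤-trans H≤N₀ N₀≤K)))) (≤-reflexive (ℕₚ.+-comm (k * K) K))

-- Regular families and independent monomials

module LinearSystems (F : FiniteField) {p : ℕ} (pr : Prime p) (charp : HasCharacteristic F p) where
  open PowerSurjectivity F pr charp public

  Regular : ∀ {m} → (Fin m → Lin) → ℕ → ℕ → Set
  Regular {m} δ A B = (g : Fin m → Pol) → (∀ i → g i ∈G A) → (∀ {f} → f ∈G B → sumf (λ i → ⟦ δ i ⟧ (g i ⊠ f)) ≡ 0f) → ∀ i → g i ≈ []

  Independent : ∀ {ℓ} → (Fin ℓ → Pol) → ℕ → Set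
  Independent {ℓ} u A = (g : Fin ℓ → Pol) → (∀ l → g l ∈G A) → sump (λ l → g l ⊠ u l) ≈ [] → ∀ l → g l ≈ []

  open SumOverProduct fieldRing public using () renaming (sum-combine to sumf-combine)
  open SumOverProduct polyRing public using () renaming (sum-combine to sump-combine)

  uncombine : ∀ {m k} {P : Fin (m * k) → Set} → (∀ i j → P (Fin.combine {m} {k} i j)) → ∀ x → P x
  uncombine {m} {k} {P} h x = subst P (Finₚ.combine-remQuot {m} k x) (h _ _)

  -- t^T divides w while `A zero` has degree below T, so `A zero` vanishes. Then w can be cancelled
  -- and the argument repeated.
  powersIndependent : ∀ {E T w w′} → w ≈ tpow T ⊠ w′ → w′ ≉0 → (A : Fin E → Pol) → (∀ m → A m ∈G T) →
    sump (λ m → A m ⊠ w ^p toℕ m) ≈ [] → ∀ m → A m ≈ []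
  powersIndependent {suc E} {T} {w} {w′} w≈ w′≉0 A dA eq = λ { zero → A₀≈[] ; (suc m) → powersIndependent w≈ w′≉0 (A ∘ suc) (dA ∘ suc) X≈[] m }
    where
    open ≈-Reasoning
    X = sump (λ m → A (suc m) ⊠ w ^p toℕ m)
    split : A zero ⊞ w ⊠ X ≈ []
    split = begin
      A zero ⊞ w ⊠ X
        ≈⟨ ⊞-cong (≈-sym (⊠-identityʳ (A zero)))
                  (≈-trans (⊠-distribˡ-sump {E} w (λ m → A (suc m) ⊠ w ^p toℕ m)) (sump-cong {E} (λ m → ⊠-leftSwap w (A (suc m)) (w ^p toℕ m)))) ⟩
      sump (λ m → A m ⊠ w ^p toℕ m) ≈⟨ eq ⟩
      [] ∎
    A₀≈[] : A zero ≈ []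
    A₀≈[] = mk≈ coefficient
      where
      coefficient : ∀ i → coef (A zero) i ≡ 0f
      coefficient i with i <? T
      ... | no ¬i<T = vanish (dA zero) i (≮⇒≥ ¬i<T)
      ... | yes i<T = trans (sym (∔-identityʳ _)) (trans (cong (coef (A zero) i ∔_) (sym low)) (trans (sym (coef-⊞ (A zero) (w ⊠ X) i)) (at split i)))
        where
        low : coef (w ⊠ X) i ≡ 0f
        low = trans (at (≈-trans (⊠-cong w≈ ≈-refl) (⊠-assoc (tpow T) w′ X)) i) (coef-tpow-⊠ T (w′ ⊠ X) i i<T)
    w≉0 : w ≉0
    w≉0 e = ⊠-≉0 (tpow≉0 T) w′≉0 (≈-trans (≈-sym w≈) e)
    X≈[] : X ≈ []
    X≈[] = ⊠-cancelˡ w≉0 (≈-trans (≈-sym (⊞-identityˡ _)) (≈-trans (⊞-cong (≈-sym A₀≈[]) ≈-refl) split))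

  -- For fixed m, the sum over l of the g u_l has degree below T. By `powersIndependent` each of
  -- these sums is zero, and the independence of u applies to each m separately.
  towerIndependent : ∀ {ℓ E A T} {u : Fin ℓ → Pol} {w w′} → w ≈ tpow T ⊠ w′ → w′ ≉0 → (∀ {g} l → g ∈G A → g ⊠ u l ∈G T) →
    Independent u A → (u′ : Fin (ℓ * E) → Pol) → (∀ l m → u′ (Fin.combine l m) ≈ u l ⊠ w ^p toℕ m) → Independent u′ A
  towerIndependent {ℓ} {E} {u = u} {w} w≈ w′≉0 small ind u′ u′-combine g dg eq =
    uncombine {ℓ} {E} {λ x → g x ≈ []} λ l m → ind (λ l → g (Fin.combine l m)) (λ l → dg _) (inner≈[] m) l
    where
    inner : Fin E → Pol
    inner m = sump {ℓ} (λ l → g (Fin.combine l m) ⊠ u l)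
    outer : sump {E} (λ m → inner m ⊠ w ^p toℕ m) ≈ []
    outer = begin
      sump {E} (λ m → inner m ⊠ w ^p toℕ m)
        ≈⟨ sump-cong {E} (λ m → ≈-trans (⊠-distribʳ-sump {ℓ} (w ^p toℕ m) (λ l → g (Fin.combine l m) ⊠ u l))
             (sump-cong {ℓ} (λ l → ≈-trans (⊠-assoc _ (u l) _) (⊠-congˡ _ (≈-sym (u′-combine l m)))))) ⟩
      sump {E} (λ m → sump {ℓ} (λ l → g (Fin.combine l m) ⊠ u′ (Fin.combine l m)))
        ≈⟨ sump-comm {E} {ℓ} (λ m l → g (Fin.combine l m) ⊠ u′ (Fin.combine l m)) ⟩
      sump {ℓ} (λ l → sump {E} (λ m → g (Fin.combine l m) ⊠ u′ (Fin.combine l m)))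
        ≈⟨ sump-combine ℓ {E} (λ x → g x ⊠ u′ x) ⟨
      sump {ℓ * E} (λ x → g x ⊠ u′ x) ≈⟨ eq ⟩
      [] ∎
      where open ≈-Reasoning
    inner≈[] : ∀ m → inner m ≈ []
    inner≈[] = powersIndependent w≈ w′≉0 inner (λ m → G-sump _ λ l → small l (dg _)) outer

-- Systems of conditions on powers of x

module Attainability (F : FiniteField) {p : ℕ} (pr : Prime p) (charp : HasCharacteristic F p)
                     (L D : ℕ) (n q : ℕ) (clo : ℕ → ℕ) where
  open LinearSystems F pr charp public

  -- Functionals δ i, closed (up to the factor Q) under extracting p^c-th roots as long as
  -- the total depth does not exceed L.
  record System (M b : ℕ) : Set where
    field
      dep     : Fin n → ℕ
      δ       : Fin n → Lin
      Q       : Pol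
      Q≉0     : Q ≉0
      Q-G     : Q ∈G (q * M)
      closure : ∀ {κ} i c {A} → κ ≤ b → dep i + c ≤ L → A ∈G (κ * M) → ∃ λ (β : Fin n → Pol) →
                (∀ i′ → β i′ ∈G (clo κ * M)) × (∀ i′ → dep i′ ≤ dep i + c ⊎ β i′ ≈ []) ×
                (∀ {f} → f ∈G ((suc D * b) * M) → ⟦ Λ c (A ▷ δ i) ⟧ (Q ⊠ f) ≡ sumf (λ i′ → ⟦ δ i′ ⟧ (β i′ ⊠ f)))
  open System public

  -- V d l says that u l has a p^(L - d)-th root among the u's
  record Monomials (M ω ι : ℕ) {ℓ} (u : Fin ℓ → Pol) : Set₁ where
    field
      V           : ℕ → Fin ℓ → Set
      rootV       : ∀ {d l} c → d + c ≤ L → V d l → ∃ λ l′ → V (d + c) l′ × u l ≈ u l′ ^p (p ^ c)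
      bounded     : ∀ l → u l ∈G (ω * M)
      independent : Independent u (ι * M)
  open Monomials public

  Targets : ℕ → Set
  Targets ℓ = Fin n → Fin ℓ → ℕ → Lin

  -- A condition of depth d stands for the p^d-th root of one with exponent j p^d, whence the bound
  -- on this product. Exponents divisible by p are left out because their conditions are rooted
  -- further.
  Solves : ∀ {M b ℓ} → System M b → (Fin ℓ → Pol) → (ℕ → Fin ℓ → Set) → (s r : ℕ) → Targets ℓ → Pol → Set
  Solves {M} S u V s r τ x = ∀ {d i l j} → 1 ≤ j → j ≤ s → ¬ (p ∣ j) → dep S i ≤ d → j * p ^ d ≤ D → V d l →
    ∀ {a} → a ∈G (r * M) → ⟦ δ S i ⟧ (a ⊠ (u l ⊠ x ^p j)) ≡ ⟦ τ i l j ⟧ a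

  -- The order of the constants matters: the degree ι of independence comes before the size ω,
  -- because the induction step builds new monomials whose size is computed from the ι required of
  -- them. The regularity α may depend on both.
  Attainable : ℕ → Set₁
  Attainable s = ∀ ℓ r → ∃ λ ι → ∀ ω → ∃ λ α → ∀ {M b} → 1 ≤ M → α ≤ b →
    (S : System M b) → Regular (δ S) (α * M) (b * M) →
    {u : Fin ℓ → Pol} (𝓜 : Monomials M ω ι u) (τ : Targets ℓ) →
    ∃ λ x → x ∈G (b * M) × Solves S u (V 𝓜) s r τ x

  attainable0 : Attainable 0
  attainable0 ℓ r = 0 , λ ω → 0 , λ 1≤M α≤b S reg 𝓜 τ → [] , G-[] , λ 1≤j j≤0 → contradiction (≤-trans 1≤j j≤0) λ ()

  -- The conditions are linear in x. A relation between them collects into polynomials `G i`, each a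
  -- combination of the u_l: regularity makes the `G i` vanish, and then independence makes their
  -- coefficients vanish.
  attainable1 : Attainable 1
  attainable1 ℓ r = r , λ ω → r + ω , λ {M} {b} 1≤M α≤b S reg {u} 𝓜 τ → main {M} {b} ω S reg u 𝓜 τ
    where
    main : ∀ {M b} ω (S : System M b) → Regular (δ S) ((r + ω) * M) (b * M) →
      (u : Fin ℓ → Pol) (𝓜 : Monomials M ω r u) (τ : Targets ℓ) → ∃ λ x → x ∈G (b * M) × Solves S u (V 𝓜) 1 r τ x
    main {M} {b} ω S reg u 𝓜 τ = result (relationOrOnto φ (b * M))
      where
      R = r * M
      row : Fin n → Fin ℓ → Fin R → Lin
      row i l s = (tpow (toℕ s) ⊠ u l) ▷ δ S i
      split : Fin (n * (ℓ * R)) → Fin n × Fin ℓ × Fin R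
      split x = let i , y = Fin.remQuot {n} (ℓ * R) x in i , Fin.remQuot {ℓ} R y
      join : Fin n → Fin ℓ → Fin R → Fin (n * (ℓ * R))
      join i l s = Fin.combine {n} {ℓ * R} i (Fin.combine {ℓ} {R} l s)
      split-join : ∀ i l s → split (join i l s) ≡ (i , l , s)
      split-join i l s = trans (cong (λ (i , y) → i , Fin.remQuot {ℓ} R y) (remQuot-combine i (Fin.combine l s)))
                               (cong (i ,_) (remQuot-combine l s))
      rowAt : Fin n × Fin ℓ × Fin R → Lin
      rowAt (i , l , s) = row i l s
      φ : Fin (n * (ℓ * R)) → Lin
      φ x = rowAt (split x)
      result : Relation φ (b * M) ⊎ Onto φ (b * M) → ∃ λ x → x ∈G (b * M) × Solves S u (V 𝓜) 1 r τ x
      result (inj₂ onto) = f , df , solves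
        where
        target : Fin n × Fin ℓ × Fin R → 𝔽
        target (i , l , s) = ⟦ τ i l 1 ⟧ (tpow (toℕ s))
        sol = onto (λ x → target (split x))
        f = proj₁ sol
        df = proj₁ (proj₂ sol)
        entry : ∀ i l s → ⟦ row i l s ⟧ f ≡ ⟦ τ i l 1 ⟧ (tpow (toℕ s))
        entry i l s = subst (λ t → ⟦ rowAt t ⟧ f ≡ target t) (split-join i l s) (proj₂ (proj₂ sol) (join i l s))
        solves : Solves S u (V 𝓜) 1 r τ f
        solves {d} {i} {l} {suc zero} 1≤j j≤1 _ _ _ _ {a} da =
          trans (resp (δ S i) (⊠-comm a _)) (lin-ext ((u l ⊠ f ^p 1) ▷ δ S i) (τ i l 1) onPower da)
          where
          onPower : ∀ k → k < R → ⟦ δ S i ⟧ ((u l ⊠ f ^p 1) ⊠ tpow k) ≡ ⟦ τ i l 1 ⟧ (tpow k)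
          onPower k k<R = subst (λ k → ⟦ δ S i ⟧ ((u l ⊠ f ^p 1) ⊠ tpow k) ≡ ⟦ τ i l 1 ⟧ (tpow k)) (toℕ-fromℕ< k<R)
            (trans (resp (δ S i) (≈-trans (⊠-comm _ _) (≈-trans (≈-sym (⊠-assoc _ (u l) _)) (⊠-congˡ _ (⊠-identityʳ f)))))
                   (entry i l (Fin.fromℕ< k<R)))
        solves {j = suc (suc _)} _ (s≤s ())
      result (inj₁ (c , (x₀ , c≢0) , rel)) = contradiction (uncombine {n} {ℓ * R} {λ x → c x ≡ 0f} (λ i → uncombine {ℓ} {R} {λ y → c (Fin.combine {n} {ℓ * R} i y) ≡ 0f} (c≡0 i)) x₀) c≢0
        where
        g : Fin n → Fin ℓ → Pol
        g i l = polyOf (λ s → c (join i l s))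
        G : Fin n → Pol
        G i = sump (λ l → g i l ⊠ u l)
        expand : ∀ i f → ⟦ δ S i ⟧ (G i ⊠ f) ≡ sumf (λ l → sumf (λ s → c (join i l s) · ⟦ φ (join i l s) ⟧ f))
        expand i f = begin
          ⟦ δ S i ⟧ (G i ⊠ f)
            ≡⟨ resp (δ S i) (⊠-distribʳ-sump {ℓ} f (λ l → g i l ⊠ u l)) ⟩
          ⟦ δ S i ⟧ (sump (λ l → g i l ⊠ u l ⊠ f))
            ≡⟨ lin-sum (δ S i) (λ l → g i l ⊠ u l ⊠ f) ⟩
          sumf (λ l → ⟦ δ S i ⟧ (g i l ⊠ u l ⊠ f))
            ≡⟨ sumf-cong (λ l → trans (resp (δ S i) (⊠-assoc (g i l) (u l) f)) (lin-polyOf (δ S i) (λ s → c (join i l s)) (u l ⊠ f))) ⟩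
          sumf (λ l → sumf (λ s → c (join i l s) · ⟦ δ S i ⟧ (tpow (toℕ s) ⊠ (u l ⊠ f))))
            ≡⟨ sumf-cong (λ l → sumf-cong (λ s → cong (c (join i l s) ·_)
                 (trans (resp (δ S i) (≈-sym (⊠-assoc _ (u l) f))) (sym (cong (λ t → ⟦ rowAt t ⟧ f) (split-join i l s)))))) ⟩
          sumf (λ l → sumf (λ s → c (join i l s) · ⟦ φ (join i l s) ⟧ f)) ∎
          where open ≡-Reasoning
        relation : ∀ {f} → f ∈G (b * M) → sumf (λ i → ⟦ δ S i ⟧ (G i ⊠ f)) ≡ 0f
        relation {f} df = trans (sumf-cong (λ i → trans (expand i f)
            (sym (sumf-combine ℓ (λ y → c (Fin.combine {n} {ℓ * R} i y) · ⟦ φ (Fin.combine {n} {ℓ * R} i y) ⟧ f)))))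
          (trans (sym (sumf-combine n (λ x → c x · ⟦ φ x ⟧ f))) (rel df))
        G≈[] : ∀ i → G i ≈ []
        G≈[] = reg G (λ i → G-sump _ λ l → G-≤ (≤-reflexive (sym (*-distribʳ-+ M r ω))) (G-⊠ (G-polyOf _) (bounded 𝓜 l))) relation
        c≡0 : ∀ i l s → c (join i l s) ≡ 0f
        c≡0 i l s = trans (sym (coef-polyOf (λ s → c (join i l s)) s)) (at (independent 𝓜 (g i) (λ l → G-polyOf _) (G≈[] i) l) (toℕ s))

-- Induction step: the choice of v and the system for x₀

module AttainabilityStep (F : FiniteField) {p : ℕ} (pr : Prime p) (charp : HasCharacteristic F p)
                         (L D : ℕ) (D<p^L : D < p ^ L) (n q : ℕ) (clo : ℕ → ℕ) where
  open Attainability F pr charp L D n q clo public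
  open SemiringSolver (CommutativeRing.commutativeSemiring polyRing) using (solve; _:=_; _:*_)

  P : ℕ
  P = p ^ L

  depth≤L : ∀ {j d} → 1 ≤ j → j * p ^ d ≤ D → d ≤ L
  depth≤L {j} {d} 1≤j jp^d≤D = ≮⇒≥ λ L<d → <⇒≱ D<p^L
    (≤-trans (ℕₚ.^-monoʳ-≤ p {{prime⇒nonZero pr}} (<⇒≤ L<d)) (≤-trans (≤-trans (≤-reflexive (sym (ℕₚ.*-identityˡ (p ^ d)))) (*-monoˡ-≤ (p ^ d) 1≤j)) jp^d≤D))

  ≤*p^ : ∀ j d → j ≤ j * p ^ d
  ≤*p^ j d = ≤-trans (≤-reflexive (sym (ℕₚ.*-identityʳ j))) (*-monoʳ-≤ j (0<p^ d))

  p^-split : ∀ {a b} → b ≤ a → p ^ a ≡ p ^ (a ∸ b) * p ^ b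
  p^-split {a} {b} b≤a = trans (cong (p ^_) (sym (ℕₚ.m∸n+n≡m b≤a))) (ℕₚ.^-distribˡ-+-* p (a ∸ b) b)

  attainable-∣ : ∀ e → p ∣ suc e → Attainable e → Attainable (suc e)
  attainable-∣ e p∣s ih ℓ r = let ι , rest = ih ℓ r in ι , λ ω → let α , main = rest ω in
    α , λ 1≤M α≤b S reg 𝓜 τ → let x , dx , eq = main 1≤M α≤b S reg 𝓜 τ in
    x , dx , λ {d} {i} {l} {j} 1≤j j≤s p∤j → eq 1≤j (ℕₚ.≤-pred (ℕₚ.≤∧≢⇒< j≤s λ { refl → p∤j p∣s })) p∤j

  module Step (e : ℕ) (1≤e : 1 ≤ e) (p∤s : ¬ (p ∣ suc e)) (ih : Attainable e) (ℓ r : ℕ) where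
    s E : ℕ
    s = suc e
    -- The mixed terms contain W^m = w^(P m) with m ≤ D, so powers of w₁ up to P D must be provided.
    E = suc (P * D)

    powers = powerSurjectivity 1≤e (n * ℓ) r

    λₑ κ₁ qs r′ : ℕ
    λₑ = proj₁ powers
    -- `κ₁` bounds a y^m for m ≤ s, and `qs` the powers of Q that are split off. The test
    -- polynomials for x₀ are such a power times either a y^m or a closure coefficient, hence `r′`.
    κ₁ = r + (s * λₑ + 1)
    qs = (P * s) * q + 1
    r′ = κ₁ + (clo κ₁ + qs)

    ι : ℕ
    ι = proj₁ (ih (ℓ * E) r′)

    module Constants (ω : ℕ) where
      ν ω₁ ω′ α′ α₁ α : ℕ
      -- The number `N` of variables in units of M: one more than the number of equations times the
      -- degree of each witness.
      ν = 1 + n * (ℓ * (s * (κ₁ * (size * (P * s)))))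
      ω₁ = (ι + ω) + ν
      ω′ = ω + (E * ω₁ + 1)
      α′ = proj₁ (proj₂ (ih (ℓ * E) r′) ω′)
      α₁ = α′ + (((P * (q + ω₁) + 1) + λₑ) + (qs + (ω′ + 1)))
      α = α₁ + κ₁

      module Solution {M b : ℕ} (1≤M : 1 ≤ M) (α≤b : α ≤ b) (S : System M b) (reg : Regular (δ S) (α * M) (b * M))
                      {u : Fin ℓ → Pol} (𝓜 : Monomials M ω ι u) (τ : Targets ℓ) where
        open Units M 1≤M

        μ : Fin n → Lin
        μ = δ S

        α₁≤b : α₁ ≤ b
        α₁≤b = ≤-trans (m≤m+n α₁ κ₁) α≤b

        α′≤α : α′ ≤ α
        α′≤α = ≤-trans (m≤m+n α′ _) (m≤m+n α₁ κ₁)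

        T R₂ N : ℕ
        -- A product g u_l with g of size ι M and u_l of size ω M has degree below T, as
        -- `towerIndependent` asks.
        T = (ι + ω) * M
        R₂ = κ₁ * M
        N = suc (n * (ℓ * (s * (R₂ * (size * (P * s))))))

        N⊑ν : N ⊑ ν
        N⊑ν = ⊑-+ (⊑-const 1) (⊑-* n (⊑-* ℓ (⊑-* s (mk⊑ (≤-reflexive (begin
          κ₁ * M * c ≡⟨ ℕₚ.*-assoc κ₁ M c ⟩
          κ₁ * (M * c) ≡⟨ cong (κ₁ *_) (ℕₚ.*-comm M c) ⟩
          κ₁ * (c * M) ≡⟨ ℕₚ.*-assoc κ₁ c M ⟨
          κ₁ * c * M ∎))))))
          where
          open ≡-Reasoning
          c = size * (P * s)

        base : Pol
        base = Q S ⊠ tpow T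

        testLin : Fin n → Fin ℓ → ℕ → ℕ → Lin
        testLin i l j t = (tpow t ⊠ (u l ⊠ base ^p (P * j))) ▷ μ i

        cubeEquation : ∀ i l (j : Fin s) (t : Fin R₂) →
          Condition N (size * (P * s)) (λ v → ⟦ testLin i l (suc (toℕ j)) (toℕ t) ⟧ (cubePoly v ^p (P * suc (toℕ j))) ≡ 0f)
        cubeEquation i l j t = equation {f = λ v → ⟦ ψ ⟧ (cubePoly v ^p (P * suc (toℕ j)))}
          (Deg-≤ {f = λ v → ⟦ ψ ⟧ (cubePoly v ^p (P * suc (toℕ j)))} (s≤s (*-monoʳ-≤ P (toℕ<n j))) (Deg-lin-^p (P * suc (toℕ j)) ψ))
          (lin-≈[] ψ (≈-trans (^p-cong (P * suc (toℕ j)) (cubePoly-origin N)) (zero-^p (ℕₚ.*-mono-≤ (0<p^ L) (s≤s z≤n)))))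
          where
          ψ : Lin
          ψ = testLin i l (suc (toℕ j)) (toℕ t)
          zero-^p : ∀ {k} → 1 ≤ k → [] ^p k ≈ []
          zero-^p {suc k} _ = ⊠-zeroˡ _

        opaque
          killer : ∃ λ (v : Cube N) → v ≢ origin × (∀ i l (j : Fin s) (t : Fin R₂) →
            ⟦ testLin i l (suc (toℕ j)) (toℕ t) ⟧ (cubePoly v ^p (P * suc (toℕ j))) ≡ 0f)
          killer = nontrivialSolution (every {m = n} λ i → every {m = ℓ} λ l → every {m = s} λ j → every {m = R₂} λ t → cubeEquation i l j t) (n<1+n _)

        w′ w₁ w W : Pol
        w′ = cubePoly (proj₁ killer)
        w₁ = tpow T ⊠ w′
        w = Q S ⊠ w₁
        -- Every W^m has a p^c-th root among the powers of w for all c ≤ L; without this, the roots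
        -- of mixed terms would not be conditions on monomials again.
        W = w ^p P

        w′≉0 : w′ ≉0
        w′≉0 = cubePoly-≉0 (proj₁ (proj₂ killer))

        w₁-G : w₁ ∈G (ω₁ * M)
        w₁-G = G-≤ (get (⊑-+ (⊑-unit (ι + ω)) N⊑ν)) (G-tpow-⊠ T (G-cubePoly (proj₁ killer)))

        w-^p : ∀ m → w ^p m ≈ Q S ^p m ⊠ w₁ ^p m
        w-^p = ^p-distrib-⊠ (Q S) w₁

        W-^p : ∀ m → W ^p m ≈ w ^p (P * m)
        W-^p = ^p-assocʳ w P

        killed : ∀ i l {j} → 1 ≤ j → j ≤ s → ∀ {A} → A ∈G R₂ → ⟦ μ i ⟧ (A ⊠ (u l ⊠ W ^p j)) ≡ 0f
        killed i l {suc j} _ j<s {A} dA = trans (resp (μ i) (⊠-comm A _)) (lin-zero ((u l ⊠ W ^p suc j) ▷ μ i) onPower dA)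
          where
          ĵ = Fin.fromℕ< j<s
          W-split : W ^p suc j ≈ base ^p (P * suc j) ⊠ w′ ^p (P * suc j)
          W-split = ≈-trans (W-^p (suc j)) (≈-trans (^p-cong (P * suc j) (≈-sym (⊠-assoc (Q S) (tpow T) w′))) (^p-distrib-⊠ base w′ (P * suc j)))
          regroup : ∀ u b c t → (u ⊠ (b ⊠ c)) ⊠ t ≈ (t ⊠ (u ⊠ b)) ⊠ c
          regroup = solve 4 (λ u b c t → (u :* (b :* c)) :* t := (t :* (u :* b)) :* c) ≈-refl
          onPower : ∀ k → k < R₂ → ⟦ μ i ⟧ ((u l ⊠ W ^p suc j) ⊠ tpow k) ≡ 0f
          onPower k k<R₂ = trans (resp (μ i) (≈-trans (⊠-cong (⊠-congˡ (u l) W-split) ≈-refl) (regroup (u l) _ _ (tpow k))))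
            (subst₂ (λ j k → ⟦ testLin i l (suc j) k ⟧ (w′ ^p (P * suc j)) ≡ 0f) (toℕ-fromℕ< j<s) (toℕ-fromℕ< k<R₂)
              (proj₂ (proj₂ killer) i l ĵ (Fin.fromℕ< k<R₂)))

        -- Powers of w₁ instead of w: the matching powers of Q are put into the test polynomials,
        -- except for the one factor Q that the closure property consumes.
        uAt : Fin ℓ × Fin E → Pol
        uAt (l , m) = u l ⊠ w₁ ^p toℕ m

        u′ : Fin (ℓ * E) → Pol
        u′ x = uAt (Fin.remQuot E x)

        u′-combine : ∀ l m → u′ (Fin.combine l m) ≡ uAt (l , m)
        u′-combine l m = cong uAt (remQuot-combine l m)

        V′ : ℕ → Fin (ℓ * E) → Set
        V′ d x = ∃ λ l → ∃ λ m → x ≡ Fin.combine l m × V 𝓜 d l × p ^ (L ∸ d) ∣ toℕ m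

        ≡⇒≈ : ∀ {f g : Pol} → f ≡ g → f ≈ g
        ≡⇒≈ refl = ≈-refl

        rootV′ : ∀ {d x} c → d + c ≤ L → V′ d x → ∃ λ x′ → V′ (d + c) x′ × u′ x ≈ u′ x′ ^p (p ^ c)
        rootV′ {d} {x} c d+c≤L (l , m , x≡ , Vl , divides k m≡) = Fin.combine l′ m̂ , (l′ , m̂ , refl , proj₁ (proj₂ root-l) , divides k toℕ-m̂) ,
              ≈-trans (≡⇒≈ (trans (cong u′ x≡) (u′-combine l m))) (≈-trans root≈ (^p-cong (p ^ c) (≈-sym (≡⇒≈ (u′-combine l′ m̂)))))
          where
          root-l : ∃ λ l′ → V 𝓜 (d + c) l′ × u l ≈ u l′ ^p (p ^ c)
          root-l = rootV 𝓜 c d+c≤L Vl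
          l′ : Fin ℓ
          l′ = proj₁ root-l
          m′ : ℕ
          m′ = k * p ^ (L ∸ (d + c))
          m≡m′p^c : toℕ m ≡ m′ * p ^ c
          m≡m′p^c = begin
            toℕ m ≡⟨ m≡ ⟩
            k * p ^ (L ∸ d) ≡⟨ cong (k *_) (p^-split (ℕₚ.m+n≤o⇒m≤o∸n c (subst (_≤ L) (ℕₚ.+-comm d c) d+c≤L))) ⟩
            k * (p ^ (L ∸ d ∸ c) * p ^ c) ≡⟨ cong (λ z → k * (p ^ z * p ^ c)) (ℕₚ.∸-+-assoc L d c) ⟩
            k * (p ^ (L ∸ (d + c)) * p ^ c) ≡⟨ ℕₚ.*-assoc k _ _ ⟨
            m′ * p ^ c ∎
            where open ≡-Reasoning
          m′<E : m′ < E
          m′<E = ℕₚ.≤-<-trans (≤-trans (≤*p^ m′ c) (≤-reflexive (sym m≡m′p^c))) (toℕ<n m)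
          m̂ : Fin E
          m̂ = Fin.fromℕ< m′<E
          toℕ-m̂ : toℕ m̂ ≡ m′
          toℕ-m̂ = toℕ-fromℕ< m′<E
          root≈ : u l ⊠ w₁ ^p toℕ m ≈ (u l′ ⊠ w₁ ^p toℕ m̂) ^p (p ^ c)
          root≈ = ≈-trans (⊠-cong (proj₂ (proj₂ root-l)) (≈-trans (^p-congʳ w₁ (trans m≡m′p^c (cong (_* p ^ c) (sym toℕ-m̂)))) (≈-sym (^p-assocʳ w₁ (toℕ m̂) (p ^ c)))))
                          (≈-sym (^p-distrib-⊠ (u l′) _ (p ^ c)))

        uAt-G : ∀ l {m} → m ≤ P * D → u l ⊠ w₁ ^p m ∈G (ω′ * M)
        uAt-G l {m} m≤ = G-≤ (get (⊑-mono (⊑-+ (⊑-unit ω) (⊑-+ (⊑-* m (⊑-unit ω₁)) (⊑-const 1)))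
            (+-monoʳ-≤ ω (+-monoˡ-≤ 1 (*-monoˡ-≤ ω₁ (ℕₚ.m≤n⇒m≤1+n m≤))))))
          (G-⊠ (bounded 𝓜 l) (G-^p m w₁-G))

        independent′ : Independent u′ (ι * M)
        independent′ = towerIndependent {ℓ} {E} (≈-refl {w₁}) w′≉0
          (λ l dg → G-≤ (≤-reflexive (sym (*-distribʳ-+ M ι ω))) (G-⊠ dg (bounded 𝓜 l)))
          (independent 𝓜) u′ (λ l m → ≡⇒≈ (u′-combine l m))

        𝓜′ : Monomials M ω′ ι u′
        𝓜′ = record
          { V = V′ ; rootV = rootV′ ; independent = independent′
          ; bounded = λ x → uAt-G (proj₁ (Fin.remQuot {ℓ} E x)) (ℕₚ.≤-pred (toℕ<n (proj₂ (Fin.remQuot {ℓ} E x)))) }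

        power = proj₂ powers M 1≤M (^p-≉0 (P * e) (Q≉0 S))

        γ : Fin n → Fin ℓ → Lin
        γ i l = proj₁ power (Fin.combine i l)

        -- The monomials with m = 0 keep their targets; the linear condition on x₀ attached to
        -- w^(P e) is reserved for reaching the targets of exponent s.
        pick : ∀ {X Y Z : Set} → Dec X → Dec Y → Dec Z → Lin → Lin → Lin
        pick (yes _) _       _       old new = old
        pick (no _)  (yes _) (yes _) old new = new
        pick (no _)  (yes _) (no _)  old new = zeroLin
        pick (no _)  (no _)  _       old new = zeroLin

        τAt : Fin n → Fin ℓ → ℕ → ℕ → Lin
        τAt i l m j = pick (m ℕₚ.≟ 0) (m ℕₚ.≟ P * e) (j ℕₚ.≟ 1) (τ i l j) (γ i l)

        τAt-zero : ∀ {i l m j} → m ≢ 0 → ¬ (m ≡ P * e × j ≡ 1) → ∀ a → ⟦ τAt i l m j ⟧ a ≡ 0f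
        τAt-zero {m = m} {j} m≢0 ¬special a with m ℕₚ.≟ 0 | m ℕₚ.≟ P * e | j ℕₚ.≟ 1
        ... | yes m≡0 | _ | _ = contradiction m≡0 m≢0
        ... | no _ | yes eq | yes eq′ = contradiction (eq , eq′) ¬special
        ... | no _ | yes _ | no _ = refl
        ... | no _ | no _ | _ = refl

        τAt-special : ∀ {i l m j} → m ≢ 0 → m ≡ P * e → j ≡ 1 → ∀ a → ⟦ τAt i l m j ⟧ a ≡ ⟦ γ i l ⟧ a
        τAt-special {m = m} {j} m≢0 eq eq′ a with m ℕₚ.≟ 0 | m ℕₚ.≟ P * e | j ℕₚ.≟ 1
        ... | yes m≡0 | _ | _ = contradiction m≡0 m≢0
        ... | no _ | yes _ | yes _ = refl
        ... | no _ | yes _ | no ¬eq′ = contradiction eq′ ¬eq′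
        ... | no _ | no ¬eq | _ = contradiction eq ¬eq

        τPair : Fin n → Fin ℓ × Fin E → ℕ → Lin
        τPair i (l , m) j = τAt i l (toℕ m) j

        reduced = proj₂ (proj₂ (ih (ℓ * E) r′) ω′) 1≤M (≤-trans α′≤α α≤b) S
          (λ g dg → reg g (λ i → G-≤ (*-monoˡ-≤ M α′≤α) (dg i))) 𝓜′ (λ i x → τPair i (Fin.remQuot E x))

        x₀ : Pol
        x₀ = proj₁ reduced

        x₀-G : x₀ ∈G (b * M)
        x₀-G = proj₁ (proj₂ reduced)

        x₀-solves : ∀ {d i l m j} → m ≤ P * D → 1 ≤ j → j ≤ e → ¬ (p ∣ j) → dep S i ≤ d → j * p ^ d ≤ D → V 𝓜 d l →
          p ^ (L ∸ d) ∣ m → ∀ {a} → a ∈G (r′ * M) → ⟦ μ i ⟧ (a ⊠ ((u l ⊠ w₁ ^p m) ⊠ x₀ ^p j)) ≡ ⟦ τAt i l m j ⟧ a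
        x₀-solves {d} {i} {l} {m} {j} m≤ 1≤j j≤e p∤j dep≤ jp≤ Vl p∣m {a} da =
          subst (λ m → ⟦ μ i ⟧ (a ⊠ ((u l ⊠ w₁ ^p m) ⊠ x₀ ^p j)) ≡ ⟦ τAt i l m j ⟧ a) toℕ-m̂
            (subst (λ y → ⟦ μ i ⟧ (a ⊠ (uAt y ⊠ x₀ ^p j)) ≡ ⟦ τPair i y j ⟧ a) (remQuot-combine l m̂)
              (proj₂ (proj₂ reduced) 1≤j j≤e p∤j dep≤ jp≤ (l , m̂ , refl , Vl , subst (p ^ (L ∸ d) ∣_) (sym toℕ-m̂) p∣m) da))
          where
          m̂ : Fin E
          m̂ = Fin.fromℕ< (s≤s m≤)
          toℕ-m̂ : toℕ m̂ ≡ m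
          toℕ-m̂ = toℕ-fromℕ< (s≤s m≤)

-- Induction step: the mixed terms and the correction y

module AttainabilityInduction (F : FiniteField) {p : ℕ} (pr : Prime p) (charp : HasCharacteristic F p)
                              (L D : ℕ) (D<p^L : D < p ^ L) (n q : ℕ) (clo : ℕ → ℕ) where
  open AttainabilityStep F pr charp L D D<p^L n q clo public
  open Binomial (CommutativeRing.commutativeSemiring polyRing) using (theorem)
  open SemiringSolver (CommutativeRing.commutativeSemiring polyRing) using (solve; _:=_; _:*_)

  module Correction (e : ℕ) (1≤e : 1 ≤ e) (p∤s : ¬ (p ∣ suc e)) (ih : Attainable e) (ℓ r : ℕ) (ω : ℕ)
                    {M b : ℕ} (1≤M : 1 ≤ M) (α≤b : Step.Constants.α e 1≤e p∤s ih ℓ r ω ≤ b) (S : System M b)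
                    (reg : Regular (δ S) (Step.Constants.α e 1≤e p∤s ih ℓ r ω * M) (b * M))
                    {u : Fin ℓ → Pol} (𝓜 : Monomials M ω (Step.ι e 1≤e p∤s ih ℓ r) u) (τ : Targets ℓ) where
    open Step e 1≤e p∤s ih ℓ r
    open Constants ω
    open Solution 1≤M α≤b S reg 𝓜 τ
    open Units M 1≤M

    s≢0 : s ×f 1f ≢ 0f
    s≢0 = p∤⇒×≢0 s p∤s

    -- The error of x₀ at exponent s, divided by s because the term (W y)^e x₀ enters with the
    -- binomial coefficient s.
    σAt : Fin n × Fin ℓ → Lin
    σAt (i , l) = scaleLin (inv (s ×f 1f) s≢0) (addLin (τ i l s) (scaleLin (neg 1f) ((u l ⊠ x₀ ^p s) ▷ μ i)))

    correction : ∃ λ y → y ∈G (λₑ * M) × (∀ x {a} → a ∈G (r * M) →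
      ⟦ proj₁ power x ⟧ (Q S ^p (P * e) ⊠ (a ⊠ y ^p e)) ≡ ⟦ σAt (Fin.remQuot ℓ x) ⟧ a)
    correction = proj₂ power (λ x → σAt (Fin.remQuot ℓ x))

    y x : Pol
    y = proj₁ correction
    x = W ⊠ y ⊞ x₀

    y-G : y ∈G (λₑ * M)
    y-G = proj₁ (proj₂ correction)

    y-solves : ∀ i l {a} → a ∈G (r * M) → ⟦ γ i l ⟧ (Q S ^p (P * e) ⊠ (a ⊠ y ^p e)) ≡ ⟦ σAt (i , l) ⟧ a
    y-solves i l {a} da = trans (proj₂ (proj₂ correction) (Fin.combine i l) da) (cong (λ z → ⟦ σAt z ⟧ a) (remQuot-combine i l))

    x-G : x ∈G (b * M)
    x-G = G-⊞ (G-≤ (get (⊑-mono (⊑-+ W⊑ (⊑-unit λₑ)) (≤-trans (≤-trans (m≤m+n _ _) (m≤n+m _ α′)) α₁≤b))) (G-⊠ (G-^p P w-G) y-G)) x₀-G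
      where
      w-G : w ∈G (q * M + ω₁ * M)
      w-G = G-⊠ (Q-G S) w₁-G
      W⊑ : P * (q * M + ω₁ * M) + 1 ⊑ P * (q + ω₁) + 1
      W⊑ = ⊑-+ (⊑-* P (⊑-+ (⊑-unit q) (⊑-unit ω₁))) (⊑-const 1)

    ay-G : ∀ {a m} → m ≤ s → a ∈G (r * M) → a ⊠ y ^p m ∈G (κ₁ * M)
    ay-G {m = m} m≤s da = G-≤ (get (⊑-mono (⊑-+ (⊑-unit r) (⊑-+ (⊑-* m (⊑-unit λₑ)) (⊑-const 1)))
      (+-monoʳ-≤ r (+-monoˡ-≤ 1 (*-monoˡ-≤ λₑ m≤s))))) (G-⊠ da (G-^p m y-G))

    Q^-G : ∀ {m} → m ≤ P * s → Q S ^p m ∈G (qs * M)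
    Q^-G {m} m≤ = G-≤ (get (⊑-mono (⊑-+ (⊑-* m (⊑-unit q)) (⊑-const 1)) (+-monoˡ-≤ 1 (*-monoˡ-≤ q m≤)))) (G-^p m (Q-G S))

    term : Fin n → Fin ℓ → Pol → ℕ → ℕ → 𝔽
    term i l a j m = ⟦ μ i ⟧ (a ⊠ (u l ⊠ ((W ⊠ y) ^p m ⊠ x₀ ^p (j ∸ m))))

    expand : ∀ i l a j → ⟦ μ i ⟧ (a ⊠ (u l ⊠ x ^p j)) ≡ sumf {suc j} (λ k → (j C toℕ k) ×f 1f · term i l a j (toℕ k))
    expand i l a j = begin
      ⟦ μ i ⟧ (a ⊠ (u l ⊠ x ^p j))
        ≡⟨ resp (μ i) (≈-trans (≈-sym (⊠-assoc a (u l) _)) (⊠-congˡ (a ⊠ u l) (theorem j (W ⊠ y) x₀))) ⟩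
      ⟦ μ i ⟧ ((a ⊠ u l) ⊠ sump {suc j} terms)
        ≡⟨ resp (μ i) (⊠-distribˡ-sump {suc j} (a ⊠ u l) terms) ⟩
      ⟦ μ i ⟧ (sump {suc j} (λ k → (a ⊠ u l) ⊠ terms k))
        ≡⟨ lin-sum (μ i) {suc j} (λ k → (a ⊠ u l) ⊠ terms k) ⟩
      sumf {suc j} (λ k → ⟦ μ i ⟧ ((a ⊠ u l) ⊠ terms k))
        ≡⟨ sumf-cong {suc j} (λ k → trans (resp (μ i) (≈-trans (×p-comm-⊠ (j C toℕ k) (a ⊠ u l) (body k)) (×p-congʳ (j C toℕ k) (⊠-assoc a (u l) (body k)))))
             (lin-×p (μ i) (j C toℕ k) (a ⊠ (u l ⊠ body k)))) ⟩
      sumf {suc j} (λ k → (j C toℕ k) ×f 1f · term i l a j (toℕ k)) ∎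
      where
      open ≡-Reasoning
      body terms : Fin (suc j) → Pol
      body k = (W ⊠ y) ^p toℕ k ⊠ x₀ ^p (j ∸ toℕ k)
      terms k = (j C toℕ k) ×p body k

    term-0 : ∀ i l a j → term i l a j 0 ≡ ⟦ μ i ⟧ (a ⊠ (u l ⊠ x₀ ^p j))
    term-0 i l a j = resp (μ i) (⊠-congˡ a (⊠-congˡ (u l) (⊠-identityˡ _)))

    module At {d i l j} (1≤j : 1 ≤ j) (j≤s : j ≤ s) (p∤j : ¬ (p ∣ j)) (dep≤ : dep S i ≤ d) (jp^d≤D : j * p ^ d ≤ D) (Vl : V 𝓜 d l)
              {a : Pol} (da : a ∈G (r * M)) where

      j≤D : j ≤ D
      j≤D = ≤-trans (≤*p^ j d) jp^d≤D

      d≤L : d ≤ L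
      d≤L = depth≤L 1≤j jp^d≤D

      term-top : term i l a j j ≡ 0f
      term-top = trans (resp (μ i) regrouped) (killed i l 1≤j j≤s (ay-G j≤s da))
        where
        rearrange : ∀ a u X Y → a ⊠ (u ⊠ (X ⊠ Y)) ≈ (a ⊠ Y) ⊠ (u ⊠ X)
        rearrange = solve 4 (λ a u X Y → a :* (u :* (X :* Y)) := (a :* Y) :* (u :* X)) ≈-refl
        regrouped : a ⊠ (u l ⊠ ((W ⊠ y) ^p j ⊠ x₀ ^p (j ∸ j))) ≈ (a ⊠ y ^p j) ⊠ (u l ⊠ W ^p j)
        regrouped = ≈-trans (⊠-congˡ a (⊠-congˡ (u l) (≈-trans (⊠-cong (^p-distrib-⊠ W y j) (^p-congʳ x₀ (ℕₚ.n∸n≡0 j))) (⊠-identityʳ _))))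
                            (rearrange a (u l) (W ^p j) (y ^p j))

      module Cross {m} (1≤m : 1 ≤ m) (m<j : m < j) where
        k : ℕ
        k = j ∸ m

        m≤s : m ≤ s
        m≤s = ≤-trans (<⇒≤ m<j) j≤s

        1≤k : 1 ≤ k
        1≤k = ℕₚ.m<n⇒0<n∸m m<j

        k<j : k < j
        k<j = ℕₚ.∸-monoʳ-< 1≤m (<⇒≤ m<j)

        k≤e : k ≤ e
        k≤e = ℕₚ.≤-pred (≤-trans k<j j≤s)

        m+k≡j : m + k ≡ j
        m+k≡j = ℕₚ.m+[n∸m]≡n (<⇒≤ m<j)

        kp^d≤D : k * p ^ d ≤ D
        kp^d≤D = ≤-trans (*-monoˡ-≤ (p ^ d) (<⇒≤ k<j)) jp^d≤D

        Pm≤PD : P * m ≤ P * D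
        Pm≤PD = *-monoʳ-≤ P (≤-trans (<⇒≤ m<j) j≤D)

        Pm≢0 : P * m ≢ 0
        Pm≢0 = ℕₚ.m<n⇒n≢0 (ℕₚ.*-mono-≤ (0<p^ L) 1≤m)

        -- The term is itself one of the conditions imposed on x₀, for the monomial u_l w₁^(P m),
        -- once the powers of y and Q are moved into the test polynomial.
        shallow : ¬ (p ∣ k) → term i l a j m ≡ ⟦ τAt i l (P * m) k ⟧ ((a ⊠ y ^p m) ⊠ Q S ^p (P * m))
        shallow p∤k = trans (resp (μ i) regrouped)
          (x₀-solves Pm≤PD 1≤k k≤e p∤k dep≤ kp^d≤D Vl p^∣Pm
            (G-≤ (get (⊑-mono (⊑-+ (⊑-unit κ₁) (⊑-unit qs)) (+-monoʳ-≤ κ₁ (m≤n+m qs (clo κ₁)))))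
                 (G-⊠ (ay-G m≤s da) (Q^-G (*-monoʳ-≤ P m≤s)))))
          where
          p^∣Pm : p ^ (L ∸ d) ∣ P * m
          p^∣Pm = divides (m * p ^ d) (trans (cong (_* m) (p^-split d≤L)) (trans (ℕₚ.*-assoc (p ^ (L ∸ d)) (p ^ d) m)
            (trans (ℕₚ.*-comm (p ^ (L ∸ d)) _) (cong (_* p ^ (L ∸ d)) (ℕₚ.*-comm (p ^ d) m)))))
          rearrange : ∀ a u q w y X → a ⊠ (u ⊠ (((q ⊠ w) ⊠ y) ⊠ X)) ≈ ((a ⊠ y) ⊠ q) ⊠ ((u ⊠ w) ⊠ X)
          rearrange = solve 6 (λ a u q w y X → a :* (u :* (((q :* w) :* y) :* X)) := ((a :* y) :* q) :* ((u :* w) :* X)) ≈-refl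
          regrouped : a ⊠ (u l ⊠ ((W ⊠ y) ^p m ⊠ x₀ ^p k)) ≈ ((a ⊠ y ^p m) ⊠ Q S ^p (P * m)) ⊠ ((u l ⊠ w₁ ^p (P * m)) ⊠ x₀ ^p k)
          regrouped = ≈-trans (⊠-congˡ a (⊠-congˡ (u l) (⊠-cong
              (≈-trans (^p-distrib-⊠ W y m) (⊠-cong (≈-trans (W-^p m) (w-^p (P * m))) (≈-refl {y ^p m}))) (≈-refl {x₀ ^p k}))))
            (rearrange a (u l) (Q S ^p (P * m)) (w₁ ^p (P * m)) (y ^p m) (x₀ ^p k))

        -- The exponent k = j″ p^c of x₀ is divisible by p, so the condition is the p^c-th power of a
        -- condition on x₀^j″ with the functional Λ c, to which the closure property applies.
        module Deep {c j″} (1≤c : 1 ≤ c) (1≤j″ : 1 ≤ j″) (p∤j″ : ¬ (p ∣ j″)) (k≡ : k ≡ j″ * p ^ c) where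
          j″p^≤D : j″ * p ^ (d + c) ≤ D
          j″p^≤D = ≤-trans (≤-reflexive (begin
            j″ * p ^ (d + c) ≡⟨ cong (j″ *_) (trans (ℕₚ.^-distribˡ-+-* p d c) (ℕₚ.*-comm (p ^ d) (p ^ c))) ⟩
            j″ * (p ^ c * p ^ d) ≡⟨ ℕₚ.*-assoc j″ _ _ ⟨
            j″ * p ^ c * p ^ d ≡⟨ cong (_* p ^ d) k≡ ⟨
            k * p ^ d ∎)) kp^d≤D
            where open ≡-Reasoning

          j″≤k : j″ ≤ k
          j″≤k = ≤-trans (≤*p^ j″ c) (≤-reflexive (sym k≡))

          d+c≤L : d + c ≤ L
          d+c≤L = depth≤L 1≤j″ j″p^≤D

          c≤L : c ≤ L
          c≤L = ≤-trans (m≤n+m c d) d+c≤L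

          t : ℕ
          -- The exponent for which w^t is a p^c-th root of W^m.
          t = m * p ^ (L ∸ c)

          tp^c≡Pm : t * p ^ c ≡ P * m
          tp^c≡Pm = trans (ℕₚ.*-assoc m _ _) (trans (cong (m *_) (sym (p^-split c≤L))) (ℕₚ.*-comm m P))

          1≤t : 1 ≤ t
          1≤t = ℕₚ.*-mono-≤ 1≤m (0<p^ (L ∸ c))

          t≤Pm : t ≤ P * m
          t≤Pm = ≤-trans (≤*p^ t c) (≤-reflexive tp^c≡Pm)

          t₀ : ℕ
          t₀ = ℕ.pred t

          t≡ : t ≡ suc t₀
          t≡ = sym (ℕₚ.suc-pred t {{ℕ.>-nonZero 1≤t}})

          root-l : ∃ λ l′ → V 𝓜 (d + c) l′ × u l ≈ u l′ ^p (p ^ c)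
          root-l = rootV 𝓜 c d+c≤L Vl

          l′ : Fin ℓ
          l′ = proj₁ root-l

          z z′ A : Pol
          z = u l′ ⊠ (w ^p t ⊠ x₀ ^p j″)
          -- One of the t factors Q is kept outside for the closure property.
          z′ = Q S ^p t₀ ⊠ ((u l′ ⊠ w₁ ^p t) ⊠ x₀ ^p j″)
          A = a ⊠ y ^p m

          term-root : term i l a j m ≡ ⟦ Λ c (A ▷ μ i) ⟧ z ^f (p ^ c)
          term-root = trans (resp (μ i) regrouped) (sym (Λ-^ c (A ▷ μ i) z))
            where
            rearrange : ∀ a u W y X → a ⊠ (u ⊠ ((W ⊠ y) ⊠ X)) ≈ (a ⊠ y) ⊠ (u ⊠ (W ⊠ X))
            rearrange = solve 5 (λ a u W y X → a :* (u :* ((W :* y) :* X)) := (a :* y) :* (u :* (W :* X))) ≈-refl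
            powers-≈ : u l ⊠ (W ^p m ⊠ x₀ ^p k) ≈ z ^p (p ^ c)
            powers-≈ = ≈-trans (⊠-cong (proj₂ (proj₂ root-l))
                (≈-trans (⊠-cong (≈-trans (W-^p m) (≈-trans (^p-congʳ w (sym tp^c≡Pm)) (≈-sym (^p-assocʳ w t (p ^ c)))))
                                 (≈-trans (^p-congʳ x₀ k≡) (≈-sym (^p-assocʳ x₀ j″ (p ^ c)))))
                         (≈-sym (^p-distrib-⊠ (w ^p t) (x₀ ^p j″) (p ^ c)))))
              (≈-sym (^p-distrib-⊠ (u l′) (w ^p t ⊠ x₀ ^p j″) (p ^ c)))
            regrouped : a ⊠ (u l ⊠ ((W ⊠ y) ^p m ⊠ x₀ ^p k)) ≈ A ⊠ z ^p (p ^ c)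
            regrouped = ≈-trans (⊠-congˡ a (⊠-congˡ (u l) (⊠-cong (^p-distrib-⊠ W y m) (≈-refl {x₀ ^p k}))))
              (≈-trans (rearrange a (u l) (W ^p m) (y ^p m) (x₀ ^p k)) (⊠-congˡ A powers-≈))

          z≈ : z ≈ Q S ⊠ z′
          z≈ = ≈-trans (⊠-congˡ (u l′) (⊠-cong (≈-trans (w-^p t) (⊠-cong (^p-congʳ (Q S) t≡) (≈-refl {w₁ ^p t}))) (≈-refl {x₀ ^p j″})))
                       (rearrange (u l′) (Q S) (Q S ^p t₀) (w₁ ^p t) (x₀ ^p j″))
            where
            rearrange : ∀ u q q₀ w X → u ⊠ (((q ⊠ q₀) ⊠ w) ⊠ X) ≈ q ⊠ (q₀ ⊠ ((u ⊠ w) ⊠ X))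
            rearrange = solve 5 (λ u q q₀ w X → u :* (((q :* q₀) :* w) :* X) := q :* (q₀ :* ((u :* w) :* X))) ≈-refl

          t₀≤ : t₀ ≤ P * s
          t₀≤ = ≤-trans (ℕₚ.pred[n]≤n {t}) (≤-trans t≤Pm (*-monoʳ-≤ P m≤s))

          z′-G : z′ ∈G ((suc D * b) * M)
          z′-G = G-≤ (get (⊑-mono (⊑-+ (⊑-unit qs) (⊑-+ (⊑-unit ω′) (⊑-+ (⊑-* j″ (⊑-unit b)) (⊑-const 1)))) bound))
                     (G-⊠ (Q^-G t₀≤) (G-⊠ (uAt-G l′ (≤-trans t≤Pm Pm≤PD)) (G-^p j″ x₀-G)))
            where
            j″≤D : j″ ≤ D
            j″≤D = ≤-trans j″≤k (≤-trans (<⇒≤ k<j) j≤D)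
            bound : qs + (ω′ + (j″ * b + 1)) ≤ suc D * b
            bound = ≤-trans (≤-reflexive (begin
              qs + (ω′ + (j″ * b + 1)) ≡⟨ cong (λ v → qs + (ω′ + v)) (ℕₚ.+-comm (j″ * b) 1) ⟩
              qs + (ω′ + (1 + j″ * b)) ≡⟨ cong (qs +_) (ℕₚ.+-assoc ω′ 1 (j″ * b)) ⟨
              qs + ((ω′ + 1) + j″ * b) ≡⟨ ℕₚ.+-assoc qs (ω′ + 1) (j″ * b) ⟨
              (qs + (ω′ + 1)) + j″ * b ∎))
              (ℕₚ.+-mono-≤ (≤-trans (≤-trans (m≤n+m _ ((P * (q + ω₁) + 1) + λₑ)) (m≤n+m _ α′)) α₁≤b) (*-monoˡ-≤ b j″≤D))
              where open ≡-Reasoning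

          -- Otherwise m = e p^c and k = p^c, so that j = s p^c would exceed s. Rooted terms
          -- therefore never meet the place where x₀ has the target γ.
          notSpecial : ¬ (t ≡ P * e × j″ ≡ 1)
          notSpecial (t≡Pe , refl) = <⇒≱ s<j j≤s
            where
            open ≡-Reasoning
            m≡ : m ≡ e * p ^ c
            m≡ = ℕₚ.*-cancelʳ-≡ m (e * p ^ c) (p ^ (L ∸ c)) {{ℕ.>-nonZero (0<p^ (L ∸ c))}} (begin
              m * p ^ (L ∸ c) ≡⟨ t≡Pe ⟩
              P * e ≡⟨ ℕₚ.*-comm P e ⟩
              e * P ≡⟨ cong (e *_) (trans (p^-split c≤L) (ℕₚ.*-comm (p ^ (L ∸ c)) (p ^ c))) ⟩
              e * (p ^ c * p ^ (L ∸ c)) ≡⟨ ℕₚ.*-assoc e _ _ ⟨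
              e * p ^ c * p ^ (L ∸ c) ∎)
            j≡ : j ≡ s * p ^ c
            j≡ = begin
              j ≡⟨ m+k≡j ⟨
              m + k ≡⟨ cong₂ _+_ m≡ (trans k≡ (ℕₚ.+-identityʳ (p ^ c))) ⟩
              e * p ^ c + p ^ c ≡⟨ ℕₚ.+-comm (e * p ^ c) (p ^ c) ⟩
              s * p ^ c ∎
            1<p^c : 1 < p ^ c
            1<p^c = <-≤-trans (ℕ.nonTrivial⇒n>1 p {{prime⇒nonTrivial pr}})
              (≤-trans (≤-reflexive (sym (ℕₚ.^-identityʳ p))) (ℕₚ.^-monoʳ-≤ p {{prime⇒nonZero pr}} 1≤c))
            s<j : s < j
            s<j = subst (s <_) (sym j≡) (ℕₚ.m<m*n s (p ^ c) 1<p^c)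

          p^∣t : p ^ (L ∸ (d + c)) ∣ t
          p^∣t = divides (m * p ^ d) (begin
            m * p ^ (L ∸ c) ≡⟨ cong (m *_) (p^-split (ℕₚ.m+n≤o⇒m≤o∸n d d+c≤L)) ⟩
            m * (p ^ (L ∸ c ∸ d) * p ^ d) ≡⟨ cong (m *_) (ℕₚ.*-comm _ (p ^ d)) ⟩
            m * (p ^ d * p ^ (L ∸ c ∸ d)) ≡⟨ ℕₚ.*-assoc m _ _ ⟨
            m * p ^ d * p ^ (L ∸ c ∸ d) ≡⟨ cong (λ v → m * p ^ d * p ^ v) (trans (ℕₚ.∸-+-assoc L c d) (cong (L ∸_) (ℕₚ.+-comm c d))) ⟩
            m * p ^ d * p ^ (L ∸ (d + c)) ∎)
            where open ≡-Reasoning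

          closed : ∃ λ (β : Fin n → Pol) → (∀ i′ → β i′ ∈G (clo κ₁ * M)) × (∀ i′ → dep S i′ ≤ dep S i + c ⊎ β i′ ≈ []) ×
            (∀ {f} → f ∈G ((suc D * b) * M) → ⟦ Λ c (A ▷ μ i) ⟧ (Q S ⊠ f) ≡ sumf (λ i′ → ⟦ μ i′ ⟧ (β i′ ⊠ f)))
          closed = closure S {κ₁} i c (≤-trans (m≤n+m κ₁ α₁) α≤b) (≤-trans (+-monoˡ-≤ c dep≤) d+c≤L) (ay-G m≤s da)

          summand : ∀ i′ → dep S i′ ≤ dep S i + c ⊎ proj₁ closed i′ ≈ [] → ⟦ μ i′ ⟧ (proj₁ closed i′ ⊠ z′) ≡ 0f
          summand i′ (inj₂ β≈[]) = lin-≈[] (μ i′) (≈-trans (⊠-cong β≈[] (≈-refl {z′})) (⊠-zeroˡ z′))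
          summand i′ (inj₁ dep′≤) = trans (resp (μ i′) (≈-sym (⊠-assoc (proj₁ closed i′) (Q S ^p t₀) ((u l′ ⊠ w₁ ^p t) ⊠ x₀ ^p j″))))
            (trans (x₀-solves (≤-trans t≤Pm Pm≤PD) 1≤j″ (≤-trans j″≤k k≤e) p∤j″
                      (≤-trans dep′≤ (+-monoˡ-≤ c dep≤)) j″p^≤D (proj₁ (proj₂ root-l)) p^∣t
                      (G-≤ (get (⊑-mono (⊑-+ (⊑-unit (clo κ₁)) (⊑-unit qs)) (m≤n+m _ κ₁))) (G-⊠ (proj₁ (proj₂ closed) i′) (Q^-G t₀≤))))
                   (τAt-zero (ℕₚ.m<n⇒n≢0 1≤t) notSpecial _))

          deep : term i l a j m ≡ 0f
          deep = trans term-root (trans (cong (_^f (p ^ c)) (trans (resp (Λ c (A ▷ μ i)) z≈)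
            (trans (proj₂ (proj₂ (proj₂ closed)) z′-G) (sumf-zero (λ i′ → summand i′ (proj₁ (proj₂ (proj₂ closed)) i′)))))) (0^f (p ^ c) (0<p^ c)))

        cross : ¬ (j ≡ s × m ≡ e) → term i l a j m ≡ 0f
        cross ¬top = byDepth (primePart pr k 1≤k)
          where
          notSpecial : ¬ (P * m ≡ P * e × k ≡ 1)
          notSpecial (Pm≡Pe , k≡1) = ¬top (j≡s , m≡e)
            where
            m≡e : m ≡ e
            m≡e = ℕₚ.*-cancelˡ-≡ m e P {{ℕ.>-nonZero (0<p^ L)}} Pm≡Pe
            j≡s : j ≡ s
            j≡s = trans (sym m+k≡j) (trans (cong₂ _+_ m≡e k≡1) (ℕₚ.+-comm e 1))
          byDepth : (∃ λ c → ∃ λ j″ → 1 ≤ j″ × ¬ (p ∣ j″) × k ≡ j″ * p ^ c) → term i l a j m ≡ 0f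
          byDepth (suc c , j″ , 1≤j″ , p∤j″ , k≡) = Deep.deep {suc c} {j″} (s≤s z≤n) 1≤j″ p∤j″ k≡
          byDepth (zero , j″ , 1≤j″ , p∤j″ , k≡) =
            trans (shallow (subst (λ v → ¬ (p ∣ v)) (sym (trans k≡ (ℕₚ.*-identityʳ j″))) p∤j″)) (τAt-zero Pm≢0 notSpecial _)

      term-nonzero : ∀ {m} → 1 ≤ m → m ≤ j → ¬ (j ≡ s × m ≡ e) → term i l a j m ≡ 0f
      term-nonzero {m} 1≤m m≤j ¬top = byCase (m ℕₚ.≟ j)
        where
        byCase : Dec (m ≡ j) → term i l a j m ≡ 0f
        byCase (yes m≡j) = subst (λ v → term i l a j v ≡ 0f) (sym m≡j) term-top
        byCase (no m≢j)  = Cross.cross 1≤m (ℕₚ.≤∧≢⇒< m≤j m≢j) ¬top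

      lower : j ≤ e → ⟦ μ i ⟧ (a ⊠ (u l ⊠ x ^p j)) ≡ ⟦ τ i l j ⟧ a
      lower j≤e = begin
        ⟦ μ i ⟧ (a ⊠ (u l ⊠ x ^p j)) ≡⟨ expand i l a j ⟩
        sumf {suc j} (λ k → (j C toℕ k) ×f 1f · term i l a j (toℕ k)) ≡⟨ sumf-single {suc j} _ zero others ⟩
        (j C 0) ×f 1f · term i l a j 0 ≡⟨ cong (λ v → v ×f 1f · term i l a j 0) (nC0≡1 j) ⟩
        (1f ∔ 0f) · term i l a j 0 ≡⟨ cong (_· term i l a j 0) (∔-identityʳ 1f) ⟩
        1f · term i l a j 0 ≡⟨ ·-identityˡ _ ⟩
        term i l a j 0 ≡⟨ term-0 i l a j ⟩
        ⟦ μ i ⟧ (a ⊠ (u l ⊠ x₀ ^p j)) ≡⟨ resp (μ i) (⊠-congˡ a (⊠-cong (≈-sym (⊠-identityʳ (u l))) (≈-refl {x₀ ^p j}))) ⟩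
        ⟦ μ i ⟧ (a ⊠ ((u l ⊠ w₁ ^p 0) ⊠ x₀ ^p j))
          ≡⟨ x₀-solves z≤n 1≤j j≤e p∤j dep≤ jp^d≤D Vl (divides 0 refl) (G-≤ (*-monoˡ-≤ M (≤-trans (m≤m+n r _) (m≤m+n κ₁ _))) da) ⟩
        ⟦ τ i l j ⟧ a ∎
        where
        open ≡-Reasoning
        others : ∀ k → k ≢ zero → (j C toℕ k) ×f 1f · term i l a j (toℕ k) ≡ 0f
        others zero    k≢0 = contradiction refl k≢0
        others (suc k) _ = trans (cong ((j C suc (toℕ k)) ×f 1f ·_)
          (term-nonzero (s≤s z≤n) (toℕ<n k) λ { (refl , _) → <⇒≱ (n<1+n e) j≤e })) (·-zeroʳ _)

      -- Two terms survive: the one with x₀^s alone, and the one with m = e, on which x₀ follows γ,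
      -- so that y contributes the missing difference.
      top : j ≡ s → ⟦ μ i ⟧ (a ⊠ (u l ⊠ x ^p j)) ≡ ⟦ τ i l j ⟧ a
      top refl = begin
        ⟦ μ i ⟧ (a ⊠ (u l ⊠ x ^p s)) ≡⟨ expand i l a s ⟩
        summands zero ∔ sumf {s} (λ k → summands (suc k)) ≡⟨ cong (summands zero ∔_) (sumf-single {s} (λ k → summands (suc k)) k̂ others) ⟩
        summands zero ∔ summands (suc k̂) ≡⟨ cong₂ _∔_ first special ⟩
        t ∔ s ×f 1f · (inv (s ×f 1f) s≢0 · (⟦ τ i l s ⟧ a ∔ neg 1f · t)) ≡⟨ cong (t ∔_) (·-assoc _ _ _) ⟨
        t ∔ s ×f 1f · inv (s ×f 1f) s≢0 · (⟦ τ i l s ⟧ a ∔ neg 1f · t) ≡⟨ cong (λ v → t ∔ v · (⟦ τ i l s ⟧ a ∔ neg 1f · t)) (inv-inverseʳ _ s≢0) ⟩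
        t ∔ 1f · (⟦ τ i l s ⟧ a ∔ neg 1f · t) ≡⟨ cong (t ∔_) (·-identityˡ _) ⟩
        t ∔ (⟦ τ i l s ⟧ a ∔ neg 1f · t) ≡⟨ cong (λ v → t ∔ (⟦ τ i l s ⟧ a ∔ v)) (trans (sym (neg-distribˡ-· 1f t)) (cong neg (·-identityˡ t))) ⟩
        t ∔ (⟦ τ i l s ⟧ a ∔ neg t) ≡⟨ trans (∔-comm t _) (neg-cancel _ t) ⟩
        ⟦ τ i l s ⟧ a ∎
        where
        open ≡-Reasoning
        t : 𝔽
        t = ⟦ μ i ⟧ (a ⊠ (u l ⊠ x₀ ^p s))
        summands : Fin (suc s) → 𝔽
        summands k = (s C toℕ k) ×f 1f · term i l a s (toℕ k)
        k̂ : Fin s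
        -- The remaining sum is indexed by m - 1, so m = e sits at the index e - 1.
        k̂ = Fin.fromℕ< (s≤s (m∸n≤m e 1))
        suc-k̂ : suc (toℕ k̂) ≡ e
        suc-k̂ = trans (cong suc (toℕ-fromℕ< (s≤s (m∸n≤m e 1)))) (ℕₚ.m+[n∸m]≡n 1≤e)
        first : summands zero ≡ t
        first = trans (cong (λ v → v ×f 1f · term i l a s 0) (nC0≡1 s)) (trans (cong (_· term i l a s 0) (∔-identityʳ 1f)) (trans (·-identityˡ _) (term-0 i l a s)))
        others : ∀ k → k ≢ k̂ → summands (suc k) ≡ 0f
        others k k≢k̂ = trans (cong ((s C suc (toℕ k)) ×f 1f ·_)
          (term-nonzero (s≤s z≤n) (toℕ<n k) λ (_ , eq) → k≢k̂ (Finₚ.toℕ-injective (ℕₚ.suc-injective (trans eq (sym suc-k̂)))))) (·-zeroʳ _)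
        s∸e≡1 : s ∸ e ≡ 1
        s∸e≡1 = ℕₚ.m+n∸n≡m 1 e
        sCe≡s : s C e ≡ s
        sCe≡s = trans (nCk≡nC[n∸k] {e} {s} (ℕₚ.n≤1+n e)) (trans (cong (s C_) s∸e≡1) (nC1≡n s))
        term-e : term i l a s e ≡ ⟦ σAt (i , l) ⟧ a
        term-e = begin
          term i l a s e ≡⟨ Cross.shallow 1≤e (n<1+n e) p∤s∸e ⟩
          ⟦ τAt i l (P * e) (s ∸ e) ⟧ ((a ⊠ y ^p e) ⊠ Q S ^p (P * e)) ≡⟨ τAt-special (Cross.Pm≢0 1≤e (n<1+n e)) refl s∸e≡1 _ ⟩
          ⟦ γ i l ⟧ ((a ⊠ y ^p e) ⊠ Q S ^p (P * e)) ≡⟨ resp (γ i l) (⊠-comm _ _) ⟩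
          ⟦ γ i l ⟧ (Q S ^p (P * e) ⊠ (a ⊠ y ^p e)) ≡⟨ y-solves i l da ⟩
          ⟦ σAt (i , l) ⟧ a ∎
          where
          p∤s∸e : ¬ (p ∣ s ∸ e)
          p∤s∸e p∣ = <⇒≱ (ℕ.nonTrivial⇒n>1 p {{prime⇒nonTrivial pr}}) (∣⇒≤ (subst (p ∣_) s∸e≡1 p∣))
        special : summands (suc k̂) ≡ s ×f 1f · (inv (s ×f 1f) s≢0 · (⟦ τ i l s ⟧ a ∔ neg 1f · t))
        special = trans (cong (λ v → (s C v) ×f 1f · term i l a s v) suc-k̂) (cong₂ (λ v w → v ×f 1f · w) sCe≡s
          (trans term-e (cong (λ v → inv (s ×f 1f) s≢0 · (⟦ τ i l s ⟧ a ∔ neg 1f · v)) (resp (μ i) (⊠-comm _ a)))))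

    solution : ∃ λ x → x ∈G (b * M) × Solves S u (V 𝓜) s r τ x
    solution = x , x-G , solves
      where
      solves : Solves S u (V 𝓜) s r τ x
      solves {d} {i} {l} {j} 1≤j j≤s p∤j dep≤ jp^d≤D Vl {a} da = byCase (j ℕₚ.≟ s)
        where
        byCase : Dec (j ≡ s) → ⟦ μ i ⟧ (a ⊠ (u l ⊠ x ^p j)) ≡ ⟦ τ i l j ⟧ a
        byCase (yes j≡s) = At.top 1≤j j≤s p∤j dep≤ jp^d≤D Vl da j≡s
        byCase (no j≢s)  = At.lower 1≤j j≤s p∤j dep≤ jp^d≤D Vl da (ℕₚ.≤-pred (ℕₚ.≤∧≢⇒< j≤s j≢s))

  attainableSuc : ∀ e → 1 ≤ e → Attainable e → Attainable (suc e)
  attainableSuc e 1≤e ih with p ∣? suc e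
  ... | yes p∣s = attainable-∣ e p∣s ih
  ... | no p∤s = λ ℓ r → Step.ι e 1≤e p∤s ih ℓ r , λ ω → Step.Constants.α e 1≤e p∤s ih ℓ r ω ,
        λ 1≤M α≤b S reg 𝓜 τ → Correction.solution e 1≤e p∤s ih ℓ r ω 1≤M α≤b S reg 𝓜 τ

  attainable : ∀ s → Attainable s
  attainable zero          = attainable0
  attainable (suc zero)    = attainable1
  attainable (suc (suc e)) = attainableSuc (suc e) (s≤s z≤n) (attainable (suc e))

-- Passing to a subfamily without small relations

module Regularization (F : FiniteField) {p : ℕ} (pr : Prime p) (charp : HasCharacteristic F p) where
  open LinearSystems F pr charp public

  -- If the functionals t^s ▷ δ i are onto, some f in G B turns a ↦ δ i (a f) into the coefficient
  -- of t^j for one chosen i and into zero for the others. Testing a relation at this f annihilates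
  -- that coefficient of g i.
  regularOrRelation : ∀ {k} (δ : Fin k → Lin) A B → Regular δ A B ⊎
    ∃ λ (a : Fin k → Pol) → (∀ i → a i ∈G A) × (∃ λ i → a i ≉0) × (∀ {f} → f ∈G B → sumf (λ i → ⟦ δ i ⟧ (a i ⊠ f)) ≡ 0f)
  regularOrRelation {k} δ A B = result (relationOrOnto φ B)
    where
    rowAt : Fin k × Fin A → Lin
    rowAt (i , s) = tpow (toℕ s) ▷ δ i
    φ : Fin (k * A) → Lin
    φ x = rowAt (Fin.remQuot A x)
    φ-combine : ∀ i s f → ⟦ φ (Fin.combine i s) ⟧ f ≡ ⟦ δ i ⟧ (tpow (toℕ s) ⊠ f)
    φ-combine i s f = cong (λ y → ⟦ rowAt y ⟧ f) (remQuot-combine i s)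
    Result : Set
    Result = Regular δ A B ⊎
      ∃ λ (a : Fin k → Pol) → (∀ i → a i ∈G A) × (∃ λ i → a i ≉0) × (∀ {f} → f ∈G B → sumf (λ i → ⟦ δ i ⟧ (a i ⊠ f)) ≡ 0f)
    result : Relation φ B ⊎ Onto φ B → Result
    result (inj₁ (c , (x , c≢0) , rel)) = inj₂ (a , (λ i → G-polyOf _) , (i₀ , lead⇒≉0 (toℕ s₀) (λ e → c≢0 (trans (sym c-x) e))) , relation)
      where
      a : Fin k → Pol
      a i = polyOf (λ s → c (Fin.combine {k} {A} i s))
      i₀ : Fin k
      i₀ = proj₁ (Fin.remQuot {k} A x)
      s₀ : Fin A
      s₀ = proj₂ (Fin.remQuot {k} A x)
      c-x : coef (a i₀) (toℕ s₀) ≡ c x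
      c-x = trans (coef-polyOf (λ s → c (Fin.combine {k} {A} i₀ s)) s₀) (cong c (Finₚ.combine-remQuot {k} A x))
      relation : ∀ {f} → f ∈G B → sumf (λ i → ⟦ δ i ⟧ (a i ⊠ f)) ≡ 0f
      relation {f} df = trans (sumf-cong {k} (λ i → trans (lin-polyOf (δ i) (λ s → c (Fin.combine {k} {A} i s)) f)
          (sumf-cong {A} (λ s → cong (c (Fin.combine i s) ·_) (sym (φ-combine i s f))))))
        (trans (sym (sumf-combine k {A} (λ x → c x · ⟦ φ x ⟧ f))) (rel df))
    result (inj₂ onto) = inj₁ λ g dg rel i → mk≈ λ j → coefficient g dg rel i j (j <? A)
      where
      coefficient : ∀ g → (∀ i → g i ∈G A) → (∀ {f} → f ∈G B → sumf (λ i → ⟦ δ i ⟧ (g i ⊠ f)) ≡ 0f) → ∀ i j → Dec (j < A) → coef (g i) j ≡ 0f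
      coefficient g dg rel i j (no j≮A) = vanish (dg i) j (≮⇒≥ j≮A)
      coefficient g dg rel i j (yes j<A) = begin
        coef (g i) j ≡⟨ selected (i Finₚ.≟ i) refl (g i) ⟨
        ⟦ target i ⟧ (g i) ≡⟨ sumf-single {k} (λ i′ → ⟦ target i′ ⟧ (g i′)) i (λ i′ i′≢i → unselected (i′ Finₚ.≟ i) i′≢i (g i′)) ⟨
        sumf (λ i′ → ⟦ target i′ ⟧ (g i′)) ≡⟨ sumf-cong {k} (λ i′ → sym (onTarget i′ (dg i′))) ⟩
        sumf (λ i′ → ⟦ δ i′ ⟧ (g i′ ⊠ f)) ≡⟨ rel df ⟩
        0f ∎
        where
        open ≡-Reasoning
        select : ∀ {i′} → Dec (i′ ≡ i) → Lin
        select (yes _) = coefLin j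
        select (no _)  = zeroLin
        target : Fin k → Lin
        target i′ = select (i′ Finₚ.≟ i)
        selected : ∀ {i′} (d : Dec (i′ ≡ i)) → i′ ≡ i → ∀ a → ⟦ select d ⟧ a ≡ coef a j
        selected (yes _) _  a = refl
        selected (no ¬e) e  a = contradiction e ¬e
        unselected : ∀ {i′} (d : Dec (i′ ≡ i)) → i′ ≢ i → ∀ a → ⟦ select d ⟧ a ≡ 0f
        unselected (yes e) ¬e a = contradiction e ¬e
        unselected (no _)  _  a = refl
        values : Fin k × Fin A → 𝔽
        values (i′ , s) = ⟦ target i′ ⟧ (tpow (toℕ s))
        sol : ∃ λ f → f ∈G B × (∀ x → ⟦ φ x ⟧ f ≡ values (Fin.remQuot A x))
        sol = onto (λ x → values (Fin.remQuot A x))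
        f : Pol
        f = proj₁ sol
        df : f ∈G B
        df = proj₁ (proj₂ sol)
        onTarget : ∀ i′ {a} → a ∈G A → ⟦ δ i′ ⟧ (a ⊠ f) ≡ ⟦ target i′ ⟧ a
        onTarget i′ {a} da = trans (resp (δ i′) (⊠-comm a f)) (lin-ext (f ▷ δ i′) (target i′) onPower da)
          where
          onPower : ∀ s → s < A → ⟦ δ i′ ⟧ (f ⊠ tpow s) ≡ ⟦ target i′ ⟧ (tpow s)
          onPower s s<A = trans (resp (δ i′) (⊠-comm f (tpow s)))
            (subst (λ s → ⟦ δ i′ ⟧ (tpow s ⊠ f) ≡ ⟦ target i′ ⟧ (tpow s)) (toℕ-fromℕ< s<A)
              (trans (sym (φ-combine i′ (Fin.fromℕ< s<A) f)) (trans (proj₂ (proj₂ sol) (Fin.combine i′ (Fin.fromℕ< s<A)))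
                (cong values (remQuot-combine i′ (Fin.fromℕ< s<A))))))

  maximal : ∀ {m} (h : Fin m → ℕ) {R : Fin m → Set} → (∀ i → Dec (R i)) → (∀ i → ¬ R i) ⊎ ∃ λ i → R i × (∀ j → R j → h j ≤ h i)
  maximal {zero}  h R? = inj₁ λ ()
  maximal {suc m} h {R} R? with R? zero | maximal (h ∘ suc) (R? ∘ suc)
  ... | no ¬r | inj₁ none = inj₁ λ { zero → ¬r ; (suc i) → none i }
  ... | yes r | inj₁ none = inj₂ (zero , r , λ { zero _ → ℕₚ.≤-refl ; (suc j) rj → contradiction rj (none j) })
  ... | no ¬r | inj₂ (i , ri , max) = inj₂ (suc i , ri , λ { zero r → contradiction r ¬r ; (suc j) rj → max j rj })
  ... | yes r | inj₂ (i , ri , max) with ℕₚ.≤-total (h zero) (h (suc i))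
  ...   | inj₁ h₀≤ = inj₂ (suc i , ri , λ { zero _ → h₀≤ ; (suc j) rj → max j rj })
  ...   | inj₂ hᵢ≤ = inj₂ (zero , r , λ { zero _ → ℕₚ.≤-refl ; (suc j) rj → ≤-trans (max j rj) hᵢ≤ })

  -- The summand q is the size of the spanning coefficients; the rest is the size of t^e A^(p^d)
  -- with e ≤ p^L and d ≤ L, which arises in `family-closed`.
  closureBound : ℕ → ℕ → ℕ → ℕ
  closureBound L q κ = q + (p ^ L + (p ^ L * κ + 1))

  module Ranges (L D : ℕ) (α : ℕ → ℕ → ℕ) where
    P : ℕ
    P = p ^ L

    -- In units of M, h(x) has size D a + 2 when x has size a, as in `fromApproximation`; one more
    -- unit allows for the power of t that selects a digit.
    exitRange : ℕ → ℕ
    exitRange a = D * a + 3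

    -- regularRange m q bounds the range on which a family with 1 + m members is required to be
    -- regular, spanRange m q the range on which it has to span; each relation that is found
    -- shortens the family by one member, and has to be valid on the next spanRange.
    mutual
      regularRange : ℕ → ℕ → ℕ
      regularRange zero    q = α zero q + exitRange (α zero q)
      regularRange (suc m) q = (α (suc m) q + exitRange (α (suc m) q)) + (q + spanRange m (α (suc m) q + q))

      spanRange : ℕ → ℕ → ℕ
      spanRange zero    q = q + ((P + (P * regularRange zero q + 1)) + suc D * regularRange zero q)
      spanRange (suc m) q = (q + ((P + (P * regularRange (suc m) q + 1)) + suc D * regularRange (suc m) q))
                            + (α (suc m) q + spanRange m (α (suc m) q + q))

    base≤regular : ∀ m q → α m q + exitRange (α m q) ≤ regularRange m q
    base≤regular zero    q = ℕₚ.≤-refl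
    base≤regular (suc m) q = m≤m+n _ _

    regular≤span : ∀ m q → q + ((P + (P * regularRange m q + 1)) + suc D * regularRange m q) ≤ spanRange m q
    regular≤span zero    q = ℕₚ.≤-refl
    regular≤span (suc m) q = m≤m+n _ _

    regularRange≤spanRange : ∀ m q → regularRange m q ≤ spanRange m q
    regularRange≤spanRange m q = ≤-trans (≤-trans (m≤m+n (regularRange m q) (D * regularRange m q)) (≤-trans (m≤n+m _ (P + (P * regularRange m q + 1))) (m≤n+m _ q))) (regular≤span m q)

  module Families (β : Lin) (L D : ℕ) (α : ℕ → ℕ → ℕ) where
    open Ranges L D α public

    δ[_,_] : ℕ → ℕ → Lin
    δ[ d , e ] = Λ d (tpow e ▷ β)

    -- the index (0 , 0) stands for β itself
    member : ∀ {m} → (Fin m → ℕ × ℕ) → Fin (suc m) → ℕ × ℕ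
    member t zero    = 0 , 0
    member t (suc i) = t i

    depth : ∀ {m} → (Fin m → ℕ × ℕ) → Fin (suc m) → ℕ
    depth t i = proj₁ (member t i)

    functional : ∀ {m} → (Fin m → ℕ × ℕ) → Fin (suc m) → Lin
    functional t i = δ[ proj₁ (member t i) , proj₂ (member t i) ]

    -- Members deeper than d must have coefficient zero, because conditions of depth d are available
    -- only for functionals of depth at most d.
    InSpan : ∀ {m} → (Fin m → ℕ × ℕ) → Pol → (B ρ d : ℕ) → Lin → Set
    InSpan {m} t Q B ρ d μ = ∃ λ (b : Fin (suc m) → Pol) → (∀ i → b i ∈G B) × (∀ i → depth t i ≤ d ⊎ b i ≈ []) ×
      (∀ {f} → f ∈G ρ → ⟦ μ ⟧ (Q ⊠ f) ≡ sumf (λ i → ⟦ functional t i ⟧ (b i ⊠ f)))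

    record Spanning (M m q ρ : ℕ) : Set where
      field
        tail  : Fin m → ℕ × ℕ
        small : ∀ i → proj₂ (member tail i) ≤ P
        Q     : Pol
        Q≉0   : Q ≉0
        Q-G   : Q ∈G (q * M)
        span  : ∀ d e → d ≤ L → e < P → InSpan tail Q (q * M) (ρ * M) d δ[ d , e ]

    data Outcome (M bound : ℕ) : Set where
      approximable : ∀ a g → g ≉0 → a ≤ bound → g ∈G (a * M) → (∀ {f} → f ∈G (exitRange a * M) → ⟦ β ⟧ (g ⊠ f) ≡ 0f) → Outcome M bound
      regular : ∀ m q (S : Spanning M m q (spanRange m q)) → spanRange m q ≤ bound →
        Regular (functional (Spanning.tail S)) (α m q * M) (regularRange m q * M) → Outcome M bound

    weaken : ∀ {M a b} → a ≤ b → Outcome M a → Outcome M b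
    weaken a≤b (approximable a g g≉0 a≤ dg rel) = approximable a g g≉0 (≤-trans a≤ a≤b) dg rel
    weaken a≤b (regular m q S ≤a reg) = regular m q S (≤-trans ≤a a≤b) reg

    δ[0,0] : ∀ f → ⟦ δ[ 0 , 0 ] ⟧ f ≡ ⟦ β ⟧ f
    δ[0,0] f = trans (sym (·-identityʳ _)) (trans (Λ-^ 0 (tpow 0 ▷ β) f) (resp β (≈-trans (⊠-identityˡ _) (⊠-identityʳ f))))

    -- Eliminating a member of maximal depth from a relation keeps the depths of the spanning
    -- combinations under control.
    eliminate : ∀ {M m q} (S : Spanning M (suc m) q (spanRange (suc m) q)) (a : Fin (suc (suc m)) → Pol) →
      (∀ i → a i ∈G (α (suc m) q * M)) →
      (∀ {f} → f ∈G (regularRange (suc m) q * M) → sumf (λ i → ⟦ functional (Spanning.tail S) i ⟧ (a i ⊠ f)) ≡ 0f) →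
      ∀ i₀ → a (suc i₀) ≉0 → (∀ j → a (suc j) ≉0 → proj₁ (Spanning.tail S j) ≤ proj₁ (Spanning.tail S i₀)) →
      Spanning M m (α (suc m) q + q) (spanRange m (α (suc m) q + q))
    eliminate {M} {m} {q} S a da rel i₀ a₀≉0 max = record
      { tail = t′ ; small = small′ ; Q = a₀ ⊠ Q ; Q≉0 = ⊠-≉0 a₀≉0 Q≉0
      ; Q-G = G-≤ (≤-reflexive (sym (*-distribʳ-+ M A q))) (G-⊠ (da (suc i₀)) Q-G)
      ; span = span′ }
      where
      open Spanning S
      A R : ℕ
      A = α (suc m) q
      R = spanRange m (A + q)
      a₀ : Pol
      a₀ = a (suc i₀)
      t′ : Fin m → ℕ × ℕ
      t′ j = tail (Fin.punchIn i₀ j)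
      lift : Fin (suc m) → Fin (suc (suc m))
      lift = Fin.punchIn (suc i₀)
      member-lift : ∀ j → member t′ j ≡ member tail (lift j)
      member-lift zero    = refl
      member-lift (suc j) = refl
      small′ : ∀ j → proj₂ (member t′ j) ≤ P
      small′ j = subst (λ v → proj₂ v ≤ P) (sym (member-lift j)) (small (lift j))
      max′ : ∀ i → a i ≉0 → depth tail i ≤ depth tail (suc i₀)
      max′ zero    _ = z≤n
      max′ (suc j) = max j
      span′ : ∀ d e → d ≤ L → e < P → InSpan t′ (a₀ ⊠ Q) ((A + q) * M) (R * M) d δ[ d , e ]
      span′ d e d≤L e<P = b′ , b′-G , b′-depth , b′-span
        where
        old : InSpan tail Q (q * M) (spanRange (suc m) q * M) d δ[ d , e ]
        old = span d e d≤L e<P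
        b : Fin (suc (suc m)) → Pol
        b = proj₁ old
        db : ∀ i → b i ∈G (q * M)
        db = proj₁ (proj₂ old)
        b₀ : Pol
        b₀ = b (suc i₀)
        -- a₀ times the old combination minus b₀ times the relation: the eliminated member cancels.
        c : Fin (suc (suc m)) → Pol
        c i = a₀ ⊠ b i ⊞ map neg (b₀ ⊠ a i)
        b′ : Fin (suc m) → Pol
        b′ j = c (lift j)
        b′-G : ∀ j → b′ j ∈G ((A + q) * M)
        b′-G j = G-⊞ (G-≤ (≤-reflexive (sym (*-distribʳ-+ M A q))) (G-⊠ (da (suc i₀)) (db (lift j))))
          (G-neg (G-≤ (≤-reflexive (trans (ℕₚ.+-comm (q * M) (A * M)) (sym (*-distribʳ-+ M A q)))) (G-⊠ (db (suc i₀)) (da (lift j)))))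
        product≈[] : ∀ {f g} → f ≈ [] ⊎ g ≈ [] → f ⊠ g ≈ []
        product≈[] {f} {g} (inj₁ e) = ≈-trans (⊠-cong e (≈-refl {g})) (⊠-zeroˡ g)
        product≈[] {f} {g} (inj₂ e) = ≈-trans (⊠-congˡ f e) (⊠-zeroʳ f)
        c≈[] : ∀ i → b i ≈ [] → b₀ ≈ [] ⊎ a i ≈ [] → c i ≈ []
        c≈[] i bi≈[] h = ≈-trans (⊞-cong (product≈[] (inj₂ bi≈[])) (neg-cong (product≈[] h))) (⊞-identityʳ [])
        -- A coefficient can newly appear at i only if b₀ and `a i` are both nonzero; then the depth
        -- of i is at most that of the eliminated member, hence at most d.
        c-depth : ∀ i → depth tail i ≤ d ⊎ c i ≈ []
        c-depth i = cases (proj₁ (proj₂ (proj₂ old)) i) (proj₁ (proj₂ (proj₂ old)) (suc i₀)) (degree? (a i))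
          where
          cases : depth tail i ≤ d ⊎ b i ≈ [] → depth tail (suc i₀) ≤ d ⊎ b₀ ≈ [] → a i ≈ [] ⊎ Degree (a i) → depth tail i ≤ d ⊎ c i ≈ []
          cases (inj₁ ≤d) _ _ = inj₁ ≤d
          cases (inj₂ bi≈[]) (inj₂ b₀≈[]) _ = inj₂ (c≈[] i bi≈[] (inj₁ b₀≈[]))
          cases (inj₂ bi≈[]) _ (inj₁ ai≈[]) = inj₂ (c≈[] i bi≈[] (inj₂ ai≈[]))
          cases (inj₂ bi≈[]) (inj₁ ≤d) (inj₂ deg) = inj₁ (≤-trans (max′ i (lead⇒≉0 _ (Degree.lead deg))) ≤d)
        b′-depth : ∀ j → depth t′ j ≤ d ⊎ b′ j ≈ []
        b′-depth j = subst (λ v → proj₁ v ≤ d ⊎ b′ j ≈ []) (sym (member-lift j)) (c-depth (lift j))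
        regroup : ∀ a b f → a ⊠ b ⊠ f ≈ b ⊠ (a ⊠ f)
        regroup a b f = ≈-trans (⊠-assoc a b f) (⊠-leftSwap a b f)
        b′-span : ∀ {f} → f ∈G (R * M) → ⟦ δ[ d , e ] ⟧ (a₀ ⊠ Q ⊠ f) ≡ sumf (λ j → ⟦ functional t′ j ⟧ (b′ j ⊠ f))
        b′-span {f} df = begin
          ⟦ δ[ d , e ] ⟧ (a₀ ⊠ Q ⊠ f) ≡⟨ resp δ[ d , e ] (regroup a₀ Q f) ⟩
          ⟦ δ[ d , e ] ⟧ (Q ⊠ (a₀ ⊠ f)) ≡⟨ proj₂ (proj₂ (proj₂ old)) a₀f-G ⟩
          sumf {suc (suc m)} (λ i → ⟦ δᵢ i ⟧ (b i ⊠ (a₀ ⊠ f))) ≡⟨ sumf-cong {suc (suc m)} separate ⟩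
          sumf {suc (suc m)} (λ i → ⟦ δᵢ i ⟧ (c i ⊠ f) ∔ ⟦ δᵢ i ⟧ (a i ⊠ (b₀ ⊠ f)))
            ≡⟨ sumf-distrib-∔ {suc (suc m)} (λ i → ⟦ δᵢ i ⟧ (c i ⊠ f)) (λ i → ⟦ δᵢ i ⟧ (a i ⊠ (b₀ ⊠ f))) ⟩
          sumf {suc (suc m)} (λ i → ⟦ δᵢ i ⟧ (c i ⊠ f)) ∔ sumf {suc (suc m)} (λ i → ⟦ δᵢ i ⟧ (a i ⊠ (b₀ ⊠ f)))
            ≡⟨ cong (sumf {suc (suc m)} (λ i → ⟦ δᵢ i ⟧ (c i ⊠ f)) ∔_) (rel b₀f-G) ⟩
          sumf {suc (suc m)} (λ i → ⟦ δᵢ i ⟧ (c i ⊠ f)) ∔ 0f ≡⟨ ∔-identityʳ _ ⟩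
          sumf {suc (suc m)} (λ i → ⟦ δᵢ i ⟧ (c i ⊠ f)) ≡⟨ sumf-remove {suc m} {suc i₀} (λ i → ⟦ δᵢ i ⟧ (c i ⊠ f)) ⟩
          ⟦ δᵢ (suc i₀) ⟧ (c (suc i₀) ⊠ f) ∔ sumf {suc m} (λ j → ⟦ δᵢ (lift j) ⟧ (b′ j ⊠ f))
            ≡⟨ cong (_∔ sumf {suc m} (λ j → ⟦ δᵢ (lift j) ⟧ (b′ j ⊠ f))) (lin-≈[] (δᵢ (suc i₀)) c₀f≈[]) ⟩
          0f ∔ sumf {suc m} (λ j → ⟦ δᵢ (lift j) ⟧ (b′ j ⊠ f)) ≡⟨ ∔-identityˡ _ ⟩
          sumf {suc m} (λ j → ⟦ δᵢ (lift j) ⟧ (b′ j ⊠ f))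
            ≡⟨ sumf-cong {suc m} (λ j → cong (λ v → ⟦ δ[ proj₁ v , proj₂ v ] ⟧ (b′ j ⊠ f)) (sym (member-lift j))) ⟩
          sumf {suc m} (λ j → ⟦ functional t′ j ⟧ (b′ j ⊠ f)) ∎
          where
          open ≡-Reasoning
          δᵢ : Fin (suc (suc m)) → Lin
          δᵢ = functional tail
          a₀f-G : a₀ ⊠ f ∈G (spanRange (suc m) q * M)
          a₀f-G = G-≤ (≤-trans (≤-reflexive (sym (*-distribʳ-+ M A R))) (*-monoˡ-≤ M (m≤n+m (A + R) (q + ((P + (P * regularRange (suc m) q + 1)) + suc D * regularRange (suc m) q))))) (G-⊠ (da (suc i₀)) df)
          b₀f-G : b₀ ⊠ f ∈G (regularRange (suc m) q * M)
          b₀f-G = G-≤ (≤-trans (≤-reflexive (sym (*-distribʳ-+ M q R))) (*-monoˡ-≤ M (m≤n+m (q + R) (A + exitRange A)))) (G-⊠ (db (suc i₀)) df)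
          c₀f≈[] : c (suc i₀) ⊠ f ≈ []
          c₀f≈[] = product≈[] (inj₁ (≈-trans (⊞-cong (⊠-comm a₀ b₀) ≈-refl) (⊞-inverseʳ (b₀ ⊠ a₀))))
          rejoin : ∀ i → b i ⊠ (a₀ ⊠ f) ≈ c i ⊠ f ⊞ a i ⊠ (b₀ ⊠ f)
          rejoin i = ≈-sym (≈-trans (⊞-cong (≈-refl {c i ⊠ f}) (≈-sym (regroup b₀ (a i) f)))
            (≈-trans (≈-sym (⊠-distribʳ f (c i) (b₀ ⊠ a i))) (≈-trans (⊠-cong cancel (≈-refl {f})) (regroup a₀ (b i) f))))
            where
            cancel : c i ⊞ b₀ ⊠ a i ≈ a₀ ⊠ b i
            cancel = ≈-trans (⊞-assoc (a₀ ⊠ b i) _ _) (≈-trans (⊞-cong (≈-refl {a₀ ⊠ b i}) (≈-trans (⊞-comm _ _) (⊞-inverseʳ (b₀ ⊠ a i)))) (⊞-identityʳ _))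
          separate : ∀ i → ⟦ δᵢ i ⟧ (b i ⊠ (a₀ ⊠ f)) ≡ ⟦ δᵢ i ⟧ (c i ⊠ f) ∔ ⟦ δᵢ i ⟧ (a i ⊠ (b₀ ⊠ f))
          separate i = trans (resp (δᵢ i) (rejoin i)) (lin-⊞ (δᵢ i) _ _)

    ≉0? : ∀ f → Dec (f ≉0)
    ≉0? f with degree? f
    ... | inj₁ f≈[] = no λ f≉0 → f≉0 f≈[]
    ... | inj₂ d = yes (lead⇒≉0 _ (Degree.lead d))

    ¬≉0⇒≈[] : ∀ {f} → ¬ (f ≉0) → f ≈ []
    ¬≉0⇒≈[] {f} ¬≉0 with degree? f
    ... | inj₁ f≈[] = f≈[]
    ... | inj₂ d = contradiction (lead⇒≉0 _ (Degree.lead d)) ¬≉0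

    -- The relation involves β alone, so its coefficient is the denominator of a good approximation
    -- to β.
    exit : ∀ {M} m q (t : Fin m → ℕ × ℕ) (a : Fin (suc m) → Pol) → (∀ i → a i ∈G (α m q * M)) → (∃ λ i → a i ≉0) →
      (∀ {f} → f ∈G (regularRange m q * M) → sumf (λ i → ⟦ functional t i ⟧ (a i ⊠ f)) ≡ 0f) →
      (∀ j → ¬ (a (suc j) ≉0)) → Outcome M (spanRange m q)
    exit {M} m q t a da nonzero rel none = approximable (α m q) (a zero) (a₀≉0 nonzero)
      (≤-trans (≤-trans (m≤m+n (α m q) (exitRange (α m q))) (base≤regular m q)) (regularRange≤spanRange m q)) (da zero)
      λ {f} df → begin
        ⟦ β ⟧ (a zero ⊠ f) ≡⟨ δ[0,0] _ ⟨
        ⟦ functional t zero ⟧ (a zero ⊠ f) ≡⟨ sumf-single {suc m} (λ i → ⟦ functional t i ⟧ (a i ⊠ f)) zero (others f) ⟨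
        sumf {suc m} (λ i → ⟦ functional t i ⟧ (a i ⊠ f)) ≡⟨ rel (G-≤ (*-monoˡ-≤ M (≤-trans (m≤n+m (exitRange (α m q)) (α m q)) (base≤regular m q))) df) ⟩
        0f ∎
      where
      open ≡-Reasoning
      a₀≉0 : (∃ λ i → a i ≉0) → a zero ≉0
      a₀≉0 (zero , h)  = h
      a₀≉0 (suc j , h) = contradiction h (none j)
      others : ∀ f i → i ≢ zero → ⟦ functional t i ⟧ (a i ⊠ f) ≡ 0f
      others f zero    ≢0 = contradiction refl ≢0
      others f (suc j) _  = lin-≈[] (functional t (suc j)) (≈-trans (⊠-cong (¬≉0⇒≈[] (none j)) (≈-refl {f})) (⊠-zeroˡ f))

    -- Only members of the tail are removed, since β must remain available for the final conditions;
    -- the length of the tail bounds the number of removals.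
    regularize : ∀ {M} m q → Spanning M m q (spanRange m q) → Outcome M (spanRange m q)
    regularize {M} m q S with regularOrRelation (functional (Spanning.tail S)) (α m q * M) (regularRange m q * M)
    regularize {M} m q S | inj₁ reg = regular m q S ℕₚ.≤-refl reg
    regularize {M} zero q S | inj₂ (a , da , nonzero , rel) = exit zero q (Spanning.tail S) a da nonzero rel λ ()
    regularize {M} (suc m) q S | inj₂ (a , da , nonzero , rel) with maximal (proj₁ ∘ Spanning.tail S) (λ j → ≉0? (a (suc j)))
    ... | inj₁ none = exit (suc m) q (Spanning.tail S) a da nonzero rel none
    ... | inj₂ (i₀ , a₀≉0 , max) = weaken (≤-trans (m≤n+m _ (α (suc m) q)) (m≤n+m _ (q + ((P + (P * regularRange (suc m) q + 1)) + suc D * regularRange (suc m) q))))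
          (regularize m (α (suc m) q + q) (eliminate S a da rel i₀ a₀≉0 max))

    initial : ∀ {M} → 1 ≤ M → ∀ ρ → Spanning M (suc L * P) 1 ρ
    initial {M} 1≤M ρ = record
      { tail = t ; small = small ; Q = 1p ; Q≉0 = 1p≉0 ; Q-G = 1p-G ; span = span }
      where
      1p-G : 1p ∈G (1 * M)
      1p-G = G-≤ (≤-trans 1≤M (≤-reflexive (sym (ℕₚ.+-identityʳ M)))) G-1p
      values : Fin (suc L) × Fin P → ℕ × ℕ
      values (d , e) = toℕ d , toℕ e
      t : Fin (suc L * P) → ℕ × ℕ
      t x = values (Fin.remQuot P x)
      small : ∀ i → proj₂ (member t i) ≤ P
      small zero    = z≤n
      small (suc x) = <⇒≤ (toℕ<n (proj₂ (Fin.remQuot {suc L} P x)))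
      span : ∀ d e → d ≤ L → e < P → InSpan t 1p (1 * M) (ρ * M) d δ[ d , e ]
      span d e d≤L e<P = b , b-G , b-depth , λ {f} _ → begin
          ⟦ δ[ d , e ] ⟧ (1p ⊠ f) ≡⟨ cong (λ v → ⟦ δ[ proj₁ v , proj₂ v ] ⟧ (1p ⊠ f)) t-x ⟨
          ⟦ functional t (suc x) ⟧ (1p ⊠ f) ≡⟨ cong (λ g → ⟦ functional t (suc x) ⟧ (g ⊠ f)) (unit-yes (x Finₚ.≟ x) refl) ⟨
          ⟦ functional t (suc x) ⟧ (b (suc x) ⊠ f) ≡⟨ sumf-single {suc (suc L * P)} (λ i → ⟦ functional t i ⟧ (b i ⊠ f)) (suc x) (others f) ⟨
          sumf {suc (suc L * P)} (λ i → ⟦ functional t i ⟧ (b i ⊠ f)) ∎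
        where
        open ≡-Reasoning
        x : Fin (suc L * P)
        x = Fin.combine {suc L} {P} (Fin.fromℕ< (s≤s d≤L)) (Fin.fromℕ< e<P)
        t-x : t x ≡ (d , e)
        t-x = trans (cong values (remQuot-combine (Fin.fromℕ< (s≤s d≤L)) (Fin.fromℕ< e<P))) (cong₂ _,_ (toℕ-fromℕ< (s≤s d≤L)) (toℕ-fromℕ< e<P))
        unit : ∀ {y} → Dec (y ≡ x) → Pol
        unit (yes _) = 1p
        unit (no _)  = []
        unit-yes : ∀ {y} (dec : Dec (y ≡ x)) → y ≡ x → unit dec ≡ 1p
        unit-yes (yes _) _ = refl
        unit-yes (no ≢)  e = contradiction e ≢
        unit-no : ∀ {y} (dec : Dec (y ≡ x)) → y ≢ x → unit dec ≡ []
        unit-no (yes e) ≢ = contradiction e ≢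
        unit-no (no _)  _ = refl
        b : Fin (suc (suc L * P)) → Pol
        b zero    = []
        b (suc y) = unit (y Finₚ.≟ x)
        unit-G : ∀ {y} (dec : Dec (y ≡ x)) → unit dec ∈G (1 * M)
        unit-G (yes _) = 1p-G
        unit-G (no _)  = G-[]
        b-G : ∀ i → b i ∈G (1 * M)
        b-G zero    = G-[]
        b-G (suc y) = unit-G (y Finₚ.≟ x)
        unit-depth : ∀ {y} (dec : Dec (y ≡ x)) → depth t (suc y) ≤ d ⊎ unit dec ≈ []
        unit-depth (yes refl) = inj₁ (≤-reflexive (cong proj₁ t-x))
        unit-depth (no _)     = inj₂ ≈-refl
        b-depth : ∀ i → depth t i ≤ d ⊎ b i ≈ []
        b-depth zero    = inj₁ z≤n
        b-depth (suc y) = unit-depth (y Finₚ.≟ x)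
        others : ∀ f i → i ≢ suc x → ⟦ functional t i ⟧ (b i ⊠ f) ≡ 0f
        others f zero    _ = lin-≈[] (functional t zero) (⊠-zeroˡ f)
        others f (suc y) ≢ = trans (cong (λ g → ⟦ functional t (suc y) ⟧ (g ⊠ f)) (unit-no (y Finₚ.≟ x) (≢ ∘ cong suc))) (lin-≈[] (functional t (suc y)) (⊠-zeroˡ f))

    module Closure {M m q ρ} (S : Spanning M m q ρ) where
      open Spanning S

      InS : (K ρ′ d : ℕ) → Lin → Set
      InS K ρ′ d μ = InSpan tail Q (K + q * M) ρ′ d μ

      δᵢ : Fin (suc m) → Lin
      δᵢ = functional tail

      span-zero : ∀ {K ρ′ d} μ → (∀ f → ⟦ μ ⟧ f ≡ 0f) → InS K ρ′ d μ
      span-zero μ μ≡0 = (λ _ → []) , (λ _ → G-[]) , (λ _ → inj₂ ≈-refl) ,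
        λ {f} _ → trans (μ≡0 _) (sym (sumf-zero {suc m} λ i → lin-≈[] (δᵢ i) (⊠-zeroˡ f)))

      span-+ : ∀ {K ρ′ d} μ ν ξ → (∀ f → ⟦ ξ ⟧ f ≡ ⟦ μ ⟧ f ∔ ⟦ ν ⟧ f) → InS K ρ′ d μ → InS K ρ′ d ν → InS K ρ′ d ξ
      span-+ {d = d} μ ν ξ ξ≡ (b , db , depb , eqb) (c , dc , depc , eqc) =
        (λ i → b i ⊞ c i) , (λ i → G-⊞ (db i) (dc i)) , (λ i → deps (depb i) (depc i)) ,
        λ {f} df → trans (ξ≡ _) (trans (cong₂ _∔_ (eqb df) (eqc df))
          (trans (sym (sumf-distrib-∔ {suc m} (λ i → ⟦ δᵢ i ⟧ (b i ⊠ f)) (λ i → ⟦ δᵢ i ⟧ (c i ⊠ f))))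
            (sumf-cong {suc m} λ i → trans (sym (lin-⊞ (δᵢ i) (b i ⊠ f) (c i ⊠ f))) (resp (δᵢ i) (≈-sym (⊠-distribʳ f (b i) (c i)))))))
        where
        deps : ∀ {k f g} → k ≤ d ⊎ f ≈ [] → k ≤ d ⊎ g ≈ [] → k ≤ d ⊎ f ⊞ g ≈ []
        deps (inj₁ k≤d) _ = inj₁ k≤d
        deps (inj₂ _) (inj₁ k≤d) = inj₁ k≤d
        deps (inj₂ f≈[]) (inj₂ g≈[]) = inj₂ (≈-trans (⊞-cong f≈[] g≈[]) (⊞-identityʳ []))

      span-scale : ∀ {K ρ′ d} x μ ξ → (∀ f → ⟦ ξ ⟧ f ≡ x · ⟦ μ ⟧ f) → InS K ρ′ d μ → InS K ρ′ d ξ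
      span-scale {d = d} x μ ξ ξ≡ (b , db , depb , eqb) =
        (λ i → scale x (b i)) , (λ i → G-scale (db i)) , (λ i → deps (depb i)) ,
        λ {f} df → trans (ξ≡ _) (trans (cong (x ·_) (eqb df)) (trans (·-distribˡ-sumf {suc m} x (λ i → ⟦ δᵢ i ⟧ (b i ⊠ f)))
          (sumf-cong {suc m} λ i → trans (sym (lin-scale (δᵢ i) x (b i ⊠ f))) (resp (δᵢ i) (≈-sym (⊠-scaleˡ x (b i) f))))))
        where
        deps : ∀ {k f} → k ≤ d ⊎ f ≈ [] → k ≤ d ⊎ scale x f ≈ []
        deps (inj₁ k≤d) = inj₁ k≤d
        deps (inj₂ f≈[]) = inj₂ (scale-cong x f≈[])

      -- Write k = e + k₁ p^d with e < p^d. The power t^(k₁ p^d) leaves the root as t^k₁, and what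
      -- remains is `δ[ d , e ]`.
      span-tpow : ∀ {K ρ′ d k} → d ≤ L → k ≤ K → K + ρ′ ≤ ρ * M → InS K ρ′ d (Λ d (tpow k ▷ β))
      span-tpow {K} {ρ′} {d} {k} d≤L k≤K K+ρ′≤ = shifted (span d e d≤L (<-≤-trans (m%n<n k (p ^ d)) (ℕₚ.^-monoʳ-≤ p {{prime⇒nonZero pr}} d≤L)))
        where
        instance
          p^d-nonZero : ℕ.NonZero (p ^ d)
          p^d-nonZero = ℕ.>-nonZero (0<p^ d)
        e k₁ : ℕ
        e = k % (p ^ d)
        k₁ = k / (p ^ d)
        k₁≤K : k₁ ≤ K
        k₁≤K = ≤-trans (m/n≤m k (p ^ d)) k≤K
        tpow-k : tpow k ≈ tpow e ⊠ tpow k₁ ^p (p ^ d)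
        tpow-k = ≈-trans (mk≈ λ i → cong (λ v → coef (tpow v) i) (trans (m≡m%n+[m/n]*n k (p ^ d)) (cong (e +_) (ℕₚ.*-comm k₁ (p ^ d)))))
          (≈-trans (tpow-+ e (p ^ d * k₁)) (⊠-congˡ (tpow e) (≈-sym (tpow-^p k₁ (p ^ d)))))
        move : ∀ f → ⟦ Λ d (tpow k ▷ β) ⟧ (Q ⊠ f) ≡ ⟦ δ[ d , e ] ⟧ (Q ⊠ (tpow k₁ ⊠ f))
        move f = ^p^-injective d (trans (Λ-^ d (tpow k ▷ β) (Q ⊠ f)) (trans (resp β (begin
          tpow k ⊠ (Q ⊠ f) ^p (p ^ d) ≈⟨ ⊠-cong tpow-k (≈-refl {(Q ⊠ f) ^p (p ^ d)}) ⟩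
          tpow e ⊠ tpow k₁ ^p (p ^ d) ⊠ (Q ⊠ f) ^p (p ^ d) ≈⟨ ⊠-assoc (tpow e) _ _ ⟩
          tpow e ⊠ (tpow k₁ ^p (p ^ d) ⊠ (Q ⊠ f) ^p (p ^ d)) ≈⟨ ⊠-congˡ (tpow e) (^p-distrib-⊠ (tpow k₁) (Q ⊠ f) (p ^ d)) ⟨
          tpow e ⊠ (tpow k₁ ⊠ (Q ⊠ f)) ^p (p ^ d) ≈⟨ ⊠-congˡ (tpow e) (^p-cong (p ^ d) (⊠-leftSwap (tpow k₁) Q f)) ⟩
          tpow e ⊠ (Q ⊠ (tpow k₁ ⊠ f)) ^p (p ^ d) ∎)) (sym (Λ-^ d (tpow e ▷ β) (Q ⊠ (tpow k₁ ⊠ f))))))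
          where open ≈-Reasoning
        shifted : InSpan tail Q (q * M) (ρ * M) d δ[ d , e ] → InS K ρ′ d (Λ d (tpow k ▷ β))
        shifted (b , db , depb , eqb) = (λ i → tpow k₁ ⊠ b i) ,
          (λ i → G-≤ (+-monoˡ-≤ (q * M) k₁≤K) (G-tpow-⊠ k₁ (db i))) , (λ i → deps (depb i)) ,
          λ {f} df → trans (move f) (trans (eqb (G-≤ (≤-trans (+-monoˡ-≤ ρ′ k₁≤K) K+ρ′≤) (G-tpow-⊠ k₁ df)))
            (sumf-cong {suc m} λ i → resp (δᵢ i) (≈-trans (⊠-leftSwap (b i) (tpow k₁) f) (≈-sym (⊠-assoc (tpow k₁) (b i) f)))))
          where
          deps : ∀ {v f} → v ≤ d ⊎ f ≈ [] → v ≤ d ⊎ tpow k₁ ⊠ f ≈ []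
          deps (inj₁ v≤d) = inj₁ v≤d
          deps (inj₂ f≈[]) = inj₂ (≈-trans (⊠-congˡ (tpow k₁) f≈[]) (⊠-zeroʳ (tpow k₁)))

      span-poly : ∀ {K ρ′ d} → d ≤ L → K + ρ′ ≤ ρ * M → ∀ n k B → B ∈G n → k + n ≤ K → InS K ρ′ d (Λ d ((tpow k ⊠ B) ▷ β))
      span-poly {d = d} d≤L K≤ zero k B dB _ = span-zero (Λ d ((tpow k ⊠ B) ▷ β)) λ f → lin-zeroˡ (≈-trans (⊠-congˡ (tpow k) (G0⇒≈[] dB)) (⊠-zeroʳ (tpow k))) f
        where
        lin-zeroˡ : ∀ {A} → A ≈ [] → ∀ f → ⟦ Λ d (A ▷ β) ⟧ f ≡ 0f
        lin-zeroˡ {A} A≈[] f = ^p^-injective d (trans (Λ-^ d (A ▷ β) f) (trans (lin-≈[] β (≈-trans (⊠-cong A≈[] (≈-refl {f ^p (p ^ d)})) (⊠-zeroˡ _))) (sym (0^f (p ^ d) (0<p^ d)))))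
      span-poly {d = d} d≤L K≤ (suc n) k [] dB k+n≤ = span-poly d≤L K≤ n k [] G-[] (≤-trans (+-monoʳ-≤ k (ℕₚ.n≤1+n n)) k+n≤)
      span-poly {K} {ρ′} {d} d≤L K≤ (suc n) k (x ∷ B) dB k+n≤ = span-+ μ₁ μ₂ (Λ d ((tpow k ⊠ (x ∷ B)) ▷ β)) split
          (span-scale (root d x) (Λ d (tpow k ▷ β)) μ₁ scaled (span-tpow d≤L (≤-trans (m≤m+n k (suc n)) k+n≤) K≤))
          (span-poly d≤L K≤ n (suc k) B (G-tail dB) (≤-trans (≤-reflexive (sym (ℕₚ.+-suc k n))) k+n≤))
        where
        μ₁ μ₂ : Lin
        μ₁ = Λ d (scale x (tpow k) ▷ β)
        μ₂ = Λ d ((tpow (suc k) ⊠ B) ▷ β)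
        expand : tpow k ⊠ (x ∷ B) ≈ scale x (tpow k) ⊞ tpow (suc k) ⊠ B
        expand = begin
          tpow k ⊠ (x ∷ B) ≈⟨ ⊠-congˡ (tpow k) (∷-split x B) ⟩
          tpow k ⊠ (constant x ⊞ (0f ∷ B)) ≈⟨ ⊠-distribˡ (tpow k) (constant x) (0f ∷ B) ⟩
          tpow k ⊠ constant x ⊞ tpow k ⊠ (0f ∷ B) ≈⟨ ⊞-cong (⊠-constant (tpow k) x) (≈-trans (⊠-shiftʳ (tpow k) B) (≈-sym (⊠-shiftˡ (tpow k) B))) ⟩
          scale x (tpow k) ⊞ tpow (suc k) ⊠ B ∎
          where open ≈-Reasoning
        split : ∀ f → ⟦ Λ d ((tpow k ⊠ (x ∷ B)) ▷ β) ⟧ f ≡ ⟦ μ₁ ⟧ f ∔ ⟦ μ₂ ⟧ f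
        split f = trans (cong (root d) (trans (resp β (≈-trans (⊠-cong expand (≈-refl {f ^p (p ^ d)})) (⊠-distribʳ (f ^p (p ^ d)) (scale x (tpow k)) (tpow (suc k) ⊠ B))))
          (lin-⊞ β _ _))) (root-∔ d _ _)
        scaled : ∀ f → ⟦ μ₁ ⟧ f ≡ root d x · ⟦ Λ d (tpow k ▷ β) ⟧ f
        scaled f = trans (cong (root d) (trans (resp β (⊠-scaleˡ x (tpow k) (f ^p (p ^ d)))) (trans (lin-scale β x _) (cong (_· ⟦ β ⟧ (tpow k ⊠ f ^p (p ^ d))) (sym (root-^ d x))))))
          (root-· d (root d x) _)

    -- By `Λ-∘` the functional is the root of depth d + c of t^e A^(p^d) ▷ β. Roots are additive, so
    -- the polynomial can be split into monomials, and their exponents reduced modulo p^(d + c).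
    family-closed : ∀ {M m q} (S : Spanning M m q (spanRange m q)) → 1 ≤ M → ∀ {κ} i c {A} → κ ≤ regularRange m q →
      depth (Spanning.tail S) i + c ≤ L → A ∈G (κ * M) →
      InSpan (Spanning.tail S) (Spanning.Q S) (closureBound L q κ * M) ((suc D * regularRange m q) * M) (depth (Spanning.tail S) i + c)
             (Λ c (A ▷ functional (Spanning.tail S) i))
    family-closed {M} {m} {q} S 1≤M {κ} i c {A} κ≤b d+c≤L dA = transport (span-poly d+c≤L range ((P + (P * κ + 1)) * M) 0 B B-G ℕₚ.≤-refl)
      where
      open Spanning S
      open Closure S
      open Units M 1≤M
      b d e : ℕ
      b = regularRange m q
      d = proj₁ (member tail i)
      e = proj₂ (member tail i)
      B : Pol
      B = tpow e ⊠ A ^p (p ^ d)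
      p^d≤P : p ^ d ≤ P
      p^d≤P = ℕₚ.^-monoʳ-≤ p {{prime⇒nonZero pr}} (≤-trans (m≤m+n d c) d+c≤L)
      B-G : B ∈G ((P + (P * κ + 1)) * M)
      B-G = G-≤ (get (⊑-+ (⊑-mono (⊑-const e) (small i)) (⊑-+ (⊑-mono (⊑-* (p ^ d) (⊑-unit κ)) (*-monoˡ-≤ κ p^d≤P)) (⊑-const 1))))
                (G-tpow-⊠ e (G-^p (p ^ d) dA))
      range : (P + (P * κ + 1)) * M + (suc D * b) * M ≤ spanRange m q * M
      range = ≤-trans (≤-reflexive (sym (*-distribʳ-+ M (P + (P * κ + 1)) (suc D * b)))) (*-monoˡ-≤ M
        (≤-trans (≤-trans (+-monoˡ-≤ (suc D * b) (+-monoʳ-≤ P (+-monoˡ-≤ 1 (*-monoʳ-≤ P κ≤b)))) (m≤n+m _ q)) (regular≤span m q)))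
      transport : InS ((P + (P * κ + 1)) * M) ((suc D * b) * M) (d + c) (Λ (d + c) ((tpow 0 ⊠ B) ▷ β)) →
        InSpan tail Q (closureBound L q κ * M) ((suc D * b) * M) (d + c) (Λ c (A ▷ functional tail i))
      transport (β′ , dβ , depβ , eqβ) = β′ ,
        (λ j → G-≤ (≤-reflexive (trans (ℕₚ.+-comm _ (q * M)) (sym (*-distribʳ-+ M q (P + (P * κ + 1)))))) (dβ j)) , depβ ,
        λ {f} df → trans (Λ-∘ c d A (tpow e) β (Q ⊠ f)) (trans (cong (root (d + c)) (resp β (⊠-cong (≈-sym (⊠-identityˡ B)) (≈-refl {(Q ⊠ f) ^p (p ^ (d + c))})))) (eqβ df))

n<p^n : ∀ {p} → 1 < p → ∀ n → n < p ^ n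
n<p^n 1<p zero    = s≤s z≤n
n<p^n {p} 1<p (suc n) = <-≤-trans (s≤s (n<p^n 1<p n))
  (≤-trans (+-monoˡ-≤ (p ^ n) (≤-trans (s≤s z≤n) (n<p^n 1<p n)))
  (≤-trans (≤-reflexive (cong (p ^ n +_) (sym (ℕₚ.+-identityʳ (p ^ n))))) (*-monoˡ-≤ (p ^ n) 1<p)))

∈⇒≤sum : ∀ {n} {ns : List ℕ} → n ∈ ns → n ≤ ListAction.sum ns
∈⇒≤sum (here refl) = m≤m+n _ _
∈⇒≤sum {ns = m ∷ ns} (there n∈) = ≤-trans (∈⇒≤sum n∈) (m≤n+m (ListAction.sum ns) m)

-- Digits of Laurent series as functionals, and evaluation of h

module LaurentFunctionals (F : FiniteField) where
  open Functionals F public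

  mulCoeff-≈[] : ∀ β {f} → f ≈ [] → ∀ i → mulCoeff F β f i ≡ 0f
  mulCoeff-≈[] β {[]}    e i = refl
  mulCoeff-≈[] β {a ∷ f} e i = trans (cong₂ _∔_ (trans (cong (_· β i) (at e 0)) (·-zeroˡ (β i))) (mulCoeff-≈[] β {f} (mk≈ (at e ∘ suc)) _)) (∔-identityˡ 0f)

  mulCoeff-cong : ∀ β {f g} → f ≈ g → ∀ i → mulCoeff F β f i ≡ mulCoeff F β g i
  mulCoeff-cong β {[]}    {g}     e i = sym (mulCoeff-≈[] β (≈-sym e) i)
  mulCoeff-cong β {a ∷ f} {[]}    e i = mulCoeff-≈[] β e i
  mulCoeff-cong β {a ∷ f} {b ∷ g} e i = cong₂ _∔_ (cong (_· β i) (at e 0)) (mulCoeff-cong β {f} {g} (mk≈ (at e ∘ suc)) _)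

  mulCoeff-scale : ∀ β a f i → mulCoeff F β (scale a f) i ≡ a · mulCoeff F β f i
  mulCoeff-scale β a []      i = sym (·-zeroʳ a)
  mulCoeff-scale β a (b ∷ f) i = trans (cong₂ _∔_ (·-assoc a b (β i)) (mulCoeff-scale β a f _)) (sym (·-distribˡ a _ _))

  opaque
    unfolding _⊞_

    mulCoeff-⊞ : ∀ β f g i → mulCoeff F β (f ⊞ g) i ≡ mulCoeff F β f i ∔ mulCoeff F β g i
    mulCoeff-⊞ β []      g       i = sym (∔-identityˡ _)
    mulCoeff-⊞ β (a ∷ f) []      i = sym (∔-identityʳ _)
    mulCoeff-⊞ β (a ∷ f) (b ∷ g) i = trans (cong₂ _∔_ (·-distribʳ (β i) a b) (mulCoeff-⊞ β f g _)) (∔-interchange _ _ _ _)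

  residue : (ℤ → 𝔽) → Lin
  residue β = record
    { ⟦_⟧ = λ f → mulCoeff F β f ℤ.-[1+ 0 ] ; resp = λ e → mulCoeff-cong β e _
    ; lin-⊞ = λ f g → mulCoeff-⊞ β f g _ ; lin-scale = λ a f → mulCoeff-scale β a f _ }

  mulCoeff-tpow : ∀ β k f j → mulCoeff F β (tpow k ⊠ f) ℤ.-[1+ j ] ≡ mulCoeff F β f ℤ.-[1+ k + j ]
  mulCoeff-tpow β zero    f j = mulCoeff-cong β (⊠-identityˡ f) _
  mulCoeff-tpow β (suc k) f j = begin
    mulCoeff F β (tpow (suc k) ⊠ f) ℤ.-[1+ j ]
      ≡⟨ mulCoeff-cong β (⊠-shiftˡ (tpow k) f) _ ⟩
    0f · β ℤ.-[1+ j ] ∔ mulCoeff F β (tpow k ⊠ f) ℤ.-[1+ suc (j + 0) ]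
      ≡⟨ trans (cong (_∔ mulCoeff F β (tpow k ⊠ f) ℤ.-[1+ suc (j + 0) ]) (·-zeroˡ _)) (∔-identityˡ _) ⟩
    mulCoeff F β (tpow k ⊠ f) ℤ.-[1+ suc (j + 0) ]
      ≡⟨ cong (λ v → mulCoeff F β (tpow k ⊠ f) ℤ.-[1+ suc v ]) (ℕₚ.+-identityʳ j) ⟩
    mulCoeff F β (tpow k ⊠ f) ℤ.-[1+ suc j ]
      ≡⟨ mulCoeff-tpow β k f (suc j) ⟩
    mulCoeff F β f ℤ.-[1+ k + suc j ]
      ≡⟨ cong (λ v → mulCoeff F β f ℤ.-[1+ v ]) (ℕₚ.+-suc k j) ⟩
    mulCoeff F β f ℤ.-[1+ suc (k + j) ] ∎
    where open ≡-Reasoning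

  residue-tpow : ∀ β k f → mulCoeff F β f ℤ.-[1+ k ] ≡ ⟦ residue β ⟧ (tpow k ⊠ f)
  residue-tpow β k f = sym (trans (mulCoeff-tpow β k f 0) (cong (λ v → mulCoeff F β f ℤ.-[1+ v ]) (ℕₚ.+-identityʳ k)))

  evaluate : List ℕ → (ℕ → Pol) → Pol → Pol
  evaluate 𝒦 c x = foldr (λ r acc → c r ⊠ x ^p r ⊞ acc) (c 0) 𝒦

  opaque
    unfolding _⊞_

    ⊗^≡^p : ∀ x n → _⊗^_ F x n ≡ x ^p n
    ⊗^≡^p x zero    = refl
    ⊗^≡^p x (suc n) = cong (_⊗_ F x) (⊗^≡^p x n)

    evalH≈evaluate : ∀ 𝒦 c x → evalH F 𝒦 c x ≈ evaluate 𝒦 c x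
    evalH≈evaluate []      c x = ≈-refl
    evalH≈evaluate (r ∷ 𝒦) c x = ⊞-cong (⊠-congˡ (c r) (mk≈ λ i → cong (λ f → coef f i) (⊗^≡^p x r))) (evalH≈evaluate 𝒦 c x)

    PolyDivides⇒ : ∀ {g f} → PolyDivides F g f → ∃ λ a → a ⊠ g ≈ f
    PolyDivides⇒ (a , eq) = a , mk≈ eq

  G-length : ∀ f → f ∈G List.length f
  G-length []      = G-[]
  G-length (a ∷ f) = G-∷ (G-length f)

  coefficientBound : List ℕ → (ℕ → Pol) → ℕ
  coefficientBound 𝒦 c = List.length (c 0) + ListAction.sum (map (List.length ∘ c) 𝒦)

  G-coefficient : ∀ 𝒦 c {r} → r ∈ 𝒦 → c r ∈G coefficientBound 𝒦 c
  G-coefficient 𝒦 c r∈ = G-≤ (≤-trans (∈⇒≤sum (∈-map⁺ (List.length ∘ c) r∈)) (m≤n+m _ (List.length (c 0)))) (G-length (c _))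

  G-evaluate : ∀ 𝒦 {c x n} → c 0 ∈G n → (∀ {r} → r ∈ 𝒦 → c r ⊠ x ^p r ∈G n) → evaluate 𝒦 c x ∈G n
  G-evaluate []      d₀ d = d₀
  G-evaluate (r ∷ 𝒦) d₀ d = G-⊞ (d (here refl)) (G-evaluate 𝒦 d₀ (d ∘ there))

  lin-evaluate-0 : ∀ λ′ 𝒦 c x → (∀ {r} → r ∈ 𝒦 → ⟦ λ′ ⟧ (c r ⊠ x ^p r) ≡ 0f) → ⟦ λ′ ⟧ (evaluate 𝒦 c x) ≡ ⟦ λ′ ⟧ (c 0)
  lin-evaluate-0 λ′ []      c x h = refl
  lin-evaluate-0 λ′ (r ∷ 𝒦) c x h = trans (lin-⊞ λ′ _ _) (trans (cong₂ _∔_ (h (here refl)) (lin-evaluate-0 λ′ 𝒦 c x (h ∘ there))) (∔-identityˡ _))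

  lin-evaluate-1 : ∀ λ′ {𝒦} c x {k} → Unique 𝒦 → k ∈ 𝒦 → (∀ {r} → r ∈ 𝒦 → r ≢ k → ⟦ λ′ ⟧ (c r ⊠ x ^p r) ≡ 0f) →
    ⟦ λ′ ⟧ (evaluate 𝒦 c x) ≡ ⟦ λ′ ⟧ (c k ⊠ x ^p k) ∔ ⟦ λ′ ⟧ (c 0)
  lin-evaluate-1 λ′ {r ∷ 𝒦} c x (r∉ ∷ uniq) (here refl) h = trans (lin-⊞ λ′ _ _)
    (cong (⟦ λ′ ⟧ (c r ⊠ x ^p r) ∔_) (lin-evaluate-0 λ′ 𝒦 c x λ r′∈ → h (there r′∈) λ { refl → All.lookup r∉ r′∈ refl }))
  lin-evaluate-1 λ′ {r ∷ 𝒦} c x (r∉ ∷ uniq) (there k∈) h = trans (lin-⊞ λ′ _ _)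
    (trans (cong₂ _∔_ (h (here refl) λ { refl → All.lookup r∉ k∈ refl }) (lin-evaluate-1 λ′ c x uniq k∈ (h ∘ there))) (∔-identityˡ _))

-- The two cases for β and the final constants

module Conclusion (F : FiniteField) (p : ℕ) (pr : Prime p) (charp : HasCharacteristic F p)
                  (𝒦 : List ℕ) (unique : Unique 𝒦) (positive : All (1 ≤_) 𝒦) where
  open Regularization F pr charp public
  open LaurentFunctionals F using (residue; residue-tpow; evaluate; evalH≈evaluate; PolyDivides⇒; coefficientBound; G-coefficient; G-length; G-evaluate; lin-evaluate-1)

  1<p : 1 < p
  1<p = ℕ.nonTrivial⇒n>1 p {{prime⇒nonTrivial pr}}

  -- A common bound for the exponents in 𝒦. It serves as the depth bound L as well, because D < p^D.
  D : ℕ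
  D = ListAction.sum 𝒦

  D<p^D : D < p ^ D
  D<p^D = n<p^n 1<p D

  module Attain (n q : ℕ) = AttainabilityInduction F pr charp D D D<p^D n q (closureBound D q)

  -- At exponent k the test polynomial is A c_k Q^k, of size 2 + (D q + 1). At the other exponents
  -- it is a closure coefficient for A c_r, which has size 2, times a power of Q.
  level : ℕ → ℕ
  level q = closureBound D q 2 + (2 + (D * q + 1))

  ι₀ α₀ α : ℕ → ℕ → ℕ
  ι₀ m q = proj₁ (Attain.attainable (suc m) q D 1 (level q))
  α₀ m q = proj₁ (proj₂ (Attain.attainable (suc m) q D 1 (level q)) 1)
  α m q = α₀ m q + ((D * q + 2) + 2)

  open Ranges D D α

  -- The starting family has (D + 1) P root functionals besides β and Q = 1, of size 1. Its spanning
  -- range dominates every range met later in the recursion, and θ is its reciprocal.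
  scaleFactor : ℕ
  scaleFactor = spanRange (suc D * P) 1

  1≤scaleFactor : 1 ≤ scaleFactor
  1≤scaleFactor = ≤-trans (s≤s z≤n) (regular≤span (suc D * P) 1)

  module Polynomial (c : ℕ → Poly F) (k : ℕ) (k∈K* : InKStar p 𝒦 k) (c-k : NonZeroPoly F (c k))
                    (intersective : ∀ g d → HasDegree F g d → ∃ λ m → InG F d m × PolyDivides F g (evalH F 𝒦 c m)) where

    k∈𝒦 : k ∈ 𝒦
    k∈𝒦 = proj₁ k∈K*

    1≤k : 1 ≤ k
    1≤k = All.lookup positive k∈𝒦

    c-k≉0 : c k ≉0
    c-k≉0 = lead⇒≉0 (proj₁ c-k) (proj₂ c-k)

    module AtScale (M : ℕ) (c-G : coefficientBound 𝒦 c < M) (β : Lin) where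
      open Units M (≤-trans (s≤s z≤n) c-G)
      open Families β D D α using (Outcome; approximable; regular; Spanning; functional; depth; δ[0,0]; regularize; initial; family-closed)

      1≤M : 1 ≤ M
      1≤M = ≤-trans (s≤s z≤n) c-G

      c₀-G : c 0 ∈G M
      c₀-G = G-≤ (≤-trans (m≤m+n (List.length (c 0)) _) (<⇒≤ c-G)) (G-length (c 0))

      cᵣ-G : ∀ {r} → r ∈ 𝒦 → c r ∈G M
      cᵣ-G r∈ = G-≤ (<⇒≤ c-G) (G-coefficient 𝒦 c r∈)

      M⊑1 : M ⊑ 1
      M⊑1 = mk⊑ (≤-reflexive (sym (ℕₚ.+-identityʳ M)))

      Goal : Set
      Goal = ∃ λ x → x ∈G (scaleFactor * M) × (∀ {i} → i < M → ⟦ β ⟧ (tpow i ⊠ evaluate 𝒦 c x) ≡ 0f)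

      -- If β is well approximable, then the root of h modulo the denominator g does the job.
      fromApproximation : ∀ a g → g ≉0 → a ≤ scaleFactor → g ∈G (a * M) → (∀ {f} → f ∈G (exitRange a * M) → ⟦ β ⟧ (g ⊠ f) ≡ 0f) → Goal
      fromApproximation a g g≉0 a≤ dg rel = x , G-≤ (*-monoˡ-≤ M a≤) x-G , λ {i} i<M → begin
          ⟦ β ⟧ (tpow i ⊠ evaluate 𝒦 c x) ≡⟨ resp β (≈-trans (⊠-congˡ (tpow i) (≈-sym yg≈)) (≈-trans (⊠-congˡ (tpow i) (⊠-comm y g)) (⊠-leftSwap (tpow i) g y))) ⟩
          ⟦ β ⟧ (g ⊠ (tpow i ⊠ y)) ≡⟨ rel (G-≤ (get (⊑-mono (⊑-+ (i⊑1 i<M) (⊑-unit (1 + (D * a + 1)))) (≤-reflexive exit≡))) (tpow-y-G i)) ⟩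
          0f ∎
        where
        open ≡-Reasoning
        open Degree (degree g≉0)
        i⊑1 : ∀ {i} → i < M → suc i ⊑ 1
        i⊑1 i<M = mk⊑ (≤-trans i<M (get M⊑1))
        given : ∃ λ m → InG F deg m × PolyDivides F g (evalH F 𝒦 c m)
        given = intersective g deg (lead , λ i deg<i → vanish bound i deg<i)
        x y : Pol
        x = proj₁ given
        y = proj₁ (PolyDivides⇒ (proj₂ (proj₂ given)))
        yg≈ : y ⊠ g ≈ evaluate 𝒦 c x
        yg≈ = ≈-trans (proj₂ (PolyDivides⇒ (proj₂ (proj₂ given)))) (evalH≈evaluate 𝒦 c x)
        x-G : x ∈G (a * M)
        x-G = G-≤ (≮⇒≥ λ aM<deg → lead (vanish dg deg (<⇒≤ aM<deg))) (mkG (proj₁ (proj₂ given)))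
        value-G : evaluate 𝒦 c x ∈G ((1 + (D * a + 1)) * M)
        value-G = G-evaluate 𝒦 (G-≤ (get (⊑-mono M⊑1 (m≤m+n 1 (D * a + 1)))) c₀-G) λ {r} r∈ →
          G-≤ (get (⊑-mono (⊑-+ M⊑1 (⊑-+ (⊑-* r (⊑-unit a)) (⊑-const 1))) (s≤s (+-monoˡ-≤ 1 (*-monoˡ-≤ a (∈⇒≤sum r∈))))))
              (G-⊠ (cᵣ-G r∈) (G-^p r x-G))
        tpow-y-G : ∀ i → tpow i ⊠ y ∈G (suc i + (1 + (D * a + 1)) * M)
        tpow-y-G i = G-⊠ (G-tpow i) (G-⊠⁻¹ g≉0 (G-≈ (≈-sym yg≈) value-G))
        exit≡ : 1 + (1 + (D * a + 1)) ≡ D * a + 3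
        exit≡ = trans (cong (λ v → 2 + v) (ℕₚ.+-comm (D * a) 1)) (ℕₚ.+-comm 3 (D * a))

      module FromRegular (m q : ℕ) (S : Spanning M m q (spanRange m q)) (≤scale : spanRange m q ≤ scaleFactor)
                         (reg : Regular (functional (Spanning.tail S)) (α m q * M) (regularRange m q * M)) where
        open Spanning S using (tail; Q; Q≉0; Q-G)

        b n : ℕ
        b = regularRange m q
        n = suc m

        module A = Attain n q

        α≤b : α m q ≤ b
        α≤b = ≤-trans (m≤m+n (α m q) _) (base≤regular m q)

        system : A.System M b
        system = record
          { dep = depth tail ; δ = functional tail ; Q = Q ; Q≉0 = Q≉0 ; Q-G = Q-G
          ; closure = λ i c κ≤b d+c≤L dA → family-closed S 1≤M i c κ≤b d+c≤L dA }

        one-^p : ∀ j → 1p ^p j ≈ 1p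
        one-^p zero    = ≈-refl
        one-^p (suc j) = ≈-trans (⊠-identityˡ _) (one-^p j)

        trivialMonomial : Fin 1 → Pol
        trivialMonomial _ = 1p

        monomials : A.Monomials M 1 (ι₀ m q) trivialMonomial
        monomials = record
          { V = λ _ _ → ⊤ ; rootV = λ {_} {l} c _ _ → l , tt , ≈-sym (one-^p (p ^ c))
          ; bounded = λ _ → G-≤ (get (⊑-mono (⊑-const 1) ℕₚ.≤-refl)) G-1p
          ; independent = λ { g _ eq zero → ≈-trans (≈-sym (⊠-identityʳ (g zero))) (≈-trans (≈-sym (⊞-identityʳ _)) eq) } }

        Qk : Pol
        Qk = c k ⊠ Q ^p k

        -- The factor c_k Q^k stands between x′^k and the term c_k x^k. Dividing by it gives the
        -- target at x′^k for which this term cancels c_0.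
        divided : ∃ λ γ → ∀ {f} → f ∈G M → ⟦ γ ⟧ (Qk ⊠ f) ≡ neg 1f · ⟦ β ⟧ (c 0 ⊠ f)
        divided = divide (⊠-≉0 c-k≉0 (^p-≉0 k Q≉0)) (scaleLin (neg 1f) (c 0 ▷ β)) M

        γ : Lin
        γ = proj₁ divided

        choose : ∀ {X : Set} → Dec X → Fin n → Lin
        choose (yes _) zero    = γ
        choose (yes _) (suc _) = zeroLin
        choose (no _)  _       = zeroLin

        target : A.Targets 1
        target i _ j = choose (j ℕₚ.≟ k) i

        target-k : ∀ a → ⟦ target zero zero k ⟧ a ≡ ⟦ γ ⟧ a
        target-k a = onYes (k ℕₚ.≟ k)
          where
          onYes : (dec : Dec (k ≡ k)) → ⟦ choose dec zero ⟧ a ≡ ⟦ γ ⟧ a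
          onYes (yes _) = refl
          onYes (no k≢k) = contradiction refl k≢k

        target-≢ : ∀ i {j} → j ≢ k → ∀ a → ⟦ target i zero j ⟧ a ≡ 0f
        target-≢ i {j} j≢k a = onNo (j ℕₚ.≟ k)
          where
          onNo : (dec : Dec (j ≡ k)) → ⟦ choose dec i ⟧ a ≡ 0f
          onNo (yes j≡k) = contradiction j≡k j≢k
          onNo (no _)    = refl

        attained : ∃ λ x → x ∈G (b * M) × A.Solves system trivialMonomial (A.V monomials) D (level q) target x
        attained = proj₂ (proj₂ (A.attainable D 1 (level q)) 1) 1≤M (≤-trans (m≤m+n (α₀ m q) _) α≤b) system
          (λ g dg rel → reg g (λ i → G-≤ (*-monoˡ-≤ M (m≤m+n (α₀ m q) _)) (dg i)) rel) monomials target

        x′ x : Pol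
        x′ = proj₁ attained
        -- The family is closed under roots only up to the factor Q, so each power of x is made to
        -- contain it.
        x = Q ⊠ x′

        x′-G : x′ ∈G (b * M)
        x′-G = proj₁ (proj₂ attained)

        solves : ∀ {d i j} → 1 ≤ j → ¬ (p ∣ j) → depth tail i ≤ d → j * p ^ d ≤ D → ∀ {a} → a ∈G (level q * M) →
          ⟦ functional tail i ⟧ (a ⊠ x′ ^p j) ≡ ⟦ target i zero j ⟧ a
        solves {d} {i} {j} 1≤j p∤j dep≤ jp≤D {a} da = trans (resp (functional tail i) (⊠-congˡ a (≈-sym (⊠-identityˡ (x′ ^p j)))))
          (proj₂ (proj₂ attained) {d} {i} {zero} {j} 1≤j (≤-trans (A.≤*p^ j d) jp≤D) p∤j dep≤ jp≤D tt da)

        x-G : x ∈G (scaleFactor * M)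
        x-G = G-≤ (≤-trans (≤-reflexive (sym (*-distribʳ-+ M q b))) (*-monoˡ-≤ M (≤-trans (+-monoʳ-≤ q b≤) (≤-trans (regular≤span m q) ≤scale)))) (G-⊠ Q-G x′-G)
          where
          b≤ : b ≤ (P + (P * b + 1)) + suc D * b
          b≤ = ≤-trans (m≤m+n b (D * b)) (m≤n+m (suc D * b) (P + (P * b + 1)))

        Q^-G : ∀ {j} → j ≤ D → Q ^p j ∈G ((D * q + 1) * M)
        Q^-G {j} j≤D = G-≤ (get (⊑-mono (⊑-+ (⊑-* j (⊑-unit q)) (⊑-const 1)) (+-monoˡ-≤ 1 (*-monoˡ-≤ q j≤D)))) (G-^p j Q-G)

        atK : ∀ {A} → A ∈G M → ⟦ β ⟧ (A ⊠ (c k ⊠ x ^p k)) ≡ neg 1f · ⟦ β ⟧ (c 0 ⊠ A)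
        atK {A} dA = begin
          ⟦ β ⟧ (A ⊠ (c k ⊠ x ^p k)) ≡⟨ resp β (≈-trans (⊠-congˡ A (≈-trans (⊠-congˡ (c k) (^p-distrib-⊠ Q x′ k)) (≈-sym (⊠-assoc (c k) _ _)))) (≈-sym (⊠-assoc A Qk _))) ⟩
          ⟦ β ⟧ (A ⊠ Qk ⊠ x′ ^p k) ≡⟨ δ[0,0] _ ⟨
          ⟦ functional tail zero ⟧ (A ⊠ Qk ⊠ x′ ^p k) ≡⟨ solves {0} {zero} 1≤k (proj₁ (proj₂ k∈K*)) z≤n (≤-trans (≤-reflexive (ℕₚ.*-identityʳ k)) (∈⇒≤sum k∈𝒦)) AQk-G ⟩
          ⟦ target zero zero k ⟧ (A ⊠ Qk) ≡⟨ target-k (A ⊠ Qk) ⟩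
          ⟦ γ ⟧ (A ⊠ Qk) ≡⟨ resp γ (⊠-comm A Qk) ⟩
          ⟦ γ ⟧ (Qk ⊠ A) ≡⟨ proj₂ divided dA ⟩
          neg 1f · ⟦ β ⟧ (c 0 ⊠ A) ∎
          where
          open ≡-Reasoning
          AQk-G : A ⊠ Qk ∈G (level q * M)
          AQk-G = G-≤ (get (⊑-mono (⊑-+ M⊑1 (⊑-+ M⊑1 (⊑-unit (D * q + 1)))) (m≤n+m _ (closureBound D q 2))))
                      (G-⊠ dA (G-⊠ (cᵣ-G k∈𝒦) (Q^-G (∈⇒≤sum k∈𝒦))))

        -- By the definition of K* no r ≠ k in 𝒦 has the form p^e k, so all other conditions have target zero.
        notK : ∀ {r e j} → r ∈ 𝒦 → r ≢ k → r ≡ j * p ^ e → j ≢ k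
        notK {r} {zero} {j} r∈ r≢k r≡ refl = r≢k (trans r≡ (ℕₚ.*-identityʳ j))
        notK {r} {suc e} {j} r∈ r≢k r≡ refl = proj₂ (proj₂ k∈K*) (suc e) (s≤s z≤n)
          (subst (1 ≤_) r≡′ (All.lookup positive r∈) , r , r∈ , λ p∣ → <⇒≱ {1} 1<p (∣⇒≤ (subst (p ∣_) (trans (cong (r C_) (sym r≡′)) (nCn≡1 r)) p∣)))
          where
          r≡′ : r ≡ p ^ suc e * j
          r≡′ = trans r≡ (ℕₚ.*-comm j (p ^ suc e))

        -- With r = j p^e and p not dividing j, the term is the p^e-th power of a combination of
        -- conditions on x′^j. Since j ≠ k, all of these have target zero.
        elsewhere : ∀ {A r} → A ∈G M → r ∈ 𝒦 → r ≢ k → ⟦ β ⟧ (A ⊠ (c r ⊠ x ^p r)) ≡ 0f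
        elsewhere {A} {r} dA r∈ r≢k = byPrimePart (primePart pr r (All.lookup positive r∈))
          where
          byPrimePart : (∃ λ e → ∃ λ j → 1 ≤ j × ¬ (p ∣ j) × r ≡ j * p ^ e) → ⟦ β ⟧ (A ⊠ (c r ⊠ x ^p r)) ≡ 0f
          byPrimePart (e , j , 1≤j , p∤j , r≡) = begin
            ⟦ β ⟧ (A ⊠ (c r ⊠ x ^p r)) ≡⟨ resp β (≈-trans (≈-sym (⊠-assoc A (c r) _)) (⊠-congˡ A′ (≈-trans (^p-congʳ x r≡) (≈-sym (^p-assocʳ x j (p ^ e)))))) ⟩
            ⟦ β ⟧ (A′ ⊠ (x ^p j) ^p (p ^ e)) ≡⟨ δ[0,0] _ ⟨
            ⟦ functional tail zero ⟧ (A′ ⊠ (x ^p j) ^p (p ^ e)) ≡⟨ Λ-^ e (A′ ▷ functional tail zero) (x ^p j) ⟨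
            ⟦ μ ⟧ (x ^p j) ^f (p ^ e) ≡⟨ cong (_^f (p ^ e)) (trans (resp μ x^j) (trans (proj₂ (proj₂ (proj₂ closed)) z-G) (sumf-zero λ i → summand i (proj₁ (proj₂ (proj₂ closed)) i)))) ⟩
            0f ^f (p ^ e) ≡⟨ 0^f (p ^ e) (0<p^ e) ⟩
            0f ∎
            where
            open ≡-Reasoning
            A′ z : Pol
            A′ = A ⊠ c r
            z = Q ^p (j ∸ 1) ⊠ x′ ^p j
            μ : Lin
            μ = Λ e (A′ ▷ functional tail zero)
            r≤D : j * p ^ e ≤ D
            r≤D = subst (_≤ D) r≡ (∈⇒≤sum r∈)
            j≤D : j ≤ D
            j≤D = ≤-trans (A.≤*p^ j e) r≤D
            x^j : x ^p j ≈ Q ⊠ z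
            x^j = ≈-trans (^p-distrib-⊠ Q x′ j) (≈-trans (⊠-cong (^p-congʳ Q (sym (ℕₚ.m+[n∸m]≡n 1≤j))) (≈-refl {x′ ^p j})) (⊠-assoc Q (Q ^p (j ∸ 1)) (x′ ^p j)))
            A′-G : A′ ∈G (2 * M)
            A′-G = G-≤ (get (⊑-+ M⊑1 M⊑1)) (G-⊠ dA (cᵣ-G r∈))
            z-G : z ∈G ((suc D * b) * M)
            z-G = G-≤ (get (⊑-mono (⊑-+ (⊑-unit (D * q + 1)) (⊑-+ (⊑-* j (⊑-unit b)) (⊑-const 1))) bound)) (G-⊠ (Q^-G (≤-trans (m∸n≤m j 1) j≤D)) (G-^p j x′-G))
              where
              bound : (D * q + 1) + (j * b + 1) ≤ suc D * b
              bound = ≤-trans (≤-reflexive (begin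
                (D * q + 1) + (j * b + 1) ≡⟨ cong (D * q + 1 +_) (ℕₚ.+-comm (j * b) 1) ⟩
                (D * q + 1) + (1 + j * b) ≡⟨ ℕₚ.+-assoc (D * q + 1) 1 (j * b) ⟨
                (D * q + 1 + 1) + j * b ≡⟨ cong (_+ j * b) (ℕₚ.+-assoc (D * q) 1 1) ⟩
                (D * q + 2) + j * b ∎))
                (ℕₚ.+-mono-≤ (≤-trans (≤-trans (m≤m+n (D * q + 2) 2) (m≤n+m _ (α₀ m q))) α≤b) (*-monoˡ-≤ b j≤D))
            closed : ∃ λ (β′ : Fin n → Pol) → (∀ i → β′ i ∈G (closureBound D q 2 * M)) × (∀ i → depth tail i ≤ e ⊎ β′ i ≈ []) ×
              (∀ {f} → f ∈G ((suc D * b) * M) → ⟦ μ ⟧ (Q ⊠ f) ≡ sumf (λ i → ⟦ functional tail i ⟧ (β′ i ⊠ f)))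
            closed = family-closed S 1≤M zero e (≤-trans (≤-trans (m≤n+m 2 (D * q + 2)) (m≤n+m _ (α₀ m q))) α≤b) (A.depth≤L 1≤j r≤D) A′-G
            summand : ∀ i → depth tail i ≤ e ⊎ proj₁ closed i ≈ [] → ⟦ functional tail i ⟧ (proj₁ closed i ⊠ z) ≡ 0f
            summand i (inj₂ β≈[]) = lin-≈[] (functional tail i) (≈-trans (⊠-cong β≈[] (≈-refl {z})) (⊠-zeroˡ z))
            summand i (inj₁ dep≤) = trans (resp (functional tail i) (≈-sym (⊠-assoc (proj₁ closed i) (Q ^p (j ∸ 1)) (x′ ^p j))))
              (trans (solves {e} {i} 1≤j p∤j dep≤ r≤D (G-≤ (get (⊑-mono (⊑-+ (⊑-unit (closureBound D q 2)) (⊑-unit (D * q + 1))) (+-monoʳ-≤ (closureBound D q 2) (m≤n+m (D * q + 1) 2))))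
                        (G-⊠ (proj₁ (proj₂ closed) i) (Q^-G (≤-trans (m∸n≤m j 1) j≤D)))))
                     (target-≢ i (notK {r} {e} {j} r∈ r≢k r≡) _))

        goal : Goal
        goal = x , x-G , λ {i} i<M → let dA = G-≤ i<M (G-tpow i) in begin
          ⟦ β ⟧ (tpow i ⊠ evaluate 𝒦 c x) ≡⟨ lin-evaluate-1 (tpow i ▷ β) c x unique k∈𝒦 (λ r∈ r≢k → elsewhere dA r∈ r≢k) ⟩
          ⟦ β ⟧ (tpow i ⊠ (c k ⊠ x ^p k)) ∔ ⟦ β ⟧ (tpow i ⊠ c 0) ≡⟨ cong₂ _∔_ (atK dA) (resp β (⊠-comm (tpow i) (c 0))) ⟩
          neg 1f · ⟦ β ⟧ (c 0 ⊠ tpow i) ∔ ⟦ β ⟧ (c 0 ⊠ tpow i) ≡⟨ cong (_∔ ⟦ β ⟧ (c 0 ⊠ tpow i)) (trans (sym (neg-distribˡ-· 1f _)) (cong neg (·-identityˡ _))) ⟩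
          neg (⟦ β ⟧ (c 0 ⊠ tpow i)) ∔ ⟦ β ⟧ (c 0 ⊠ tpow i) ≡⟨ neg-inverseˡ _ ⟩
          0f ∎
          where open ≡-Reasoning

      solution : Goal
      solution = fromOutcome (regularize (suc D * P) 1 (initial 1≤M scaleFactor))
        where
        fromOutcome : Outcome M scaleFactor → Goal
        fromOutcome (approximable a g g≉0 a≤ dg rel) = fromApproximation a g g≉0 a≤ dg rel
        fromOutcome (regular m q S ≤scale reg) = FromRegular.goal m q S ≤scale reg

theorem1p4 : (F : FiniteField) (p : ℕ) → Prime p → HasCharacteristic F p →
    (𝒦 : List ℕ) → Unique 𝒦 → All (1 ≤_) 𝒦 →
    ∃ λ a → ∃ λ b → (1 ≤ a) × (1 ≤ b) ×
    ((c : ℕ → Poly F) →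
    (∀ r → r ∈ 𝒦 → NonZeroPoly F (c r)) →
    (∃ λ k → InKStar p 𝒦 k × NonZeroPoly F (c k)) →
    (∀ g d → HasDegree F g d →
    ∃ λ m → InG F d m × PolyDivides F g (evalH F 𝒦 c m)) →
    ∃ λ N₀ → (1 ≤ N₀) ×
    (∀ N → N₀ < N → (β : Laurent F) →
    ∃ λ x → InG F N x × FracOrdLe F β (evalH F 𝒦 c x) a b N))
theorem1p4 F p pr charp 𝒦 unique positive = 1 , scaleFactor , s≤s z≤n , 1≤scaleFactor ,
  λ { c _ (k , k∈K* , c-k) intersective →
      -- For N beyond this value, M = N / `scaleFactor` exceeds the lengths of the coefficients of
      -- h; N₀ depends on h in this way only.
      suc (coefficientBound 𝒦 c) * scaleFactor , ℕₚ.*-mono-≤ {1} {suc (coefficientBound 𝒦 c)} {1} {scaleFactor} (s≤s z≤n) 1≤scaleFactor ,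
      λ N N₀<N β → fractionalParts c N β (N / scaleFactor) refl
        (Polynomial.AtScale.solution c k k∈K* c-k intersective (N / scaleFactor)
          (≤-quotient (suc (coefficientBound 𝒦 c)) (<⇒≤ N₀<N)) (residue (Laurent.lc β))) }
  where
  open Conclusion F p pr charp 𝒦 unique positive
  open LaurentFunctionals F using (residue; residue-tpow; mulCoeff-cong; evaluate; evalH≈evaluate; coefficientBound)
  instance
    scaleFactor-nonZero : ℕ.NonZero scaleFactor
    scaleFactor-nonZero = ℕ.>-nonZero 1≤scaleFactor
  ≤-quotient : ∀ i {N} → i * scaleFactor ≤ N → i ≤ N / scaleFactor
  ≤-quotient i {N} h = ≤-trans (≤-reflexive (sym (m*n/n≡m i scaleFactor))) (/-monoˡ-≤ scaleFactor h)
  fractionalParts : ∀ c N (β : Laurent F) M → M ≡ N / scaleFactor →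
    (∃ λ x → x ∈G (scaleFactor * M) × (∀ {i} → i < M → ⟦ residue (Laurent.lc β) ⟧ (tpow i ⊠ evaluate 𝒦 c x) ≡ 0f)) →
    ∃ λ x → InG F N x × FracOrdLe F β (evalH F 𝒦 c x) 1 scaleFactor N
  fractionalParts c N β M refl (x , x-G , zero-at) =
    x , vanish (G-≤ (≤-trans (≤-reflexive (ℕₚ.*-comm scaleFactor M)) (m/n*n≤m N scaleFactor)) x-G) ,
    λ { zero () ; (suc i) _ h → trans (mulCoeff-cong (Laurent.lc β) (evalH≈evaluate 𝒦 c x) _)
        (trans (residue-tpow (Laurent.lc β) i _) (zero-at (≤-quotient (suc i)
          (≤-trans (≤-reflexive (ℕₚ.*-comm (suc i) scaleFactor)) (≤-trans (<⇒≤ h) (≤-reflexive (ℕₚ.+-identityʳ N))))))) }
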